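{- Let $G$ be a finite simple graph with maximum degree $\Delta=\Delta(G)$ that is Class 1 (i.e. $\chi'(G)=\Delta(G)$), and suppose that $G$ is triangle-free or chordless. Then any two proper $(\Delta(G)+1)$-edge-colorings of $G$ are $K$-equivalent.
   Context: A (proper) $t$-coloring of a graph $G$ is a map $\alpha:E(G)\to\{1,\dots,t\}$ such that adjacent edges receive distinct colors; $\chi'(G)$ is the least $t$ for which a $t$-coloring exists. Given a proper edge coloring and two distinct colors $c,d$, a Kempe chain is a connected component of the subgraph formed by the edges colored $c$ or $d$ (a maximal connected bicolored subgraph); a $K$-change (Kempe change) consists of selecting a Kempe chain and swapping the two colors on its edges. Two $t$-colorings of $G$ are $K$-equivalent if one can be obtained from the other by a finite sequence of $K$-changes using only colors from $\{1,\dots,t\}$. A graph is chordless if no cycle $C$ of $G$ has a chord, i.e. an edge of $G$ joining two nonconsecutive vertices of $C$. -}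

module Defs where

open import Data.Nat using (ℕ; zero; suc; _+_; _⊔_; _≤_; _<_; _∸_)
open import Data.Fin using (Fin; toℕ)
open import Data.Bool using (Bool; true; false; T; if_then_else_)
open import Data.List using (List; map; foldr; allFin)
open import Data.Nat.ListAction using (sum)
open import Data.Product using (Σ; ∃; _×_; _,_)
open import Data.Sum using (_⊎_)
open import Data.Empty using (⊥)
open import Relation.Nullary using (¬_)
open import Relation.Binary.PropositionalEquality using (_≡_; _≢_)
open import Relation.Binary.Construct.Closure.ReflexiveTransitive using (Star)
open import Function.Definitions using (Injective)

record Graph (n : ℕ) : Set where
  field
    adj   : Fin n → Fin n → Bool
    sym   : ∀ u v → adj u v ≡ adj v u
    irrefl : ∀ v → adj v v ≡ false

module _ {n : ℕ} (G : Graph n) where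
  open Graph G

  Adj : Fin n → Fin n → Set
  Adj u v = T (adj u v)

  degree : Fin n → ℕ
  degree v = sum (map (λ w → if adj v w then 1 else 0) (allFin n))

  maxDegree : ℕ
  maxDegree = foldr _⊔_ 0 (map degree (allFin n))

  record Edge : Set where
    constructor edge
    field
      lo hi : Fin n
      lo<hi : toℕ lo < toℕ hi
      isEdge : Adj lo hi

  open Edge

  ShareEnd : Edge → Edge → Set
  ShareEnd e f = (lo e ≡ lo f ⊎ lo e ≡ hi f) ⊎ (hi e ≡ lo f ⊎ hi e ≡ hi f)

  SameEdge : Edge → Edge → Set
  SameEdge e f = lo e ≡ lo f × hi e ≡ hi f

  AdjEdges : Edge → Edge → Set
  AdjEdges e f = ¬ SameEdge e f × ShareEnd e f

  EdgeMap : ℕ → Set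
  EdgeMap t = Edge → Fin t

  Proper : {t : ℕ} → EdgeMap t → Set
  Proper α = ∀ e f → AdjEdges e f → α e ≢ α f

  IsChromaticIndex : ℕ → Set
  IsChromaticIndex k =
    (Σ (EdgeMap k) Proper) × (∀ t → Σ (EdgeMap t) Proper → k ≤ t)

  InPair : {t : ℕ} → Fin t → Fin t → Fin t → Set
  InPair c d x = x ≡ c ⊎ x ≡ d

  
  -- KChain α c d e f : f lies in the Kempe chain (component of the
  -- subgraph of edges coloured c or d) containing the edge e.
  data KChain {t : ℕ} (α : EdgeMap t) (c d : Fin t) (e : Edge) : Edge → Set where
    here : InPair c d (α e) → KChain α c d e e
    step : ∀ {f g} → KChain α c d e f → ShareEnd f g → InPair c d (α g) →
           KChain α c d e g

  KChange : {t : ℕ} → EdgeMap t → EdgeMap t → Set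
  KChange {t} α β =
    Σ (Fin t) λ c → Σ (Fin t) λ d → c ≢ d × Σ Edge λ e →
      ∀ f → (KChain α c d e f → (α f ≡ c → β f ≡ d) × (α f ≡ d → β f ≡ c))
          × (¬ KChain α c d e f → β f ≡ α f)

  KEquivalent : {t : ℕ} → EdgeMap t → EdgeMap t → Set
  KEquivalent {t} α β =
    Σ (EdgeMap t) λ γ → Star KChange α γ × (∀ f → γ f ≡ β f)

  TriangleFree : Set
  TriangleFree = ∀ u v w → Adj u v → Adj v w → Adj u w → ⊥

  Consecutive : {k : ℕ} → Fin k → Fin k → Set
  Consecutive {k} i j =
    (toℕ j ≡ suc (toℕ i) ⊎ toℕ i ≡ suc (toℕ j))
    ⊎ ((toℕ i ≡ 0 × toℕ j ≡ k ∸ 1) ⊎ (toℕ j ≡ 0 × toℕ i ≡ k ∸ 1))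

  record Cycle (k : ℕ) : Set where
    field
      len≥3 : 3 ≤ k
      vtx : Fin k → Fin n
      distinct : Injective _≡_ _≡_ vtx
      closed : ∀ i j → Consecutive i j → Adj (vtx i) (vtx j)

  Chordless : Set
  Chordless = ∀ k (C : Cycle k) → ∀ i j → i ≢ j → ¬ Consecutive i j →
              ¬ Adj (Cycle.vtx C i) (Cycle.vtx C j)

{-# OPTIONS --safe #-}
-- Triangle-free and chordless graphs share a property that passes to subgraphs: in a triangle every edge is a
-- bridge once the opposite vertex is deleted (NoDetour).  For graphs with this property it is shown by induction
-- on k that a (k+1)-colouring C is equivalent to every k-colouring γ.  Let M be the last colour class of γ.  If
-- the class of the last colour s in C contains M, give this class the colour s in γ too, delete it, and induct.
-- Otherwise some uv in M does not have colour s.  If va has colour s, a Vizing fan at a starting with v frees v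
-- from s: the fan ends, or a Kempe chain avoiding s makes it end, or it closes at a vertex missing s and is
-- rotated.  Doing this at v and then at u lets uv take the colour s; the second step leaves v free because v is
-- not adjacent to the pivot, and in a triangle a Kempe chain does the job.
--
-- Rotation of a fan is the heart of the matter (the star lemma): colourings C and D that differ only at the edges
-- of one vertex v are equivalent.  One inducts on the number of edges vu with different colours, applying Kempe
-- changes to C and to D simultaneously.  If no edge at v can be recoloured directly, the colours at v are permuted;
-- let v miss m, and let vu change from c to e.  If the (m , e)-chain of u avoids v, or its (c , e)-chain avoids
-- the vertex z for which vz is to receive c, swapping chains reduces the number of differences.  Otherwise these chains
-- are under control, and a fan at u starting from colour m, whose vertices are not affected by the permutation
-- because of NoDetour, can be turned so that vu takes the colour m in both colourings.
module Submission where

open import Data.Nat using (ℕ; zero; suc; _+_; _≤_; _<_; z≤n; s≤s; _∸_)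
import Data.Nat as ℕ
import Data.Nat.Properties as ℕₚ
open import Data.Bool using (Bool; true; false; not; _∧_; _∨_; if_then_else_; T)
import Data.Bool.Properties as Boolₚ
open import Data.Fin using (Fin; zero; suc; toℕ; fromℕ<)
import Data.Fin as Fin
import Data.Fin.Properties as Finₚ
open import Data.List using (List; []; _∷_; map; lookup; length)
open import Data.List.Membership.Propositional using (_∈_; _∉_)
import Data.List.Membership.DecPropositional as DecMembership
open import Data.List.Membership.Propositional.Properties using (∈-lookup)
open import Data.List.Relation.Unary.All using (All; []; _∷_)
import Data.List.Relation.Unary.All as All
open import Data.List.Relation.Unary.Any using (here; there)
open import Data.Maybe using (Maybe; just; nothing; is-just)
import Data.Maybe as Maybe
import Data.Maybe.Properties as Maybeₚ
open import Data.Product using (∃-syntax; _×_; _,_; proj₁; proj₂)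
open import Data.Sum using (_⊎_; inj₁; inj₂; [_,_]′)
import Data.Sum as Sum
open import Data.Empty using (⊥; ⊥-elim)
open import Data.Unit using (tt)
open import Function using (_∘_; id; case_of_)
open import Relation.Nullary using (¬_; Dec; yes; no; does; contradiction)
open import Relation.Nullary.Decidable using (_×-dec_; _⊎-dec_; dec-true; dec-false; ¬?)
open import Relation.Binary.PropositionalEquality
  using (_≡_; _≢_; refl; sym; trans; cong; cong₂; subst; subst₂; ≢-sym)
open import Relation.Binary.Construct.Closure.ReflexiveTransitive using (Star; ε; _◅_; _◅◅_)
import Relation.Binary.Construct.Closure.ReflexiveTransitive as Star
open import Relation.Binary using (Rel; Decidable; tri<; tri≈; tri>)
open import Level using (0ℓ)
open import Defs using (Graph; maxDegree; Edge; edge; EdgeMap; Proper; IsChromaticIndex; InPair; KChain; here; step;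
  KChange; KEquivalent; TriangleFree; Chordless; Cycle; Consecutive; Adj; ShareEnd; SameEdge)

-- Kempe changes are described by vertex sets: a set that no edge of colour c or d leaves is a union
-- of chains (single vertices included), so complements and differences of chains can be swapped in
-- one move. That `γ` uses only k of the k+1 colours matters twice. By pigeonhole every vertex
-- misses a colour in every (k+1)-colouring, so a fan can always be continued; and in the induction
-- both palettes lose one colour together. A closed fan is the obstacle: none of its vertices need
-- share a missing colour with the pivot, so there may be no edge with which to begin the shift, and
-- the rotation is a sequence of legal moves only if a further colour is lent. The star lemma
-- removes the loan, because a rotation changes nothing but edges at the pivot. Within the star
-- lemma, every move in C has to be mirrored in D by a set that is closed there too and coincides
-- with the first one almost everywhere. C and D disagree about which chains run through v, so the
-- links between v, u and z must be known before anything is swapped.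

-- Finite vertex sets

VSet : ℕ → Set
VSet n = Fin n → Bool

true≢false : true ≢ false
true≢false ()

opaque

  holds : ∀ {P : Set} → Dec P → Bool
  holds = does

  holds-true : ∀ {P : Set} (d : Dec P) → P → holds d ≡ true
  holds-true = dec-true

  holds-inv : ∀ {P : Set} (d : Dec P) → holds d ≡ true → P
  holds-inv (yes p) _ = p

count : ∀ {n} → VSet n → ℕ
count {zero}  S = 0
count {suc n} S = (if S zero then 1 else 0) + count (S ∘ suc)

private
  bit-mono : ∀ a b → (a ≡ true → b ≡ true) → (if a then 1 else 0) ≤ (if b then 1 else 0)
  bit-mono false b h = z≤n
  bit-mono true  b h rewrite h refl = ℕₚ.≤-refl

count-mono : ∀ {n} {S U : VSet n} → (∀ x → S x ≡ true → U x ≡ true) → count S ≤ count U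
count-mono {zero}          h = z≤n
count-mono {suc n} {S} {U} h = ℕₚ.+-mono-≤ (bit-mono (S zero) (U zero) (h zero)) (count-mono (h ∘ suc))

count-strict : ∀ {n} {S U : VSet n} → (∀ x → S x ≡ true → U x ≡ true) →
               ∀ x → S x ≡ false → U x ≡ true → count S < count U
count-strict {suc n} {S} {U} h zero sx ux rewrite sx | ux = s≤s (count-mono (h ∘ suc))
count-strict {suc n} {S} {U} h (suc x) sx ux = ℕₚ.≤-trans (ℕₚ.≤-reflexive (sym (ℕₚ.+-suc _ _)))
  (ℕₚ.+-mono-≤ (bit-mono (S zero) (U zero) (h zero)) (count-strict (h ∘ suc) x sx ux))

opaque

  insert : ∀ {n} → Fin n → VSet n → VSet n
  insert v S x = if does (x Fin.≟ v) then true else S x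

  remove : ∀ {n} → Fin n → VSet n → VSet n
  remove v S x = if does (x Fin.≟ v) then false else S x

  ∁ : ∀ {n} → VSet n → VSet n
  ∁ S x = not (S x)

  _∖_ : ∀ {n} → VSet n → VSet n → VSet n
  (S ∖ U) x = S x ∧ not (U x)

  insert-here : ∀ {n} (v : Fin n) S → insert v S v ≡ true
  insert-here v S rewrite dec-true (v Fin.≟ v) refl = refl

  insert-there : ∀ {n} {v x : Fin n} {S} → x ≢ v → insert v S x ≡ S x
  insert-there {v = v} {x} x≢v rewrite dec-false (x Fin.≟ v) x≢v = refl

  insert-⊆ : ∀ {n} {v x : Fin n} {S} → S x ≡ true → insert v S x ≡ true
  insert-⊆ {v = v} {x} sx with x Fin.≟ v
  ... | yes _ = refl
  ... | no  _ = sx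

  insert-inv : ∀ {n} {v x : Fin n} {S} → insert v S x ≡ true → x ≡ v ⊎ S x ≡ true
  insert-inv {v = v} {x} e with x Fin.≟ v
  ... | yes p = inj₁ p
  ... | no  _ = inj₂ e

  remove-here : ∀ {n} (v : Fin n) S → remove v S v ≡ false
  remove-here v S rewrite dec-true (v Fin.≟ v) refl = refl

  remove-there : ∀ {n} {v x : Fin n} {S} → x ≢ v → remove v S x ≡ S x
  remove-there {v = v} {x} x≢v rewrite dec-false (x Fin.≟ v) x≢v = refl

  ∁-true : ∀ {n} {S : VSet n} {x} → S x ≡ false → ∁ S x ≡ true
  ∁-true sx rewrite sx = refl

  ∁-false : ∀ {n} {S : VSet n} {x} → S x ≡ true → ∁ S x ≡ false
  ∁-false sx rewrite sx = refl

  ∁-inv : ∀ {n} {S : VSet n} {x} → ∁ S x ≡ true → S x ≡ false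
  ∁-inv {S = S} {x} e with S x
  ... | false = refl

  ∁-cong : ∀ {n} {S : VSet n} {x y} → S x ≡ S y → ∁ S x ≡ ∁ S y
  ∁-cong = cong not

  ∖-⊆ : ∀ {n} {S U : VSet n} {x} → (S ∖ U) x ≡ true → S x ≡ true
  ∖-⊆ {S = S} {x = x} e with S x
  ... | true = refl

  ∖-∉ : ∀ {n} {S U : VSet n} {x} → U x ≡ true → (S ∖ U) x ≡ false
  ∖-∉ {S = S} {x = x} e rewrite e = Boolₚ.∧-zeroʳ (S x)

  ∖-off : ∀ {n} {S U : VSet n} {x} → U x ≡ false → (S ∖ U) x ≡ S x
  ∖-off {S = S} {x = x} e rewrite e = Boolₚ.∧-identityʳ (S x)

  ∖-cong : ∀ {n} {S U : VSet n} {x y} → S x ≡ S y → U x ≡ U y → (S ∖ U) x ≡ (S ∖ U) y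
  ∖-cong p q = cong₂ (λ a b → a ∧ not b) p q

triple-inv : ∀ {n} {a b c x : Fin n} → insert a (insert b (insert c (λ _ → false))) x ≡ true → x ≡ a ⊎ x ≡ b ⊎ x ≡ c
triple-inv x∈ with insert-inv x∈
... | inj₁ h = inj₁ h
... | inj₂ x∈′ with insert-inv x∈′
...   | inj₁ h = inj₂ (inj₁ h)
...   | inj₂ x∈″ with insert-inv x∈″
...     | inj₁ h = inj₂ (inj₂ h)

bool-ext : ∀ {a b : Bool} → (a ≡ true → b ≡ true) → (b ≡ true → a ≡ true) → a ≡ b
bool-ext {true}  {b}     f g = sym (f refl)
bool-ext {false} {false} f g = refl
bool-ext {false} {true}  f g = g refl

-- Components of a decidable relation

module _ {n : ℕ} {R : Rel (Fin n) 0ℓ} where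

  record Component (x : Fin n) : Set where
    field
      mem     : VSet n
      root    : mem x ≡ true
      closed  : ∀ {y z} → mem y ≡ true → R y z → mem z ≡ true
      reached : ∀ {y} → mem y ≡ true → Star R x y

  opaque

    component : Decidable R → ∀ x → Component x
    component R? x = grow _ (insert x (λ _ → false)) (ℕₚ.n<1+n _) (insert-here x (λ _ → false)) base
      where
      base : ∀ {y} → insert x (λ _ → false) y ≡ true → Star R x y
      base eq with insert-inv eq
      ... | inj₁ refl = ε
      -- `p` is fuel: it exceeds the number of vertices outside `S`, and every round adds one of
      -- them.
      grow : ∀ p S → count (∁ S) < p → S x ≡ true → (∀ {y} → S y ≡ true → Star R x y) → Component x
      grow (suc p) S (s≤s le) sx reach
        with Finₚ.any? (λ y → Finₚ.any? (λ z → (S y Boolₚ.≟ true) ×-dec R? y z ×-dec (S z Boolₚ.≟ false)))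
      ... | no none = record
        { mem = S ; root = sx ; reached = reach
        ; closed = λ {y} {z} sy r → Boolₚ.¬-not (λ sz → none (y , z , sy , r , sz)) }
      ... | yes (y , z , sy , r , sz) = grow p (insert z S)
                (ℕₚ.<-≤-trans (count-strict sub z (∁-false (insert-here z S)) (∁-true sz)) le)
                (insert-⊆ sx) reach′
        where
        sub : ∀ w → ∁ (insert z S) w ≡ true → ∁ S w ≡ true
        sub w e = ∁-true (Boolₚ.¬-not (λ sw → true≢false (trans (sym (insert-⊆ sw)) (∁-inv e))))
        reach′ : ∀ {w} → insert z S w ≡ true → Star R x w
        reach′ {w} e with insert-inv e
        ... | inj₁ refl = reach sy ◅◅ (r ◅ ε)
        ... | inj₂ sw   = reach sw

  spread : ∀ {x y z} (K : Component x) → Component.mem K y ≡ true → Star R y z → Component.mem K z ≡ true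
  spread K y∈ ε        = y∈
  spread K y∈ (r ◅ rs) = spread K (Component.closed K y∈ r) rs

-- The transposition of two colours

abstract

  exchange : ℕ → ℕ → ℕ → ℕ
  exchange c d e = if does (e ℕ.≟ c) then d else (if does (e ℕ.≟ d) then c else e)

  exchange-l : ∀ c d → exchange c d c ≡ d
  exchange-l c d rewrite dec-true (c ℕ.≟ c) refl = refl

  exchange-r : ∀ c d → exchange c d d ≡ c
  exchange-r c d with d ℕ.≟ c
  ... | yes refl = exchange-l c c
  ... | no p rewrite dec-false (d ℕ.≟ c) p | dec-true (d ℕ.≟ d) refl = refl

  exchange-fix : ∀ {c d e} → e ≢ c → e ≢ d → exchange c d e ≡ e
  exchange-fix {c} {d} {e} p q rewrite dec-false (e ℕ.≟ c) p | dec-false (e ℕ.≟ d) q = refl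

  exchange-invol : ∀ c d e → exchange c d (exchange c d e) ≡ e
  exchange-invol c d e with e ℕ.≟ c
  ... | yes refl = trans (cong (exchange c d) (exchange-l c d)) (exchange-r c d)
  ... | no e≢c with e ℕ.≟ d
  ...   | yes refl = trans (cong (exchange c d) (exchange-r c d)) (exchange-l c d)
  ...   | no e≢d   = trans (cong (exchange c d) (exchange-fix e≢c e≢d)) (exchange-fix e≢c e≢d)

  exchange-same : ∀ c e → exchange c c e ≡ e
  exchange-same c e with e ℕ.≟ c
  ... | yes refl = exchange-l c c
  ... | no p     = exchange-fix p p

  exchange-< : ∀ {c d e k} → c < k → d < k → e < k → exchange c d e < k
  exchange-< {c} {d} {e} p q r with e ℕ.≟ c
  ... | yes refl = subst (_< _) (sym (exchange-l c d)) q
  ... | no e≢c with e ℕ.≟ d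
  ...   | yes refl = subst (_< _) (sym (exchange-r c d)) p
  ...   | no e≢d   = subst (_< _) (sym (exchange-fix e≢c e≢d)) r

map-exchange : ∀ {c d e} (a : Maybe ℕ) → Maybe.map (exchange c d) a ≡ just e → a ≡ just (exchange c d e)
map-exchange {c} {d} (just f) refl = cong just (sym (exchange-invol c d f))

-- Colourings, closed sets and Kempe equivalence

opaque

  _≟ᴹ_ : (a b : Maybe ℕ) → Dec (a ≡ b)
  _≟ᴹ_ = Maybeₚ.≡-dec ℕ._≟_

-- nothing marks a non-edge.
Colouring : ℕ → Set
Colouring n = Fin n → Fin n → Maybe ℕ

module _ {n : ℕ} where

  infix 4 _≐_
  _≐_ : Colouring n → Colouring n → Set
  C ≐ D = ∀ x y → C x y ≡ D x y

  -- A record instead of the bare function type, so that unification recovers `C`, `x` and `c`;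
  -- `Closed` and `AgreeOff` are wrapped for the same reason.
  record Misses (C : Colouring n) (x : Fin n) (c : ℕ) : Set where
    constructor missing
    field
      absent : ∀ y → C x y ≢ just c

  open Misses public

  sees? : ∀ (C : Colouring n) x c → (∃[ y ] C x y ≡ just c) ⊎ Misses C x c
  sees? C x c with Finₚ.any? (λ y → C x y ≟ᴹ just c)
  ... | yes p = inj₁ p
  ... | no ¬p = inj₂ (missing (λ y e → ¬p (y , e)))

  Bicoloured : Colouring n → ℕ → ℕ → Rel (Fin n) 0ℓ
  Bicoloured C c d x y = C x y ≡ just c ⊎ C x y ≡ just d

  bicoloured? : ∀ C c d → Decidable (Bicoloured C c d)
  bicoloured? C c d x y = (C x y ≟ᴹ just c) ⊎-dec (C x y ≟ᴹ just d)

  -- Such a set is a union of components of the graph of edges coloured `c` or `d`. Phrased as an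
  -- equality of Booleans, the condition passes at once to complements and differences.
  record Closed (C : Colouring n) (c d : ℕ) (S : VSet n) : Set where
    constructor closed
    field
      same-side : ∀ {x y} → Bicoloured C c d x y → S x ≡ S y

  open Closed public

  record IsProper (C : Colouring n) : Set where
    field
      symm : ∀ x y → C x y ≡ C y x
      uniq : ∀ {x y z c} → C x y ≡ just c → C x z ≡ just c → y ≡ z

    flip : ∀ {x y c} → C x y ≡ just c → C y x ≡ just c
    flip {x} {y} e = trans (symm y x) e

    flip-bi : ∀ {c d x y} → Bicoloured C c d x y → Bicoloured C c d y x
    flip-bi = Sum.map flip flip

  symm-closed : ∀ {C c d S} → (∀ {x y} → Bicoloured C c d x y → Bicoloured C c d y x) →
                (∀ {x y} → S x ≡ true → Bicoloured C c d x y → S y ≡ true) → Closed C c d S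
  symm-closed s h = closed (λ b → bool-ext (λ e → h e b) (λ e → h e (s b)))

  chain : ∀ C c d x → Component {R = Bicoloured C c d} x
  chain C c d x = component (bicoloured? C c d) x

  chain-closed : ∀ {C c d x} → IsProper C → (K : Component {R = Bicoloured C c d} x) →
                 Closed C c d (Component.mem K)
  chain-closed P K = symm-closed (IsProper.flip-bi P) (Component.closed K)

  ∁-closed : ∀ {C c d S} → Closed C c d S → Closed C c d (∁ S)
  ∁-closed h = closed (∁-cong ∘ same-side h)

  ∖-closed : ∀ {C c d S U} → Closed C c d S → Closed C c d U → Closed C c d (S ∖ U)
  ∖-closed h l = closed (λ b → ∖-cong (same-side h b) (same-side l b))

  opaque

    -- Only the first endpoint is tested, so the result is symmetric because `S` is closed; see
    -- `swap-proper`.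
    swap : ℕ → ℕ → VSet n → Colouring n → Colouring n
    swap c d S C x y = if S x then Maybe.map (exchange c d) (C x y) else C x y

  module _ {c d : ℕ} {S : VSet n} {C : Colouring n} where

    opaque
      unfolding swap

      swap-in : ∀ {x} y → S x ≡ true → swap c d S C x y ≡ Maybe.map (exchange c d) (C x y)
      swap-in y e rewrite e = refl

      swap-out : ∀ {x} y → S x ≡ false → swap c d S C x y ≡ C x y
      swap-out y e rewrite e = refl

      swap-just : ∀ {x y e} → S x ≡ true → swap c d S C x y ≡ just e → C x y ≡ just (exchange c d e)
      swap-just {x} {y} s eq = map-exchange (C x y) (trans (sym (swap-in y s)) eq)

      swap-in-just : ∀ {x y e} → S x ≡ true → C x y ≡ just e → swap c d S C x y ≡ just (exchange c d e)
      swap-in-just s eq rewrite s | eq = refl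

      swap-fix : ∀ {x y} → C x y ≢ just c → C x y ≢ just d → swap c d S C x y ≡ C x y
      swap-fix {x} {y} p q with S x
      ... | false = refl
      ... | true with C x y
      ...   | nothing = refl
      ...   | just e  = cong just (exchange-fix (p ∘ cong just) (q ∘ cong just))

      swap-keep : ∀ {x y e} → e ≢ c → e ≢ d → C x y ≡ just e → swap c d S C x y ≡ just e
      swap-keep {x} {y} {e} p q eq =
        trans (swap-fix {x} {y} (p ∘ Maybeₚ.just-injective ∘ trans (sym eq))
                                (q ∘ Maybeₚ.just-injective ∘ trans (sym eq))) eq

      swap-kept : ∀ {x y e} → e ≢ c → e ≢ d → swap c d S C x y ≡ just e → C x y ≡ just e
      swap-kept {x} {y} {e} p q eq with S x in s
      ... | false = eq
      ... | true = trans (map-exchange (C x y) eq) (cong just (exchange-fix p q))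

      swap-bi : ∀ {x y} → Bicoloured (swap c d S C) c d x y → Bicoloured C c d x y
      swap-bi {x} {y} b with S x in s
      ... | false = b
      ... | true  = [ (λ e → inj₂ (trans (map-exchange (C x y) e) (cong just (exchange-l c d))))
                    , (λ e → inj₁ (trans (map-exchange (C x y) e) (cong just (exchange-r c d)))) ]′ b

      swap-closed : ∀ {U} → Closed C c d U → Closed (swap c d S C) c d U
      swap-closed h = closed (same-side h ∘ swap-bi)

      swap-invol : swap c d S (swap c d S C) ≐ C
      swap-invol x y with S x
      ... | false = refl
      ... | true with C x y
      ...   | nothing = refl
      ...   | just e  = cong just (exchange-invol c d e)

      swap-is-just : ∀ x y → is-just (swap c d S C x y) ≡ is-just (C x y)
      swap-is-just x y with S x
      ... | false = refl
      ... | true with C x y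
      ...   | nothing = refl
      ...   | just e  = refl

      swap-proper : IsProper C → Closed C c d S → IsProper (swap c d S C)
      swap-proper P cl = record { symm = sy ; uniq = un }
        where
        open IsProper P
        sy : ∀ x y → swap c d S C x y ≡ swap c d S C y x
        sy x y with bicoloured? C c d x y
        ... | yes b rewrite same-side cl b | symm x y = refl
        ... | no ¬b = trans (swap-fix (¬b ∘ inj₁) (¬b ∘ inj₂)) (trans (symm x y)
                (sym (swap-fix (¬b ∘ inj₁ ∘ trans (symm x y)) (¬b ∘ inj₂ ∘ trans (symm x y)))))
        un : ∀ {x y z e} → swap c d S C x y ≡ just e → swap c d S C x z ≡ just e → y ≡ z
        un {x} {y} {z} p q with S x in s
        ... | true  = uniq (map-exchange (C x y) p) (map-exchange (C x z) q)
        ... | false = uniq p q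

  swap-agree : ∀ {c d S U C D x y} → S x ≡ U x → C x y ≡ D x y → swap c d S C x y ≡ swap c d U D x y
  swap-agree {S = S} {U} {x = x} {y} s e with S x in sx
  ... | true  = trans (swap-in y sx) (trans (cong (Maybe.map _) e) (sym (swap-in y (sym s))))
  ... | false = trans (swap-out y sx) (trans e (sym (swap-out y (sym s))))

  module _ {c d : ℕ} {S : VSet n} {C : Colouring n} where

    misses-in : ∀ {x e} → S x ≡ true → Misses C x (exchange c d e) → Misses (swap c d S C) x e
    misses-in s h = missing (λ y eq → absent h y (swap-just s eq))

    misses-out : ∀ {x e} → S x ≡ false → Misses C x e → Misses (swap c d S C) x e
    misses-out s h = missing (λ y eq → absent h y (trans (sym (swap-out y s)) eq))

    misses-keep : ∀ {x e} → e ≢ c → e ≢ d → Misses C x e → Misses (swap c d S C) x e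
    misses-keep p q h = missing (λ y eq → absent h y (swap-kept p q eq))

  -- One `kempe` step may swap several chains at once; `realise` later splits it into single Kempe
  -- changes. `pointwise` takes the place of function extensionality.
  data _⊢_≈_ (k : ℕ) : Colouring n → Colouring n → Set where
    pointwise : ∀ {C D} → C ≐ D → k ⊢ C ≈ D
    kempe     : ∀ {C} c d S → c < k → d < k → Closed C c d S → k ⊢ C ≈ swap c d S C
    transᴷ    : ∀ {C D E} → k ⊢ C ≈ D → k ⊢ D ≈ E → k ⊢ C ≈ E

  reflᴷ : ∀ {k C} → k ⊢ C ≈ C
  reflᴷ = pointwise (λ _ _ → refl)

  symᴷ : ∀ {k C D} → k ⊢ C ≈ D → k ⊢ D ≈ C
  symᴷ (pointwise e)         = pointwise (λ x y → sym (e x y))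
  symᴷ (kempe c d S p q cl)  = transᴷ (kempe c d S p q (swap-closed cl)) (pointwise swap-invol)
  symᴷ (transᴷ p q)          = transᴷ (symᴷ q) (symᴷ p)

  record IsColouring (A : Fin n → Fin n → Bool) (k : ℕ) (C : Colouring n) : Set where
    field
      proper  : IsProper C
      support : ∀ x y → is-just (C x y) ≡ A x y
      bounded : ∀ {x y c} → C x y ≡ just c → c < k
    open IsProper proper public

    adj : ∀ {x y c} → C x y ≡ just c → A x y ≡ true
    adj {x} {y} e = trans (sym (support x y)) (cong is-just e)

    colour : ∀ {x y} → A x y ≡ true → ∃[ c ] C x y ≡ just c
    colour {x} {y} a with C x y | support x y
    ... | just c  | _ = c , refl
    ... | nothing | e = contradiction (trans (sym a) (sym e)) true≢false

  open IsColouring public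

  ≐-colouring : ∀ {A k C D} → C ≐ D → IsColouring A k C → IsColouring A k D
  ≐-colouring e P = record
    { proper = record
      { symm = λ x y → trans (sym (e x y)) (trans (symm P x y) (e y x))
      ; uniq = λ {x} {y} {z} p q → uniq P (trans (e x y) p) (trans (e x z) q) }
    ; support = λ x y → trans (cong is-just (sym (e x y))) (support P x y)
    ; bounded = λ {x} {y} p → bounded P (trans (e x y) p) }

  swap-colouring : ∀ {A k C c d S} → c < k → d < k → Closed C c d S →
                   IsColouring A k C → IsColouring A k (swap c d S C)
  swap-colouring {C = C} {c} {d} {S} p q cl P = record
    { proper = swap-proper (proper P) cl
    ; support = λ x y → trans (swap-is-just x y) (support P x y)
    ; bounded = bd }
    where
    bd : ∀ {x y e} → swap c d S C x y ≡ just e → e < _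
    bd {x} {y} {e} eq with S x in s
    ... | false = bounded P (trans (sym (swap-out y s)) eq)
    ... | true  = subst (_< _) (exchange-invol c d e) (exchange-< p q (bounded P (swap-just s eq)))

  ≈-colouring : ∀ {A k C D} → k ⊢ C ≈ D → IsColouring A k C → IsColouring A k D
  ≈-colouring (pointwise e) P        = ≐-colouring e P
  ≈-colouring (kempe c d S p q cl) P = swap-colouring p q cl P
  ≈-colouring (transᴷ r s) P         = ≈-colouring s (≈-colouring r P)

module _ {n : ℕ} where

  -- Ends of Kempe chains

  End : Colouring n → ℕ → ℕ → Fin n → Set
  End C c d x = Misses C x c ⊎ Misses C x d

  -- Alternating C x c d l u e f : the walk of length l that leaves x along colour d and alternates
  -- between c and d has arrived at u along colour f and is to leave along colour e.
  data Alternating (C : Colouring n) (x : Fin n) (c d : ℕ) : ℕ → Fin n → ℕ → ℕ → Set where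
    start  : Alternating C x c d 0 x d c
    extend : ∀ {l u w e f} → Alternating C x c d l u e f → C u w ≡ just e →
             Alternating C x c d (suc l) w f e

  module _ {C : Colouring n} (P : IsProper C) where
    private module Pr = IsProper P

    alternating-colours : ∀ {x c d l u e f} → Alternating C x c d l u e f →
                          (e ≡ d × f ≡ c) ⊎ (e ≡ c × f ≡ d)
    alternating-colours start        = inj₁ (refl , refl)
    alternating-colours (extend w _) = Sum.map (λ (p , q) → q , p) (λ (p , q) → q , p)
                                        (Sum.swap (alternating-colours w))

    alternating-unique : ∀ {x c d l u w e f e′ f′} → Alternating C x c d l u e f →
                         Alternating C x c d l w e′ f′ → u ≡ w × e ≡ e′ × f ≡ f′
    alternating-unique start start = refl , refl , refl
    alternating-unique (extend p a) (extend q b) with alternating-unique p q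
    ... | refl , refl , refl = Pr.uniq a b , refl , refl

    alternating-prefix : ∀ {x c d l z e f m} → Alternating C x c d l z e f → m < l →
                         ∃[ u ] ∃[ e′ ] ∃[ f′ ] ∃[ w ] Alternating C x c d m u e′ f′ × C u w ≡ just e′
    alternating-prefix {m = m} (extend {l} p a) (s≤s m≤l) with m ℕ.≟ l
    ... | yes refl = _ , _ , _ , _ , p , a
    ... | no m≢l   = alternating-prefix p (ℕₚ.≤∧≢⇒< m≤l m≢l)

    -- At a visited vertex one of the two colours leads on and the other leads one step back. At the
    -- start, going back would need colour `c`, which `x` misses.
    alternating-step : ∀ {x c d l u w e f} → Misses C x c → Alternating C x c d l u e f →
                       Bicoloured C c d u w →
                       ∃[ l′ ] ∃[ e′ ] ∃[ f′ ] Alternating C x c d l′ w e′ f′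
    alternating-step {x} {c} {d} {l} {u} {w} {e} {f} xc p b = [ forth , back p ]′ (split (alternating-colours p) b)
      where
      split : (e ≡ d × f ≡ c) ⊎ (e ≡ c × f ≡ d) → Bicoloured C c d u w → C u w ≡ just e ⊎ C u w ≡ just f
      split (inj₁ (refl , refl)) = Sum.swap
      split (inj₂ (refl , refl)) = id
      forth : C u w ≡ just e → _
      forth a = _ , _ , _ , extend p a
      back : ∀ {l u e f} → Alternating C x c d l u e f → C u w ≡ just f →
             ∃[ l′ ] ∃[ e′ ] ∃[ f′ ] Alternating C x c d l′ w e′ f′
      back start a = contradiction a (absent xc w)
      back (extend q a′) a with Pr.uniq (Pr.flip a′) a
      ... | refl = _ , _ , _ , q

    alternating-star : ∀ {x c d u y l e f} → Misses C x c → Alternating C x c d l u e f →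
                       Star (Bicoloured C c d) u y →
                       ∃[ l′ ] ∃[ e′ ] ∃[ f′ ] Alternating C x c d l′ y e′ f′
    alternating-star xc p ε = _ , _ , _ , p
    alternating-star xc p (b ◅ bs) with alternating-step xc p b
    ... | _ , _ , _ , q = alternating-star xc q bs

    private
      inner-sees-both : ∀ {x c d l y e f w} → Alternating C x c d l y e f → y ≢ x → C y w ≡ just e →
                        ¬ End C c d y
      inner-sees-both start y≢x _ _ = y≢x refl
      inner-sees-both p@(extend _ a′) _ a end with alternating-colours p
      ... | inj₁ (refl , refl) = [ (λ h → absent h _ (Pr.flip a′)) , (λ h → absent h _ a) ]′ end
      ... | inj₂ (refl , refl) = [ (λ h → absent h _ a) , (λ h → absent h _ (Pr.flip a′)) ]′ end

      -- The alternating walk from `x` is determined by its length. Whichever of `y` and `z` it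
      -- reaches first it must leave again, and that vertex then sees both colours.
      two-ends : ∀ {x y z c d} → Misses C x c → End C c d y → End C c d z →
                 y ≢ x → z ≢ x → y ≢ z →
                 Star (Bicoloured C c d) x y → Star (Bicoloured C c d) x z → ⊥
      two-ends xc ey ez y≢x z≢x y≢z xy xz
        with alternating-star xc start xy | alternating-star xc start xz
      ... | i , _ , _ , p | j , _ , _ , q with ℕₚ.<-cmp i j
      ...   | tri≈ _ refl _ = y≢z (proj₁ (alternating-unique p q))
      ...   | tri< i<j _ _ with alternating-prefix q i<j
      ...     | _ , _ , _ , _ , p′ , a with alternating-unique p p′
      ...       | refl , refl , refl = inner-sees-both p y≢x a ey
      two-ends xc ey ez y≢x z≢x y≢z xy xz | i , _ , _ , p | j , _ , _ , q | tri> _ _ j<i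
        with alternating-prefix p j<i
      ... | _ , _ , _ , _ , q′ , a with alternating-unique q q′
      ...   | refl , refl , refl = inner-sees-both q z≢x a ez

      star-swap : ∀ {c d x y} → Star (Bicoloured C c d) x y → Star (Bicoloured C d c) x y
      star-swap ε        = ε
      star-swap (b ◅ bs) = Sum.swap b ◅ star-swap bs

    three-ends : ∀ {x y z c d} → End C c d x → End C c d y → End C c d z →
                 y ≢ x → z ≢ x → y ≢ z →
                 Star (Bicoloured C c d) x y → Star (Bicoloured C c d) x z → ⊥
    three-ends (inj₁ xc) ey ez p q r xy xz = two-ends xc ey ez p q r xy xz
    three-ends (inj₂ xd) ey ez p q r xy xz =
      two-ends xd (Sum.swap ey) (Sum.swap ez) p q r (star-swap xy) (star-swap xz)

  star-flip : ∀ {R : Rel (Fin n) 0ℓ} → (∀ {x y} → R x y → R y x) → ∀ {x y} → Star R x y → Star R y x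
  star-flip s ε        = ε
  star-flip s (r ◅ rs) = star-flip s rs ◅◅ (s r ◅ ε)

  -- Recolouring around a vertex

  opaque

    recolour : Colouring n → Fin n → Fin n → ℕ → Colouring n
    recolour C u w e x y =
      if (does (x Fin.≟ u) ∧ does (y Fin.≟ w)) ∨ (does (x Fin.≟ w) ∧ does (y Fin.≟ u))
      then just e else C x y

    restar : Colouring n → Fin n → (Fin n → Maybe ℕ) → Colouring n
    restar C u g x y = if does (x Fin.≟ u) then g y else (if does (y Fin.≟ u) then g x else C x y)

  module _ {C : Colouring n} {u : Fin n} where

    opaque
      unfolding recolour restar

      recolour-here : ∀ w e → recolour C u w e u w ≡ just e
      recolour-here w e rewrite dec-true (u Fin.≟ u) refl | dec-true (w Fin.≟ w) refl = refl

      recolour-here′ : ∀ w e → recolour C u w e w u ≡ just e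
      recolour-here′ w e rewrite dec-true (u Fin.≟ u) refl | dec-true (w Fin.≟ w) refl
        = cong (λ b → if b then just e else C w u) (Boolₚ.∨-zeroʳ (does (w Fin.≟ u) ∧ does (u Fin.≟ w)))

      recolour-off : ∀ {w e x y} → x ≢ u → y ≢ u → recolour C u w e x y ≡ C x y
      recolour-off {w} {x = x} {y} p q
        rewrite dec-false (x Fin.≟ u) p | dec-false (y Fin.≟ u) q | Boolₚ.∧-zeroʳ (does (x Fin.≟ w)) = refl

      recolour-at : ∀ {w e y} → y ≢ w → recolour C u w e u y ≡ C u y
      recolour-at {w} {y = y} p
        rewrite dec-true (u Fin.≟ u) refl | dec-false (y Fin.≟ w) p with u Fin.≟ w
      ... | no _  = refl
      ... | yes refl rewrite dec-false (y Fin.≟ u) p = refl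

      recolour-at′ : ∀ {w e y} → y ≢ u → recolour C u w e w y ≡ C w y
      recolour-at′ {w} {y = y} p
        rewrite dec-true (w Fin.≟ w) refl | dec-false (y Fin.≟ u) p with w Fin.≟ u
      ... | no _  = refl
      ... | yes refl rewrite dec-false (y Fin.≟ u) p = refl

      restar-at : ∀ {g} y → restar C u g u y ≡ g y
      restar-at y rewrite dec-true (u Fin.≟ u) refl = refl

      restar-at′ : ∀ {g} x → restar C u g x u ≡ g x
      restar-at′ x with x Fin.≟ u
      ... | yes refl = refl
      ... | no _ rewrite dec-true (u Fin.≟ u) refl = refl

      restar-off : ∀ {g x y} → x ≢ u → y ≢ u → restar C u g x y ≡ C x y
      restar-off {x = x} {y} p q rewrite dec-false (x Fin.≟ u) p | dec-false (y Fin.≟ u) q = refl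

    recolour-off₂ : ∀ {w e x} y → x ≢ u → x ≢ w → recolour C u w e x y ≡ C x y
    recolour-off₂ {w} {e} {x} y p q with y Fin.≟ u
    ... | no y≢u = recolour-off p y≢u
    ... | yes refl = off′ p q
      where
      opaque
        unfolding recolour
        off′ : ∀ {w e x} → x ≢ u → x ≢ w → recolour C u w e x u ≡ C x u
        off′ {w} {e} {x} p q rewrite dec-false (x Fin.≟ u) p | dec-false (x Fin.≟ w) q = refl

  -- Fans

  -- The list is in reverse order (its last entry has colour s); it pairs each neighbour with its new colour,
  -- which is the present colour of the entry before it.
  data Fan (f : Fin n → Maybe ℕ) (s : ℕ) : List (Fin n × ℕ) → Set where
    one  : ∀ {w b} → f w ≡ just s → Fan f s ((w , b) ∷ [])
    more : ∀ {w′ b w a ps} → f w′ ≡ just a → w′ ∉ map proj₁ ((w , a) ∷ ps) →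
           Fan f s ((w , a) ∷ ps) → Fan f s ((w′ , b) ∷ (w , a) ∷ ps)

  override : (Fin n → Maybe ℕ) → List (Fin n × ℕ) → Fin n → Maybe ℕ
  override f []             x = f x
  override f ((w , b) ∷ ps) x = if does (x Fin.≟ w) then just b else override f ps x

  override-tail : ∀ {f w b ps x} → x ≢ w → override f ((w , b) ∷ ps) x ≡ override f ps x
  override-tail {w = w} {x = x} p rewrite dec-false (x Fin.≟ w) p = refl

  override-∉ : ∀ {f ps x} → x ∉ map proj₁ ps → override f ps x ≡ f x
  override-∉ {ps = []} _ = refl
  override-∉ {ps = (w , b) ∷ ps} x∉ = trans (override-tail {ps = ps} (x∉ ∘ here)) (override-∉ {ps = ps} (x∉ ∘ there))

  override-cong : ∀ {f g} ps {x} → f x ≡ g x → override f ps x ≡ override g ps x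
  override-cong [] e = e
  override-cong ((w , b) ∷ ps) {x} e with does (x Fin.≟ w)
  ... | true  = refl
  ... | false = override-cong ps e

  fan-cong : ∀ {f g s ps} → (∀ {x} → x ∈ map proj₁ ps → f x ≡ g x) → Fan f s ps → Fan g s ps
  fan-cong h (one p)      = one (trans (sym (h (here refl))) p)
  fan-cong h (more p q F) = more (trans (sym (h (here refl))) p) q (fan-cong (h ∘ there) F)

  Free : Colouring n → Fin n × ℕ → Set
  Free C (w , a) = Misses C w a

  module _ {A : Fin n → Fin n → Bool} {k : ℕ} (irr : ∀ x → A x x ≡ false) where

    edge-≢ : ∀ {C x y c} → IsColouring A k C → C x y ≡ just c → x ≢ y
    edge-≢ {x = x} P e refl = true≢false (trans (sym (adj P e)) (irr x))

    -- As `e` is missing at both ends, the edge `uw` is a whole chain in its colour and `e`, with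
    -- vertex set {u, w}.
    recolour-≈ : ∀ {C u w c e} → IsColouring A k C → C u w ≡ just c →
                 Misses C u e → Misses C w e → e < k → k ⊢ C ≈ recolour C u w e
    recolour-≈ {C} {u} {w} {c} {e} P uw ue we e<k =
      transᴷ (kempe c e S (bounded P uw) e<k cl) (pointwise same)
      where
      S : VSet n
      S = insert u (insert w (λ _ → false))
      u∈ : S u ≡ true
      u∈ = insert-here u (insert w (λ _ → false))
      w∈ : S w ≡ true
      w∈ = insert-⊆ {v = u} {S = insert w (λ _ → false)} (insert-here w (λ _ → false))
      ∉S : ∀ {x} → x ≢ u → x ≢ w → S x ≡ false
      ∉S p q = trans (insert-there p) (insert-there q)
      members : ∀ {x} → S x ≡ true → x ≡ u ⊎ x ≡ w
      members sx with insert-inv sx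
      ... | inj₁ p = inj₁ p
      ... | inj₂ q with insert-inv q
      ...   | inj₁ p = inj₂ p
      out : ∀ {x y} → S x ≡ true → Bicoloured C c e x y → S y ≡ true
      out {x} {y} sx b with members sx | b
      ... | inj₁ refl | inj₁ q = subst (λ z → S z ≡ true) (uniq P uw q) w∈
      ... | inj₁ refl | inj₂ q = contradiction q (absent ue y)
      ... | inj₂ refl | inj₁ q = subst (λ z → S z ≡ true) (uniq P (flip P uw) q) u∈
      ... | inj₂ refl | inj₂ q = contradiction q (absent we y)
      cl : Closed C c e S
      cl = symm-closed (flip-bi P) out
      same : swap c e S C ≐ recolour C u w e
      same x y with x Fin.≟ u | x Fin.≟ w
      ... | no p | no q = trans (swap-out y (∉S p q)) (sym (recolour-off₂ y p q))
      ... | yes refl | _ with y Fin.≟ w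
      ...   | yes refl = trans (swap-in-just u∈ uw) (trans (cong just (exchange-l c e)) (sym (recolour-here w e)))
      ...   | no y≢w = trans (swap-fix (λ q → y≢w (uniq P q uw)) (absent ue y)) (sym (recolour-at y≢w))
      same x y | no p | yes refl with y Fin.≟ u
      ...   | yes refl = trans (swap-in-just w∈ (flip P uw))
                           (trans (cong just (exchange-l c e)) (sym (recolour-here′ w e)))
      ...   | no y≢u = trans (swap-fix (λ q → y≢u (uniq P q (flip P uw))) (absent we y)) (sym (recolour-at′ y≢u))

    -- Giving `b` to the edge of `w` releases its old colour at `u`, and this is the colour for
    -- which the next entry waits. The row `f` is separate from `C` so that a fan found in one
    -- colouring can be turned in any other that has the same row at `u`.
    turn : ∀ {f s w b ps C u} → Fan f s ((w , b) ∷ ps) → IsColouring A k C → (∀ x → C u x ≡ f x) →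
           All (Free C) ((w , b) ∷ ps) → (∀ x → f x ≢ just b) → b < k →
           k ⊢ C ≈ restar C u (override f ((w , b) ∷ ps)) ×
           (∀ x → override f ((w , b) ∷ ps) x ≢ just s)
    turn {f} {s} {w} {b} {ps} {C} {u} F P Cu (wb ∷ miss) fb b<k = result F miss
      where
      C₁ : Colouring n
      C₁ = recolour C u w b
      C≈C₁ : ∀ {a} → f w ≡ just a → k ⊢ C ≈ C₁
      C≈C₁ fw = recolour-≈ P (trans (Cu w) fw) (missing (λ x e → fb x (trans (sym (Cu x)) e))) wb b<k
      restar-≐ : ∀ {qs g} → (∀ x → C₁ u x ≡ g x) → w ∉ map proj₁ qs → ∀ x y →
                 restar C₁ u (override g qs) x y ≡ restar C u (override f ((w , b) ∷ qs)) x y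
      restar-≐ {qs} {g} h w∉ x y = cases (x Fin.≟ u) (y Fin.≟ u)
        where
        at : ∀ x → override g qs x ≡ override f ((w , b) ∷ qs) x
        at x with x Fin.≟ w
        ... | yes refl = trans (override-∉ {ps = qs} w∉) (trans (sym (h w)) (recolour-here w b))
        ... | no x≢w   = override-cong qs (trans (sym (h x)) (trans (recolour-at x≢w) (Cu x)))
        cases : Dec (x ≡ u) → Dec (y ≡ u) → restar C₁ u (override g qs) x y ≡ restar C u (override f ((w , b) ∷ qs)) x y
        cases (yes refl) _ = trans (restar-at y) (trans (at y) (sym (restar-at y)))
        cases (no p) (yes refl) = trans (restar-at′ x) (trans (at x) (sym (restar-at′ x)))
        cases (no p) (no q) = trans (restar-off p q) (trans (recolour-off p q) (sym (restar-off p q)))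
      result : ∀ {ps} → Fan f s ((w , b) ∷ ps) → All (Free C) ps →
               k ⊢ C ≈ restar C u (override f ((w , b) ∷ ps)) × (∀ x → override f ((w , b) ∷ ps) x ≢ just s)
      result (one fw) [] = transᴷ (C≈C₁ fw) (transᴷ (pointwise (λ x y → sym (restar-C₁ x y)))
                                            (pointwise (restar-≐ {[]} (λ _ → refl) λ ())))
                         , unseen
        where
        restar-C₁ : ∀ x y → restar C₁ u (C₁ u) x y ≡ C₁ x y
        restar-C₁ x y with x Fin.≟ u | y Fin.≟ u
        ... | yes refl | _ = restar-at y
        ... | no p | yes refl = trans (restar-at′ x) (symm (≈-colouring (C≈C₁ fw) P) u x)
        ... | no p | no q = restar-off p q
        unseen : ∀ x → override f ((w , b) ∷ []) x ≢ just s
        unseen x e with x Fin.≟ w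
        ... | yes refl = fb w (trans fw (sym e))
        ... | no x≢w = x≢w (uniq P (trans (Cu x) e) (trans (Cu w) fw))
      result (more {w = w₁} {a} {ps} fw w∉ F) (m ∷ ms) =
        transᴷ (C≈C₁ fw) (transᴷ (proj₁ rec) (pointwise (restar-≐ {(w₁ , a) ∷ ps} (λ _ → refl) w∉)))
        , λ x e → proj₂ rec x (trans (override-C₁ x) e)
        where
        P₁ : IsColouring A k C₁
        P₁ = ≈-colouring (C≈C₁ fw) P
        f-C₁ : ∀ {x} → x ∈ map proj₁ ((w₁ , a) ∷ ps) → f x ≡ C₁ u x
        f-C₁ x∈ = sym (trans (recolour-at (λ { refl → w∉ x∈ })) (Cu _))
        still : ∀ {x c} → x ≢ w → x ≢ u → Misses C x c → Misses C₁ x c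
        still p q h = missing (λ y e → absent h y (trans (sym (recolour-off₂ y q p)) e))
        fan-≢u : ∀ {qs} → Fan f s qs → All (λ q → proj₁ q ≢ u) qs
        fan-≢u (one p) = (λ { refl → edge-≢ P (trans (Cu _) p) refl }) ∷ []
        fan-≢u (more p _ G) = (λ { refl → edge-≢ P (trans (Cu _) p) refl }) ∷ fan-≢u G
        lift : ∀ {qs} → w ∉ map proj₁ qs → All (λ q → proj₁ q ≢ u) qs → All (Free C) qs → All (Free C₁) qs
        lift w∉ [] [] = []
        lift w∉ (p ∷ ps) (h ∷ hs) = still (λ { refl → w∉ (here refl) }) p h ∷ lift (w∉ ∘ there) ps hs
        fb₁ : ∀ x → C₁ u x ≢ just a
        fb₁ x e with x Fin.≟ w
        ... | yes refl = fb w (trans fw (trans (sym e) (recolour-here w b)))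
        ... | no x≢w = x≢w (uniq P (trans (sym (recolour-at x≢w)) e) (trans (Cu w) fw))
        rec : k ⊢ C₁ ≈ restar C₁ u (override (C₁ u) ((w₁ , a) ∷ ps)) ×
              (∀ x → override (C₁ u) ((w₁ , a) ∷ ps) x ≢ just s)
        rec = turn (fan-cong f-C₁ F) P₁ (λ _ → refl) (lift w∉ (fan-≢u F) (m ∷ ms)) fb₁
                   (bounded P (trans (Cu w) fw))
        override-C₁ : ∀ x → override (C₁ u) ((w₁ , a) ∷ ps) x ≡ override f ((w , b) ∷ (w₁ , a) ∷ ps) x
        override-C₁ x = trans (sym (restar-at {C = C₁} x)) (trans (restar-≐ {(w₁ , a) ∷ ps} (λ _ → refl) w∉ u x) (restar-at x))

-- Fans with repetitions and the ways in which they end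

Inner : ℕ → ℕ → ℕ → Set
Inner c s a = a ≢ s × a ≢ c

Inner₃ : ℕ → ℕ → ℕ → ℕ → Set
Inner₃ c s x a = Inner c s a × a ≢ x

module _ {n : ℕ} where

  -- Fans that may repeat vertices, so that they can be concatenated.
  data Walk (C : Colouring n) (u : Fin n) (ok : ℕ → Set) (s : ℕ) : Fin n → Set where
    begin : ∀ {w} → C u w ≡ just s → Walk C u ok s w
    next  : ∀ {w w′ a} → Walk C u ok s w → Misses C w a → ok a → C u w′ ≡ just a → Walk C u ok s w′

  walk-colour : ∀ {C u ok s w} → Walk C u ok s w → ∃[ a ] C u w ≡ just a × (a ≡ s ⊎ ok a)
  walk-colour (begin e)      = _ , e , inj₁ refl
  walk-colour (next _ _ o e) = _ , e , inj₂ o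

  walk-source : ∀ {C u ok s w} → Walk C u ok s w → ∃[ y ] C u y ≡ just s
  walk-source (begin e)      = _ , e
  walk-source (next p _ _ _) = walk-source p

  walk-map : ∀ {C C′ u ok ok′ s s′ w} → (∀ {w} → C u w ≡ just s → C′ u w ≡ just s′) →
             (∀ {w w′ a} → ok a → Misses C w a → C u w′ ≡ just a → Misses C′ w a × ok′ a × C′ u w′ ≡ just a) →
             Walk C u ok s w → Walk C′ u ok′ s′ w
  walk-map f g (begin e) = begin (f e)
  walk-map f g (next p m o e) with g o m e
  ... | m′ , o′ , e′ = next (walk-map f g p) m′ o′ e′

  walk-weaken : ∀ {C u ok ok′ s w} → (∀ {a} → ok a → ok′ a) → Walk C u ok s w → Walk C u ok′ s w
  walk-weaken f = walk-map id (λ o m e → m , f o , e)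

  walk-join : ∀ {C u ok s t p q} → Walk C u ok s p → Misses C p t → ok t → Walk C u ok t q → Walk C u ok s q
  walk-join p m o (begin e)         = next p m o e
  walk-join p m o (next q m′ o′ e)  = next (walk-join p m o q) m′ o′ e

  _∈?_ : ∀ (x : Fin n) xs → Dec (x ∈ xs)
  _∈?_ = DecMembership._∈?_ Fin._≟_

  Visited : Colouring n → Fin n → (ℕ → Set) → ℕ → Fin n × ℕ → Set
  Visited C u ok s (x , a) = Walk C u ok s x × Misses C x a × ok a

  cut : ∀ {f s w′ w b ps} {Q : Fin n × ℕ → Set} → w′ ∈ map proj₁ ((w , b) ∷ ps) → Fan f s ((w , b) ∷ ps) → All Q ps →
        ∃[ qs ] (∀ b′ → Fan f s ((w′ , b′) ∷ qs)) × All Q qs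
  cut (here refl) (one e) [] = [] , (λ _ → one e) , []
  cut (here refl) (more e ∉ps F) qs = _ , (λ _ → more e ∉ps F) , qs
  cut (there i) (more e ∉ps F) (q ∷ qs) = cut i F qs

  -- If the new vertex already occurs, the loop is cut out. Every entry retains the walk that
  -- reached it, from which its colour and its place in the graph are read off later.
  walk-fan : ∀ {C u ok s w} → Walk C u ok s w →
             ∃[ ps ] (∀ b → Fan (C u) s ((w , b) ∷ ps)) × All (Visited C u ok s) ps
  walk-fan (begin e) = [] , (λ _ → one e) , []
  walk-fan (next {w} {w′} {a} p m o e) with walk-fan p
  ... | ps , F , vs with w′ ∈? (w ∷ map proj₁ ps)
  ...   | yes w′∈ = cut w′∈ (F a) vs
  ...   | no w′∉  = (w , a) ∷ ps , (λ _ → more e w′∉ (F a)) , (p , m , o) ∷ vs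

  -- The colour `c` is barred from the walk: in the star lemma it is the colour of the edge between
  -- `v` and the pivot, elsewhere it is `s` itself. A `fork` arises when the trail would run back
  -- into itself: `q` is its last vertex, and `p` precedes the vertex to which the edge of colour
  -- `x` leads.
  data Outcome (k : ℕ) (C : Colouring n) (u : Fin n) (c s : ℕ) : Set where
    escape : ∀ {w b} → Walk C u (Inner c s) s w → Misses C w b → b < k → Misses C u b → Outcome k C u c s
    blocked : ∀ {w} → Walk C u (Inner c s) s w → Misses C w c → Outcome k C u c s
    loop   : ∀ {w} → Walk C u (Inner c s) s w → Misses C w s → Outcome k C u c s
    fork   : ∀ {p q x} → p ≢ q → x ≢ s → x ≢ c →
             Walk C u (Inner₃ c s x) s p → Misses C p x →
             Walk C u (Inner₃ c s x) x q → Misses C q x → Outcome k C u c s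

  module _ {k : ℕ} {C : Colouring n} (P : IsProper C)
           (room : ∀ x → ∃[ m ] m < k × Misses C x m) (u : Fin n) (c s : ℕ) where
    private
      module Pr = IsProper P

      data Trail : List (Fin n) → Set where
        one  : ∀ {w} → C u w ≡ just s → Trail (w ∷ [])
        more : ∀ {w ws w′ a} → Misses C w a → Inner c s a → C u w′ ≡ just a → w′ ∉ w ∷ ws →
               Trail (w ∷ ws) → Trail (w′ ∷ w ∷ ws)

      trail-walk : ∀ {w ws} → Trail (w ∷ ws) → Walk C u (Inner c s) s w
      trail-walk (one e)          = begin e
      trail-walk (more m o e _ t) = next (trail-walk t) m o e

      trail-avoids : ∀ {x y w ws} → C u y ≡ just x → y ∉ w ∷ ws → Trail (w ∷ ws) → Walk C u (Inner₃ c s x) s w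
      trail-avoids uy y∉ (one e) = begin e
      trail-avoids uy y∉ (more m o e _ t) =
        next (trail-avoids uy (y∉ ∘ there) t) m (o , λ { refl → y∉ (here (Pr.uniq uy e)) }) e

      -- The trail came to `y` from a vertex `p` missing the colour `x` of `uy`, so `p` and the last
      -- vertex miss the same colour. Before `p` no step uses `x`, since only `y` carries it.
      split : ∀ {x y w ws} → C u y ≡ just x → x ≢ s → y ∈ w ∷ ws → Trail (w ∷ ws) →
              ∃[ p ] p ∈ w ∷ ws × p ≢ w × Walk C u (Inner₃ c s x) s p × Misses C p x × Walk C u (Inner₃ c s x) x w
      split uy x≢s (here refl) (one e) = contradiction (Maybeₚ.just-injective (trans (sym uy) e)) x≢s
      split uy x≢s (here refl) (more {w} m o e y∉ t) with Maybeₚ.just-injective (trans (sym e) uy)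
      ... | refl = w , there (here refl) , (λ { refl → y∉ (here refl) }) , trail-avoids uy y∉ t , m , begin uy
      split uy x≢s (there y∈) (more m o e w∉ t) with split uy x≢s y∈ t
      ... | p , p∈ , _ , sp , px , xw =
        p , there p∈ , (λ { refl → w∉ p∈ }) , sp , px , next xw m (o , λ { refl → w∉ (subst (_∈ _) (Pr.uniq uy e) y∈) }) e

      run : ∀ p V {w ws} → count (∁ V) < p → (∀ {x} → V x ≡ true → x ∈ w ∷ ws) → Trail (w ∷ ws) → Outcome k C u c s
      run (suc p) V {w} {ws} (s≤s le) V⊆ t with room w
      ... | a , a<k , wa with a ℕ.≟ s | a ℕ.≟ c | sees? C u a
      ...   | yes refl | _ | _ = loop (trail-walk t) wa
      ...   | no _ | yes refl | _ = blocked (trail-walk t) wa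
      ...   | no _ | no _ | inj₂ ua = escape (trail-walk t) wa a<k ua
      ...   | no a≢s | no a≢c | inj₁ (y , uy) with y ∈? (w ∷ ws)
      ...     | yes y∈ with split uy a≢s y∈ t
      ...       | p , _ , p≢w , sp , pa , aw = fork p≢w a≢s a≢c sp pa aw wa
      run (suc p) V {w} {ws} (s≤s le) V⊆ t | a , a<k , wa | no a≢s | no a≢c | inj₁ (y , uy) | no y∉ =
        run p (insert y V) (ℕₚ.<-≤-trans (count-strict sub y (∁-false (insert-here y V)) (∁-true (Boolₚ.¬-not (y∉ ∘ V⊆)))) le)
            V⊆′ (more wa (a≢s , a≢c) uy y∉ t)
        where
        sub : ∀ x → ∁ (insert y V) x ≡ true → ∁ V x ≡ true
        sub x e = ∁-true (Boolₚ.¬-not (λ v → true≢false (trans (sym (insert-⊆ v)) (∁-inv e))))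
        V⊆′ : ∀ {x} → insert y V x ≡ true → x ∈ y ∷ w ∷ ws
        V⊆′ e with insert-inv e
        ... | inj₁ refl = here refl
        ... | inj₂ v    = there (V⊆ v)

    explore : ∀ {w} → C u w ≡ just s → Outcome k C u c s
    explore e = run _ (λ _ → false) (ℕₚ.n<1+n _) (λ ()) (one e)

-- Walks that avoid a vertex, and detours around an edge of a triangle

Avoiding : ∀ {n} → Rel (Fin n) 0ℓ → Fin n → Rel (Fin n) 0ℓ
Avoiding R z a b = R a b × a ≢ z × b ≢ z

module _ {n : ℕ} {R : Rel (Fin n) 0ℓ} where

  -- Cut the walk after its last visit to `x`: the next vertex can only be `w`.
  leave : ∀ {x w a y} → (∀ {b} → R x b → b ≡ w) → y ≢ x → Star R a y →
          (Star (Avoiding R x) a y × a ≢ x) ⊎ Star (Avoiding R x) w y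
  leave only y≢x ε = inj₁ (ε , y≢x)
  leave {x} {a = a} only y≢x (r ◅ rs) with leave only y≢x rs
  ... | inj₂ st = inj₂ st
  ... | inj₁ (st , a′≢x) with a Fin.≟ x
  ...   | no a≢x   = inj₁ ((r , a≢x , a′≢x) ◅ st , a≢x)
  ...   | yes refl with only r
  ...     | refl = inj₂ st

  leave-root : ∀ {x w y} → (∀ {b} → R x b → b ≡ w) → y ≢ x → Star R x y → Star (Avoiding R x) w y
  leave-root only y≢x st with leave only y≢x st
  ... | inj₁ (_ , x≢x) = contradiction refl x≢x
  ... | inj₂ st′       = st′

  meet : ∀ b {a y} → Star R a y → Star (Avoiding R b) a y ⊎ Star R a b
  meet b ε = inj₁ ε
  meet b {a} (_◅_ {j = a′} r rs) with a Fin.≟ b | a′ Fin.≟ b | meet b rs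
  ... | yes refl | _ | _ = inj₂ ε
  ... | no _ | yes refl | _ = inj₂ (r ◅ ε)
  ... | no _ | no _ | inj₂ st = inj₂ (r ◅ st)
  ... | no p | no q | inj₁ st = inj₁ ((r , p , q) ◅ st)

Detour : ∀ {n} → (Fin n → Fin n → Bool) → Fin n → Fin n → Fin n → Rel (Fin n) 0ℓ
Detour A x y z a b = (A a b ≡ true × a ≢ z × b ≢ z) × ¬ (a ≡ x × b ≡ y) × ¬ (a ≡ y × b ≡ x)

-- Every edge of a triangle is a bridge once the opposite vertex is deleted.  This is what
-- triangle-free and chordless graphs have in common, and it passes to subgraphs.
NoDetour : ∀ {n} → (Fin n → Fin n → Bool) → Set
NoDetour A = ∀ {x y z} → A x y ≡ true → A y z ≡ true → A x z ≡ true → ¬ Star (Detour A x y z) x y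

collect : ∀ {n} {Q : Set} {P : Fin n → Set} → (∀ t → Q ⊎ P t) → Q ⊎ (∀ t → P t)
collect {zero}  h = inj₂ λ ()
collect {suc n} h with h zero | collect (h ∘ suc)
... | inj₁ q | _      = inj₁ q
... | inj₂ _ | inj₁ q = inj₁ q
... | inj₂ p | inj₂ f = inj₂ λ { zero → p ; (suc t) → f t }

Roomy : ∀ {n} → (Fin n → Fin n → Bool) → ℕ → Set
Roomy A k = ∀ {C} → IsColouring A k C → ∀ x → ∃[ m ] m < k × Misses C x m

-- The star lemma: colourings that differ only at one vertex

module StarLemma {n : ℕ} {A : Fin n → Fin n → Bool} {k : ℕ} (irr : ∀ x → A x x ≡ false)
                 (room : Roomy A k) (no-detour : NoDetour A) (v : Fin n) where

  record AgreeOff (C D : Colouring n) : Set where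
    constructor agreeing
    field
      off : ∀ {x y} → x ≢ v → y ≢ v → C x y ≡ D x y

  open AgreeOff

  opaque

    diff : Colouring n → Colouring n → VSet n
    diff C D u = not (does (C v u ≟ᴹ D v u))

    diff-true : ∀ {C D u} → C v u ≢ D v u → diff C D u ≡ true
    diff-true {C} {D} {u} p rewrite dec-false (C v u ≟ᴹ D v u) p = refl

    diff-false : ∀ {C D u} → C v u ≡ D v u → diff C D u ≡ false
    diff-false {C} {D} {u} p rewrite dec-true (C v u ≟ᴹ D v u) p = refl

  diff-inv : ∀ {C D u} → diff C D u ≡ true → C v u ≢ D v u
  diff-inv p q = true≢false (trans (sym p) (diff-false q))

  diff-mono : ∀ C D C′ D′ → (∀ {x} → C′ v x ≢ D′ v x → C v x ≢ D v x) →
              count (diff C′ D′) ≤ count (diff C D)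
  diff-mono C D C′ D′ sub = count-mono {n} (λ x e → diff-true (sub (diff-inv e)))

  -- Off `v` both colourings have the same edges, so only the edges of `D` at `v` remain to be
  -- checked. Most moves of `C` are mirrored in `D` by means of this lemma.
  closed-transfer : ∀ {C D c d S U} → IsProper D → AgreeOff C D → Closed C c d S →
                    (∀ {x} → x ≢ v → U x ≡ S x) → (∀ {x} → Bicoloured D c d v x → U v ≡ U x) → Closed D c d U
  closed-transfer {C} {D} {c} {d} {S} {U} P ag cl same atv = closed go
    where
    go : ∀ {x y} → Bicoloured D c d x y → U x ≡ U y
    go {x} {y} b with x Fin.≟ v | y Fin.≟ v
    ... | yes refl | _ = atv b
    ... | no _ | yes refl = sym (atv (IsProper.flip-bi P b))
    ... | no p | no q = trans (same p) (trans (same-side cl (Sum.map back back b)) (sym (same q)))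
      where
      back : ∀ {e} → D x y ≡ just e → C x y ≡ just e
      back = trans (off ag p q)

  module Descent {p : ℕ} (ih : ∀ {C D} → IsColouring A k C → IsColouring A k D → AgreeOff C D →
                               count (diff C D) < p → k ⊢ C ≈ D) where

    record Situation (C D : Colouring n) : Set where
      field
        colC  : IsColouring A k C
        colD  : IsColouring A k D
        agree : AgreeOff C D
        size  : count (diff C D) ≤ p

    open Situation

    flip-situation : ∀ {C D} → Situation C D → Situation D C
    flip-situation {C} {D} s = record
      { colC = colD s ; colD = colC s ; agree = agreeing (λ p q → sym (off (agree s) p q))
      ; size = ℕₚ.≤-trans (diff-mono C D D C ≢-sym) (size s) }

    descend : ∀ {C D C′ D′} → Situation C D → IsColouring A k C′ → IsColouring A k D′ → AgreeOff C′ D′ →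
              (∀ {x} → C′ v x ≢ D′ v x → C v x ≢ D v x) →
              ∀ t → C′ v t ≡ D′ v t → C v t ≢ D v t → k ⊢ C′ ≈ D′
    descend s P′ Q′ ag sub t eq neq = ih P′ Q′ ag
      (ℕₚ.<-≤-trans (count-strict (λ x e → diff-true (sub (diff-inv e))) t (diff-false eq) (diff-true neq)) (size s))

    -- `u` misses `e` in `C` too: in `D` its only edge of colour `e` is `uv`, and its other edges
    -- are the same in `C`. Hence `vu` can be recoloured directly.
    fix-one : ∀ {C D u e} → Situation C D → C v u ≢ D v u → D v u ≡ just e → Misses C v e → k ⊢ C ≈ D
    fix-one {C} {D} {u} {e} s neq Du ve = transᴷ C≈C₁ (descend s (≈-colouring C≈C₁ P) Q
      (agreeing (λ p q → trans (recolour-off p q) (off (agree s) p q))) sub u (trans (recolour-here u e) (sym Du)) neq)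
      where
      P : IsColouring A k C
      P = colC s
      Q : IsColouring A k D
      Q = colD s
      v≢u : v ≢ u
      v≢u = edge-≢ irr Q Du
      ue : Misses C u e
      ue = missing absent-u
        where
        absent-u : ∀ x → C u x ≢ just e
        absent-u x eq with x Fin.≟ v
        ... | yes refl = neq (trans (flip P eq) (sym Du))
        ... | no x≢v = x≢v (uniq Q (trans (sym (off (agree s) (≢-sym v≢u) x≢v)) eq) (flip Q Du))
      C≈C₁ : k ⊢ C ≈ recolour C v u e
      C≈C₁ = recolour-≈ irr P (proj₂ (colour P (adj Q Du))) ve ue (bounded Q Du)
      sub : ∀ {x} → recolour C v u e v x ≢ D v x → C v x ≢ D v x
      sub {x} h eq with x Fin.≟ u
      ... | yes refl = neq eq
      ... | no x≢u = h (trans (recolour-at x≢u) eq)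

    target-missing : ∀ {C D t e} → Situation C D → C v t ≢ D v t → D v t ≡ just e → Misses C t e
    target-missing {C} {D} {t} {e} s neq Dt = missing go
      where
      go : ∀ x → C t x ≢ just e
      go x eq with x Fin.≟ v
      ... | yes refl = neq (trans (flip (colC s) eq) (sym Dt))
      ... | no x≢v = x≢v (uniq (colD s) (trans (sym (off (agree s) (≢-sym (edge-≢ irr (colD s) Dt)) x≢v)) eq)
                                        (flip (colD s) Dt))

    -- Suppose the (m, e)-chain of `t` in `C` avoids `v`. It is swapped in `C`, and together with
    -- `v` in `D`, where this is closed because `vt` is the only edge at `v` of colour `m` or `e`.
    -- Then `vt` has colour `m` in `D`, `v` still misses `m` in `C`, and `fix-one` applies.
    relink : ∀ {C D m t e} → Situation C D → m < k → Misses C v m → Misses D v m →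
             C v t ≢ D v t → D v t ≡ just e → k ⊢ C ≈ D ⊎ Star (Bicoloured C m e) t v
    relink {C} {D} {m} {t} {e} s m<k Cm Dm neq Dt with Component.mem (chain C m e t) v in vK
    ... | true  = inj₂ (Component.reached (chain C m e t) vK)
    ... | false = inj₁ (transᴷ (kempe m e K m<k e<k Kcl) (transᴷ
                    (fix-one s₁ neq₁ D₁t (misses-out vK Cm))
                    (symᴷ (kempe m e K⁺ m<k e<k K⁺cl))))
      where
      K K⁺ : VSet n
      K = Component.mem (chain C m e t)
      K⁺ = insert v K
      P : IsColouring A k C
      P = colC s
      Q : IsColouring A k D
      Q = colD s
      e<k : e < k
      e<k = bounded Q Dt
      Kcl : Closed C m e K
      Kcl = chain-closed (proper P) (chain C m e t)
      v∈ : K⁺ v ≡ true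
      v∈ = insert-here v K
      atv : ∀ {x} → Bicoloured D m e v x → K⁺ v ≡ K⁺ x
      atv (inj₁ q) = contradiction q (absent Dm _)
      atv (inj₂ q) with uniq Q q Dt
      ... | refl = trans v∈ (sym (insert-⊆ (Component.root (chain C m e t))))
      K⁺cl : Closed D m e K⁺
      K⁺cl = closed-transfer (proper Q) (agree s) Kcl insert-there atv
      D₁t : swap m e K⁺ D v t ≡ just m
      D₁t = trans (swap-in-just v∈ Dt) (cong just (exchange-r m e))
      D₁v : ∀ {x} → x ≢ t → swap m e K⁺ D v x ≡ D v x
      D₁v x≢t = swap-fix (absent Dm _) (λ q → x≢t (uniq Q q Dt))
      neq₁ : swap m e K C v t ≢ swap m e K⁺ D v t
      neq₁ eq = absent Cm t (trans (sym (swap-out t vK)) (trans eq D₁t))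
      s₁ : Situation (swap m e K C) (swap m e K⁺ D)
      s₁ = record
        { colC = swap-colouring m<k e<k Kcl P ; colD = swap-colouring m<k e<k K⁺cl Q
        ; agree = agreeing (λ p q → swap-agree (sym (insert-there p)) (off (agree s) p q))
        ; size = ℕₚ.≤-trans (diff-mono C D _ _ sub) (size s) }
        where
        sub : ∀ {x} → swap m e K C v x ≢ swap m e K⁺ D v x → C v x ≢ D v x
        sub {x} h eq with x Fin.≟ t
        ... | yes refl = neq eq
        ... | no x≢t = h (trans (swap-out x vK) (trans eq (sym (D₁v x≢t))))

    -- Where this fails, `fix-one` applies. In both directions together it says that `C` and `D`
    -- have the same set of colours at `v`.
    Onto : Colouring n → Colouring n → Set
    Onto C D = ∀ t {e} → C v t ≢ D v t → D v t ≡ just e → ∃[ y ] C v y ≡ just e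

    onto : ∀ {C D} → Situation C D → k ⊢ C ≈ D ⊎ Onto C D
    onto {C} {D} s = collect at
      where
      at : ∀ t → k ⊢ C ≈ D ⊎ (∀ {e} → C v t ≢ D v t → D v t ≡ just e → ∃[ y ] C v y ≡ just e)
      at t with D v t in Dt
      ... | nothing = inj₂ (λ _ ())
      ... | just e with C v t ≟ᴹ just e | sees? C v e
      ...   | yes eq | _ = inj₂ (λ neq _ → contradiction eq neq)
      ...   | no _ | inj₁ y = inj₂ (λ { _ refl → y })
      ...   | no neq | inj₂ m = inj₁ (fix-one s (λ eq → neq (trans eq Dt)) Dt m)

    swap-situation : ∀ {C D c d S} → Situation C D → c < k → d < k → Closed C c d S → Closed D c d S →
                     Situation (swap c d S C) (swap c d S D)
    swap-situation {C} {D} s c<k d<k clC clD = record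
      { colC = swap-colouring c<k d<k clC (colC s) ; colD = swap-colouring c<k d<k clD (colD s)
      ; agree = agreeing (λ p q → swap-agree refl (off (agree s) p q))
      ; size = ℕₚ.≤-trans (diff-mono C D _ _ (λ h eq → h (swap-agree refl eq))) (size s) }

    -- The edge vu is to change its colour from c to e, the present colour of vy; c is to be the colour of vz.
    module Core {u y z : Fin n} {c e : ℕ} (c≢e : c ≢ e) where

      -- `apart` is the contribution of NoDetour, proved in `moved-apart`. It makes every neighbour
      -- of `u` other than `v` see the same colours along the same edges in `C` and `D`, so that a
      -- fan of `C` at `u` is usable in `D`.
      record Setup (C D : Colouring n) (m : ℕ) : Set where
        field
          situation : Situation C D
          m<k   : m < k
          missC : Misses C v m
          missD : Misses D v m
          Cu    : C v u ≡ just c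
          Du    : D v u ≡ just e
          Cy    : C v y ≡ just e
          Dz    : D v z ≡ just c
          apart : ∀ {w} → A u w ≡ true → w ≢ v → C v w ≡ D v w
        isC : IsColouring A k C
        isC = colC situation

        isD : IsColouring A k D
        isD = colD situation

        agreed : AgreeOff C D
        agreed = agree situation

        v≢u : v ≢ u
        v≢u = edge-≢ irr isC Cu

        z≢u : z ≢ u
        z≢u refl = c≢e (Maybeₚ.just-injective (trans (sym Dz) Du))

        u-moves : C v u ≢ D v u
        u-moves eq = c≢e (Maybeₚ.just-injective (trans (sym Cu) (trans eq Du)))

        z-moves : C v z ≢ D v z
        z-moves eq = z≢u (uniq isC (trans eq Dz) Cu)

        u-misses-e : Misses C u e
        u-misses-e = target-missing situation u-moves Du

        z-misses-c : Misses C z c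
        z-misses-c = target-missing situation z-moves Dz

        D-u-misses-c : Misses D u c
        D-u-misses-c = target-missing (flip-situation situation) (≢-sym u-moves) Cu

        c<k : c < k
        c<k = bounded isC Cu

        e<k : e < k
        e<k = bounded isD Du

        m≢c : m ≢ c
        m≢c refl = absent missC u Cu

        m≢e : m ≢ e
        m≢e refl = absent missC y Cy

        K : VSet n
        K = Component.mem (chain C c e u)

        u∈K : K u ≡ true
        u∈K = Component.root (chain C c e u)

        v∈K : K v ≡ true
        v∈K = Component.closed (chain C c e u) u∈K (inj₁ (flip isC Cu))

        K-closed : Closed C c e K
        K-closed = chain-closed (proper isC) (chain C c e u)

        not-v : ∀ {w a} → C u w ≡ just a → a ≢ c → w ≢ v
        not-v uw a≢c refl = a≢c (Maybeₚ.just-injective (trans (sym uw) (flip isC Cu)))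

        same-star : ∀ {w} → A u w ≡ true → w ≢ v → ∀ x → C w x ≡ D w x
        same-star {w} uw w≢v x with x Fin.≟ v
        ... | yes refl = trans (symm isC w v) (trans (apart uw w≢v) (symm isD v w))
        ... | no x≢v = off agreed w≢v x≢v

        row-u : ∀ {x} → x ≢ v → C u x ≡ D u x
        row-u = off agreed (≢-sym v≢u)

      open Setup

      Result : Colouring n → Colouring n → Set
      Result C D = k ⊢ C ≈ D

      sandwich : ∀ {C D C′ D′ : Colouring n} → k ⊢ C ≈ C′ → k ⊢ D ≈ D′ → k ⊢ C′ ≈ D′ → k ⊢ C ≈ D
      sandwich p q r = transᴷ p (transᴷ r (symᴷ q))

      swap-off : ∀ {C D m a b S} → Setup C D m → a < k → b < k → Closed C a b S → S v ≡ false →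
                 (∀ {x} → Bicoloured D a b v x → S v ≡ S x) →
                 (Setup (swap a b S C) (swap a b S D) m → Result (swap a b S C) (swap a b S D)) → Result C D
      swap-off {C} {D} {m} {a} {b} {S} s a<k b<k cl v∉ atv f =
        sandwich (kempe a b S a<k b<k cl) (kempe a b S a<k b<k clD) (f (record
          { situation = swap-situation (situation s) a<k b<k cl clD
          ; m<k = m<k s ; missC = misses-out v∉ (missC s) ; missD = misses-out v∉ (missD s)
          ; Cu = trans (swap-out u v∉) (Cu s) ; Du = trans (swap-out u v∉) (Du s)
          ; Cy = trans (swap-out y v∉) (Cy s) ; Dz = trans (swap-out z v∉) (Dz s)
          ; apart = λ uw w≢v → swap-agree refl (apart s uw w≢v) }))
        where
        clD : Closed D a b S
        clD = closed-transfer (proper (isD s)) (agreed s) cl (λ _ → refl) atv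

      -- Colours `c` and `e` are swapped in `C` outside `K`, and in `D` outside `K` and also at `u`
      -- and `v`. In `D` these colours lie at `v` on `vz` and `vu`; both edges stay inside the
      -- larger set exactly because `z` is outside `K`. Afterwards `vu` has colour `c` on both
      -- sides.
      unlinked : ∀ {C D m} (s : Setup C D m) → K s z ≡ false → Result C D
      unlinked {C} {D} {m} s z∉ = sandwich (kempe c e S (c<k s) (e<k s) clC) (kempe c e S⁺ (c<k s) (e<k s) clD)
        (descend (situation s) (swap-colouring (c<k s) (e<k s) clC (isC s)) (swap-colouring (c<k s) (e<k s) clD (isD s))
          (agreeing agree₁) sub u (trans (trans (swap-out u v∉S) (Cu s)) (sym D₁u)) (u-moves s))
        where
        S S⁺ : VSet n
        S = ∁ (K s)
        S⁺ = insert u (insert v S)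
        clC : Closed C c e S
        clC = ∁-closed (K-closed s)
        v∉S : S v ≡ false
        v∉S = ∁-false (v∈K s)
        u∉S : S u ≡ false
        u∉S = ∁-false (u∈K s)
        u∈S⁺ : S⁺ u ≡ true
        u∈S⁺ = insert-here u (insert v S)
        v∈S⁺ : S⁺ v ≡ true
        v∈S⁺ = insert-⊆ (insert-here v S)
        S⁺-off : ∀ {x} → x ≢ u → x ≢ v → S⁺ x ≡ S x
        S⁺-off p q = trans (insert-there p) (insert-there q)
        z∈S⁺ : S⁺ z ≡ true
        z∈S⁺ = insert-⊆ (insert-⊆ (∁-true z∉))
        v-out : ∀ {x} → Bicoloured D c e v x → S⁺ x ≡ true
        v-out (inj₁ q) = subst (λ x → S⁺ x ≡ true) (uniq (isD s) (Dz s) q) z∈S⁺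
        v-out (inj₂ q) = subst (λ x → S⁺ x ≡ true) (uniq (isD s) (Du s) q) u∈S⁺
        u-out : ∀ {x} → Bicoloured D c e u x → S⁺ x ≡ true
        u-out (inj₁ q) = contradiction q (absent (D-u-misses-c s) _)
        u-out (inj₂ q) = subst (λ x → S⁺ x ≡ true) (uniq (isD s) (flip (isD s) (Du s)) q) v∈S⁺
        clD : Closed D c e S⁺
        clD = closed go
          where
          go : ∀ {x y} → Bicoloured D c e x y → S⁺ x ≡ S⁺ y
          go {x} {y} b with x Fin.≟ v | y Fin.≟ v | x Fin.≟ u | y Fin.≟ u
          ... | yes refl | _ | _ | _ = trans v∈S⁺ (sym (v-out b))
          ... | no _ | yes refl | _ | _ = trans (v-out (flip-bi (isD s) b)) (sym v∈S⁺)
          ... | no _ | no _ | yes refl | _ = trans u∈S⁺ (sym (u-out b))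
          ... | no _ | no _ | no _ | yes refl = trans (u-out (flip-bi (isD s) b)) (sym u∈S⁺)
          ... | no p | no q | no r | no t = trans (S⁺-off r p) (trans (same-side clC (Sum.map back back b)) (sym (S⁺-off t q)))
            where
            back : ∀ {f} → D x y ≡ just f → C x y ≡ just f
            back = trans (off (agreed s) p q)
        D₁u : swap c e S⁺ D v u ≡ just c
        D₁u = trans (swap-in-just v∈S⁺ (Du s)) (cong just (exchange-r c e))
        agree₁ : ∀ {x w} → x ≢ v → w ≢ v → swap c e S C x w ≡ swap c e S⁺ D x w
        agree₁ {x} {w} p q with x Fin.≟ u
        ... | no x≢u = swap-agree (sym (S⁺-off x≢u p)) (off (agreed s) p q)
        ... | yes refl = trans (swap-out w u∉S) (trans (row-u s q) (sym (swap-fix (absent (D-u-misses-c s) w)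
                           (λ h → q (uniq (isD s) h (flip (isD s) (Du s)))))))
        sub : ∀ {x} → swap c e S C v x ≢ swap c e S⁺ D v x → C v x ≢ D v x
        sub {x} h eq with x Fin.≟ u | x Fin.≟ z
        ... | yes refl | _ = u-moves s eq
        ... | no _ | yes refl = z-moves s eq
        ... | no p | no q = h (trans (swap-out x v∉S) (trans eq (sym (swap-fix
                              (λ r → q (uniq (isD s) r (Dz s))) (λ r → p (uniq (isD s) r (Du s)))))))

      -- After turning the fan around u, u misses m as v does, and vu can take the colour m.  The target D is
      -- moved along: it is equivalent to the colouring D₂ in which vu has colour m as well.
      escaping : ∀ {C D m w b} → Setup C D m → Walk C u (Inner c m) m w → Misses C w b → b < k → Misses C u b →
                 Result C D
      escaping {C} {D} {m} {w} {b} s p wb b<k ub with K s z in z∈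
      ... | false = unlinked s z∈
      ... | true with walk-fan p
      ...   | ps , fan , vs = sandwich C≈C₂ D≈D₂ C₂≈D₂
        where
        P : IsColouring A k C
        P = isC s
        Q : IsColouring A k D
        Q = isD s
        b≢c : b ≢ c
        b≢c refl = absent ub v (flip P (Cu s))
        qs : List (Fin n × ℕ)
        qs = (w , b) ∷ ps
        g : Fin n → Maybe ℕ
        g = override (C u) qs
        Entry : Fin n × ℕ → Set
        Entry (x , a) = A u x ≡ true × x ≢ v × Misses C x a × a ≢ c
        walk-vertex : ∀ {x} → Walk C u (Inner c m) m x → A u x ≡ true × x ≢ v
        walk-vertex q with walk-colour q
        ... | a , e , inj₁ refl = adj P e , not-v s e (m≢c s)
        ... | a , e , inj₂ (_ , a≢c) = adj P e , not-v s e a≢c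
        entries : All Entry qs
        entries = (proj₁ (walk-vertex p) , proj₂ (walk-vertex p) , wb , b≢c)
          ∷ All.map (λ (q , h , _ , a≢c) → proj₁ (walk-vertex q) , proj₂ (walk-vertex q) , h , a≢c) vs
        -- u and z are the ends of the chain K.
        outside : ∀ {x} → A u x ≡ true → x ≢ v → Misses C x e → K s x ≡ false
        outside {x} ux x≢v h = Boolₚ.¬-not (λ x∈ → three-ends (proper P) (inj₂ (u-misses-e s)) (inj₁ (z-misses-c s)) (inj₂ h)
          (z≢u s) (≢-sym (edge-≢ irr P (proj₂ (colour P ux)))) (λ { refl → z-moves s (apart s ux x≢v) })
          (Component.reached (chain C c e u) z∈) (Component.reached (chain C c e u) x∈))
        v∉qs : ∀ {rs} → All Entry rs → v ∉ map proj₁ rs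
        v∉qs (h ∷ _) (here refl) = proj₁ (proj₂ h) refl
        v∉qs (_ ∷ hs) (there i) = v∉qs hs i
        g-v : g v ≡ just c
        g-v = trans (override-∉ {ps = qs} (v∉qs entries)) (flip P (Cu s))
        g-value : ∀ {rs x a} → All Entry rs → x ≢ v → override (C u) rs x ≡ just a → a ≢ c × (a ≡ e → K s x ≡ false)
        g-value {[]} [] x≢v eq = (λ { refl → x≢v (uniq P eq (flip P (Cu s))) })
                               , (λ { refl → contradiction eq (absent (u-misses-e s) _) })
        g-value {(w′ , a′) ∷ rs} {x} ((uw , w≢v , h , a≢c) ∷ hs) x≢v eq with x Fin.≟ w′
        ... | yes refl with eq
        ...   | refl = a≢c , (λ { refl → outside uw w≢v h })
        g-value {(w′ , a′) ∷ rs} ((uw , w≢v , h , a≢c) ∷ hs) x≢v eq | no x≢w = g-value hs x≢v eq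
        freeC : ∀ {rs} → All Entry rs → All (Free C) rs
        freeC = All.map (λ h → proj₁ (proj₂ (proj₂ h)))
        turnC : k ⊢ C ≈ restar C u g × (∀ x → g x ≢ just m)
        turnC = turn irr (fan b) P (λ _ → refl) (freeC entries) (absent ub) b<k
        g-m : ∀ x → g x ≢ just m
        g-m = proj₂ turnC
        C₁ C₂ : Colouring n
        C₁ = restar C u g
        C₂ = recolour C₁ u v m
        last-step : ∀ {E} → k ⊢ E ≈ restar E u g → IsColouring A k E → Misses E v m → k ⊢ E ≈ recolour (restar E u g) u v m
        last-step {E} h R vm = transᴷ h (recolour-≈ irr (≈-colouring h R) (trans (restar-at v) g-v)
          (missing (λ x eq → g-m x (trans (sym (restar-at x)) eq))) (missing at-v) (m<k s))
          where
          at-v : ∀ x → restar E u g v x ≢ just m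
          at-v x eq with x Fin.≟ u
          ... | yes refl = m≢c s (Maybeₚ.just-injective (trans (sym eq) (trans (restar-at′ v) g-v)))
          ... | no x≢u = absent vm x (trans (sym (restar-off (v≢u s) x≢u)) eq)
        C≈C₂ : k ⊢ C ≈ C₂
        C≈C₂ = last-step (proj₁ turnC) P (missC s)
        KD : Closed D c e (K s)
        KD = closed-transfer (proper Q) (agreed s) (K-closed s) (λ _ → refl) atv
          where
          atv : ∀ {x} → Bicoloured D c e v x → K s v ≡ K s x
          atv (inj₁ q) = trans (v∈K s) (sym (subst (λ x → K s x ≡ true) (uniq Q (Dz s) q) z∈))
          atv (inj₂ q) = trans (v∈K s) (sym (subst (λ x → K s x ≡ true) (uniq Q (Du s) q) (u∈K s)))
        -- Swapping `K` in `D` gives `vu` the colour `c`, so that `D₄` has the same row at `u` as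
        -- `C` and the same fan can be turned. Once `vu` has colour `m`, swapping back on `K`
        -- without `u` restores `D` at all edges not at `u`.
        D₄ D₁ D₃ D₂ : Colouring n
        D₄ = swap c e (K s) D
        D₁ = restar D₄ u g
        D₃ = recolour D₁ u v m
        S : VSet n
        S = remove u (K s)
        D₂ = swap c e S D₃
        D≈D₄ : k ⊢ D ≈ D₄
        D≈D₄ = kempe c e (K s) (c<k s) (e<k s) KD
        P₄ : IsColouring A k D₄
        P₄ = ≈-colouring D≈D₄ Q
        D₄-u : ∀ x → D₄ u x ≡ C u x
        D₄-u x with x Fin.≟ v
        ... | yes refl = trans (swap-in-just (u∈K s) (flip Q (Du s))) (trans (cong just (exchange-r c e)) (sym (flip P (Cu s))))
        ... | no x≢v = trans (swap-fix (absent (D-u-misses-c s) x)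
                         (λ q → x≢v (uniq Q q (flip Q (Du s))))) (sym (row-u s x≢v))
        D₄-misses : ∀ {r} → Entry r → Free D₄ r
        D₄-misses {x , a} (ux , x≢v , h , a≢c) with a ℕ.≟ e
        ... | yes refl = misses-out (outside ux x≢v h) (missing (λ t eq → absent h t (trans (same-star s ux x≢v t) eq)))
        ... | no a≢e = misses-keep a≢c a≢e (missing (λ t eq → absent h t (trans (same-star s ux x≢v t) eq)))
        D₄≈D₃ : k ⊢ D₄ ≈ D₃
        D₄≈D₃ = last-step (proj₁ (turn irr (fan b) P₄ D₄-u (All.map D₄-misses entries) (absent ub) b<k)) P₄
                          (misses-keep (m≢c s) (m≢e s) (missD s))
        P₃ : IsColouring A k D₃
        P₃ = ≈-colouring D₄≈D₃ P₄
        D₃-uv : D₃ u v ≡ just m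
        D₃-uv = recolour-here v m
        D₃-u : ∀ {x} → x ≢ v → D₃ u x ≡ g x
        D₃-u x≢v = trans (recolour-at x≢v) (restar-at _)
        D₃-off : ∀ {x t} → x ≢ u → t ≢ u → D₃ x t ≡ D₄ x t
        D₃-off p q = trans (recolour-off p q) (restar-off p q)
        S-off : ∀ {x} → x ≢ u → S x ≡ K s x
        S-off = remove-there
        S-u : S u ≡ false
        S-u = remove-here u (K s)
        S-closed : Closed D₃ c e S
        S-closed = closed go
          where
          -- After the turn `u` has no edge of colour `c`, and one of colour `e` leads to a vertex
          -- outside `K`. This is why `u` may be dropped from the set.
          u-out : ∀ {x} → Bicoloured D₃ c e u x → S x ≡ false
          u-out {x} d with x Fin.≟ v
          u-out (inj₁ q) | yes refl = contradiction (Maybeₚ.just-injective (trans (sym D₃-uv) q)) (m≢c s)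
          u-out (inj₂ q) | yes refl = contradiction (Maybeₚ.just-injective (trans (sym D₃-uv) q)) (m≢e s)
          u-out (inj₁ q) | no x≢v = contradiction refl (proj₁ (g-value entries x≢v (trans (sym (D₃-u x≢v)) q)))
          u-out (inj₂ q) | no x≢v = trans (S-off (≢-sym (edge-≢ irr P₃ q))) (proj₂ (g-value entries x≢v (trans (sym (D₃-u x≢v)) q)) refl)
          go : ∀ {x t} → Bicoloured D₃ c e x t → S x ≡ S t
          go {x} {t} d with x Fin.≟ u | t Fin.≟ u
          ... | yes refl | _ = trans S-u (sym (u-out d))
          ... | no _ | yes refl = trans (u-out (flip-bi P₃ d)) (sym S-u)
          ... | no x≢u | no t≢u = trans (S-off x≢u) (trans (same-side (swap-closed KD)
                (Sum.map (trans (sym (D₃-off x≢u t≢u))) (trans (sym (D₃-off x≢u t≢u))) d)) (sym (S-off t≢u)))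
        D₃≈D₂ : k ⊢ D₃ ≈ D₂
        D₃≈D₂ = kempe c e S (c<k s) (e<k s) S-closed
        D≈D₂ : k ⊢ D ≈ D₂
        D≈D₂ = transᴷ D≈D₄ (transᴷ D₄≈D₃ D₃≈D₂)
        P₂ : IsColouring A k D₂
        P₂ = ≈-colouring D₃≈D₂ P₃
        D₂-off : ∀ {x t} → x ≢ u → t ≢ u → D₂ x t ≡ D x t
        D₂-off {x} {t} p q = trans (swap-agree (S-off p) (D₃-off p q)) (swap-invol x t)
        D₂-u : ∀ x → D₂ u x ≡ D₃ u x
        D₂-u x = swap-out x S-u
        C₂-u : ∀ {x} → x ≢ v → C₂ u x ≡ g x
        C₂-u x≢v = trans (recolour-at x≢v) (restar-at _)
        C₂-off : ∀ {x t} → x ≢ u → t ≢ u → C₂ x t ≡ C x t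
        C₂-off p q = trans (recolour-off p q) (restar-off p q)
        row : ∀ {x} → x ≢ v → C₂ u x ≡ D₂ u x
        row x≢v = trans (C₂-u x≢v) (sym (trans (D₂-u _) (D₃-u x≢v)))
        P₂′ : IsColouring A k C₂
        P₂′ = ≈-colouring C≈C₂ P
        agree₂ : ∀ {x t} → x ≢ v → t ≢ v → C₂ x t ≡ D₂ x t
        agree₂ {x} {t} p q with x Fin.≟ u | t Fin.≟ u
        ... | yes refl | _ = row q
        ... | no _ | yes refl = trans (symm P₂′ x u) (trans (row p) (symm P₂ u x))
        ... | no x≢u | no t≢u = trans (C₂-off x≢u t≢u) (trans (off (agreed s) p q) (sym (D₂-off x≢u t≢u)))
        C₂≈D₂ : k ⊢ C₂ ≈ D₂
        C₂≈D₂ = descend (situation s) P₂′ P₂ (agreeing agree₂) sub u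
          (trans (symm P₂′ v u) (trans (recolour-here v m) (sym (trans (symm P₂ v u) (trans (D₂-u v) D₃-uv))))) (u-moves s)
          where
          sub : ∀ {x} → C₂ v x ≢ D₂ v x → C v x ≢ D v x
          sub {x} h eq with x Fin.≟ u
          ... | yes refl = u-moves s eq
          ... | no x≢u = h (trans (C₂-off (v≢u s) x≢u) (trans eq (sym (D₂-off (v≢u s) x≢u))))

      -- If `z` lies in `K`, its ends are `u` and `z`, so `w` is outside. Swapping everything
      -- outside `K`, in `C` and in `D`, makes `w` miss `e`, which `u` misses as well: the fan
      -- escapes.
      blocking : ∀ {C D m w} → Setup C D m → Walk C u (Inner c m) m w → Misses C w c → Result C D
      blocking {C} {D} {m} {w} s p wc with K s z in z∈
      ... | false = unlinked s z∈
      ... | true = swap-off s (c<k s) (e<k s) (∁-closed (K-closed s)) (∁-false (v∈K s)) atv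
                     (λ s′ → escaping s′ (walk-map (trans (swap-out _ u∉)) step′ p) we (e<k s) (u-misses-e s′))
        where
        u∉ : ∁ (K s) u ≡ false
        u∉ = ∁-false (u∈K s)
        atv : ∀ {x} → Bicoloured D c e v x → ∁ (K s) v ≡ ∁ (K s) x
        atv (inj₁ q) = ∁-cong (trans (v∈K s) (sym (subst (λ x → K s x ≡ true) (uniq (isD s) (Dz s) q) z∈)))
        atv (inj₂ q) = ∁-cong (trans (v∈K s) (sym (subst (λ x → K s x ≡ true) (uniq (isD s) (Du s) q) (u∈K s))))
        vertex : A u w ≡ true × w ≢ v
        vertex with walk-colour p
        ... | a , q , inj₁ refl = adj (isC s) q , not-v s q (m≢c s)
        ... | a , q , inj₂ (_ , a≢c) = adj (isC s) q , not-v s q a≢c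
        w∉ : K s w ≡ false
        w∉ = Boolₚ.¬-not (λ w∈ → three-ends (proper (isC s)) (inj₂ (u-misses-e s)) (inj₁ (z-misses-c s)) (inj₁ wc)
          (z≢u s) (≢-sym (edge-≢ irr (isC s) (proj₂ (colour (isC s) (proj₁ vertex)))))
          (λ { refl → z-moves s (apart s (proj₁ vertex) (proj₂ vertex)) })
          (Component.reached (chain C c e u) z∈) (Component.reached (chain C c e u) w∈))
        we : Misses (swap c e (∁ (K s)) C) w e
        we = misses-in (∁-true w∉) (subst (Misses C w) (sym (exchange-r c e)) wc)
        step′ : ∀ {x x′ a} → Inner c m a → Misses C x a → C u x′ ≡ just a →
               Misses (swap c e (∁ (K s)) C) x a × Inner c m a × swap c e (∁ (K s)) C u x′ ≡ just a
        step′ (a≢m , a≢c) h q = misses-keep a≢c (λ { refl → absent (u-misses-e s) _ q }) h , (a≢m , a≢c) , trans (swap-out _ u∉) q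

      -- Unless `relink` finishes, the (m, e)-chain of `u` has `v` as its other end, so `w` is not
      -- on it. Swapping outside this chain makes `w` miss `e`, and the fan escapes.
      looping : ∀ {C D m w} → Setup C D m → Walk C u (Inner c m) m w → Misses C w m → Result C D
      looping {C} {D} {m} {w} s p wm
        with relink (situation s) (m<k s) (missC s) (missD s) (u-moves s) (Du s)
      ... | inj₁ done = done
      ... | inj₂ link = swap-off s (m<k s) (e<k s) (∁-closed (chain-closed (proper (isC s)) L)) (∁-false v∈) atv
                          (λ s′ → escaping s′ (walk-map (trans (swap-out _ u∉)) step′ p) we (e<k s) (u-misses-e s′))
        where
        L : Component {R = Bicoloured C m e} u
        L = chain C m e u
        S : VSet n
        S = ∁ (Component.mem L)
        v∈ : Component.mem L v ≡ true
        v∈ = spread L (Component.root L) link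
        u∉ : S u ≡ false
        u∉ = ∁-false (Component.root L)
        atv : ∀ {x} → Bicoloured D m e v x → S v ≡ S x
        atv (inj₁ q) = contradiction q (absent (missD s) _)
        atv (inj₂ q) with uniq (isD s) (Du s) q
        ... | refl = trans (∁-false v∈) (sym u∉)
        vertex : A u w ≡ true × w ≢ v
        vertex with walk-colour p
        ... | a , q , inj₁ refl = adj (isC s) q , not-v s q (m≢c s)
        ... | a , q , inj₂ (_ , a≢c) = adj (isC s) q , not-v s q a≢c
        w∉ : Component.mem L w ≡ false
        w∉ = Boolₚ.¬-not (λ w∈ → three-ends (proper (isC s)) (inj₂ (u-misses-e s)) (inj₁ (missC s)) (inj₁ wm)
          (v≢u s) (≢-sym (edge-≢ irr (isC s) (proj₂ (colour (isC s) (proj₁ vertex))))) (≢-sym (proj₂ vertex))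
          link (Component.reached L w∈))
        we : Misses (swap m e S C) w e
        we = misses-in (∁-true w∉) (subst (Misses C w) (sym (exchange-r m e)) wm)
        step′ : ∀ {x x′ a} → Inner c m a → Misses C x a → C u x′ ≡ just a →
               Misses (swap m e S C) x a × Inner c m a × swap m e S C u x′ ≡ just a
        step′ (a≢m , a≢c) h q = misses-keep a≢m (λ { refl → absent (u-misses-e s) _ q }) h , (a≢m , a≢c) , trans (swap-out _ u∉) q

      -- Exchanging the colours m and x along the chain of v turns the fork into a loop.
      forking : ∀ {C D m p q x} → Setup C D m → p ≢ q → x ≢ m → x ≢ c →
                Walk C u (Inner₃ c m x) m p → Misses C p x → Walk C u (Inner₃ c m x) x q → Misses C q x → Result C D
      forking {C} {D} {m} {p} {q} {x} s p≢q x≢m x≢c mp px xq qx = [ id , main ]′ D-side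
        where
        P : IsColouring A k C
        P = isC s
        x<k : x < k
        x<k = bounded P (proj₂ (walk-source xq))
        x≢e : x ≢ e
        x≢e refl = absent (u-misses-e s) _ (proj₂ (walk-source xq))
        L : Component {R = Bicoloured C m x} v
        L = chain C m x v
        S : VSet n
        S = Component.mem L
        v∈ : S v ≡ true
        v∈ = Component.root L
        cl : Closed C m x S
        cl = chain-closed (proper P) L
        -- To mirror the move, an edge `vt` of colour `x` in `D` must not leave `S`. If `vt` has
        -- this colour in `C` too, `S` is closed there; if not, `relink` either finishes or joins
        -- `t` to `v` by an (m, x)-chain of `C`.
        D-side : Result C D ⊎ (∀ {t} → Bicoloured D m x v t → S v ≡ S t)
        D-side with sees? D v x
        ... | inj₂ miss = inj₂ λ { (inj₁ h) → contradiction h (absent (missD s) _) ; (inj₂ h) → contradiction h (absent miss _) }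
        ... | inj₁ (t , Dt) with C v t ≟ᴹ D v t
        ...   | yes eq = inj₂ λ { (inj₁ h) → contradiction h (absent (missD s) _)
                                ; (inj₂ h) → same-side cl (inj₂ (trans (cong (C v) (uniq (isD s) h Dt)) (trans eq Dt))) }
        ...   | no neq with relink (situation s) (m<k s) (missC s) (missD s) neq Dt
        ...     | inj₁ done = inj₁ done
        ...     | inj₂ link = inj₂ λ { (inj₁ h) → contradiction h (absent (missD s) _)
                                     ; (inj₂ h) → trans v∈ (sym (subst (λ r → S r ≡ true) (uniq (isD s) Dt h)
                                                    (spread L v∈ (star-flip (flip-bi P) link)))) }
        C′ : Colouring n
        C′ = swap m x S C
        vertex : ∀ {w t} → t ≢ c → Walk C u (Inner₃ c m x) t w → w ≢ v
        vertex t≢c r with walk-colour r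
        ... | a , e′ , inj₁ refl = not-v s e′ t≢c
        ... | a , e′ , inj₂ ((_ , a≢c) , _) = not-v s e′ a≢c
        not-both : S p ≡ true → S q ≡ true → ⊥
        not-both p∈ q∈ = three-ends (proper P) (inj₁ (missC s)) (inj₂ px) (inj₂ qx) (vertex (m≢c s) mp) (vertex x≢c xq) p≢q
          (Component.reached L p∈) (Component.reached L q∈)
        keep : ∀ {w w′ a} → Inner₃ c m x a → Misses C w a → C u w′ ≡ just a →
               Misses C′ w a × Inner c x a × C′ u w′ ≡ just a
        keep ((a≢m , a≢c) , a≢x) h e′ = misses-keep a≢m a≢x h , (a≢x , a≢c) , swap-keep a≢m a≢x e′
        crossed : ∀ {w} → S w ≡ true → Misses C w x → Misses C′ w m
        crossed w∈ h = misses-in w∈ (subst (Misses C _) (sym (exchange-l m x)) h)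
        into-x : S u ≡ true → ∀ {w} → C u w ≡ just m → C′ u w ≡ just x
        into-x u∈ e′ = trans (swap-in-just u∈ e′) (cong just (exchange-l m x))
        into-m : S u ≡ true → ∀ {w} → C u w ≡ just x → C′ u w ≡ just m
        into-m u∈ e′ = trans (swap-in-just u∈ e′) (cong just (exchange-r m x))
        stay : S u ≡ false → ∀ {w a} → C u w ≡ just a → C′ u w ≡ just a
        stay u∉ e′ = trans (swap-out _ u∉) e′
        m-ok : Inner c x m
        m-ok = ≢-sym x≢m , m≢c s
        -- Now `v` misses `x`. If `u` is in `S`, the colours `m` and `x` have changed places at `u`;
        -- if `p` or `q` is in `S`, it misses `m` instead of `x`. As `p` and `q` are not both in
        -- `S`, one of the two walks, or both joined, leads from colour `x` to a vertex that misses
        -- `x`.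
        cycle : Setup C′ (swap m x S D) x → Result C′ (swap m x S D)
        cycle s′ with S u in u∈ | S p in p∈ | S q in q∈
        ... | true | false | _ = looping s′ (walk-map (into-x u∈) keep mp) (misses-out p∈ px)
        ... | true | true | false = looping s′
          (walk-join (walk-map (into-x u∈) keep mp) (crossed p∈ px) m-ok (walk-map (into-m u∈) keep xq)) (misses-out q∈ qx)
        ... | false | _ | false = looping s′ (walk-map (stay u∈) keep xq) (misses-out q∈ qx)
        ... | false | false | true = looping s′
          (walk-join (walk-map (stay u∈) keep xq) (crossed q∈ qx) m-ok (walk-map (stay u∈) keep mp)) (misses-out p∈ px)
        ... | true | true | true = ⊥-elim (not-both p∈ q∈)
        ... | false | true | true = ⊥-elim (not-both p∈ q∈)
        main : (∀ {t} → Bicoloured D m x v t → S v ≡ S t) → Result C D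
        main atv = sandwich (kempe m x S (m<k s) x<k cl) (kempe m x S (m<k s) x<k clD) (cycle (record
          { situation = swap-situation (situation s) (m<k s) x<k cl clD
          ; m<k = x<k
          ; missC = misses-in v∈ (subst (Misses C v) (sym (exchange-r m x)) (missC s))
          ; missD = misses-in v∈ (subst (Misses D v) (sym (exchange-r m x)) (missD s))
          ; Cu = swap-keep (≢-sym (m≢c s)) (≢-sym x≢c) (Cu s) ; Du = swap-keep (≢-sym (m≢e s)) (≢-sym x≢e) (Du s)
          ; Cy = swap-keep (≢-sym (m≢e s)) (≢-sym x≢e) (Cy s) ; Dz = swap-keep (≢-sym (m≢c s)) (≢-sym x≢c) (Dz s)
          ; apart = λ uw w≢v → swap-agree refl (apart s uw w≢v) }))
          where
          clD : Closed D m x S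
          clD = closed-transfer (proper (isD s)) (agree (situation s)) cl (λ _ → refl) atv

      solve : ∀ {C D m} → Setup C D m → Result C D
      solve {C} {D} {m} s with sees? C u m
      ... | inj₁ (w , uw) with explore (proper (isC s)) (room (isC s)) u c m uw
      ...   | escape p wb b<k ub           = escaping s p wb b<k ub
      ...   | blocked p wc                 = blocking s p wc
      ...   | loop p wm                    = looping s p wm
      ...   | fork p≢q x≢m x≢c mp px xq qx = forking s p≢q x≢m x≢c mp px xq qx
      -- Here `u` misses both `m` and `e`, so its chain is a single vertex and cannot reach `v`.
      solve {C} {D} {m} s | inj₂ um
        with relink (situation s) (m<k s) (missC s) (missD s) (u-moves s) (Du s)
      ... | inj₁ done = done
      ... | inj₂ ε = contradiction refl (v≢u s)
      ... | inj₂ (inj₁ h ◅ _) = contradiction h (absent um _)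
      ... | inj₂ (inj₂ h ◅ _) = contradiction h (absent (u-misses-e s) _)

    -- The path u, v, y is a whole (c, e)-chain of `C`, since `u` misses `e` and `y` misses `c`.
    two-cycle : ∀ {C D u y c e} → Situation C D → c ≢ e → C v u ≡ just c → D v u ≡ just e →
                C v y ≡ just e → D v y ≡ just c → k ⊢ C ≈ D
    two-cycle {C} {D} {u} {y} {c} {e} s c≢e Cu Du Cy Dy =
      transᴷ (kempe c e S (bounded P Cu) (bounded P Cy) cl)
        (descend s (swap-colouring (bounded P Cu) (bounded P Cy) cl P) (colD s) (agreeing agree₁) sub u
          (trans (trans (swap-in-just v∈ Cu) (cong just (exchange-l c e))) (sym Du)) u-moves)
      where
      P : IsColouring A k C
      P = colC s
      u-moves : C v u ≢ D v u
      u-moves eq = c≢e (Maybeₚ.just-injective (trans (sym Cu) (trans eq Du)))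
      y-moves : C v y ≢ D v y
      y-moves eq = c≢e (Maybeₚ.just-injective (trans (sym Dy) (trans (sym eq) Cy)))
      S : VSet n
      S = insert v (insert u (insert y (λ _ → false)))
      v∈ : S v ≡ true
      v∈ = insert-here v (insert u (insert y (λ _ → false)))
      u∈ : S u ≡ true
      u∈ = insert-⊆ (insert-here u (insert y (λ _ → false)))
      y∈ : S y ≡ true
      y∈ = insert-⊆ (insert-⊆ (insert-here y (λ _ → false)))
      ue : Misses C u e
      ue = target-missing s u-moves Du
      yc : Misses C y c
      yc = target-missing s y-moves Dy
      out : ∀ {x t} → S x ≡ true → Bicoloured C c e x t → S t ≡ true
      out x∈ b with triple-inv x∈ | b
      ... | inj₁ refl | inj₁ h = subst (λ t → S t ≡ true) (uniq P Cu h) u∈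
      ... | inj₁ refl | inj₂ h = subst (λ t → S t ≡ true) (uniq P Cy h) y∈
      ... | inj₂ (inj₁ refl) | inj₁ h = subst (λ t → S t ≡ true) (uniq P (flip P Cu) h) v∈
      ... | inj₂ (inj₁ refl) | inj₂ h = contradiction h (absent ue _)
      ... | inj₂ (inj₂ refl) | inj₁ h = contradiction h (absent yc _)
      ... | inj₂ (inj₂ refl) | inj₂ h = subst (λ t → S t ≡ true) (uniq P (flip P Cy) h) v∈
      cl : Closed C c e S
      cl = symm-closed (flip-bi P) out
      agree₁ : ∀ {x t} → x ≢ v → t ≢ v → swap c e S C x t ≡ D x t
      agree₁ {x} {t} p q with S x in x∈
      ... | false = trans (swap-out t x∈) (off (agree s) p q)
      ... | true with triple-inv x∈
      ...   | inj₁ h = contradiction h p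
      ...   | inj₂ (inj₁ refl) = trans (swap-fix (λ h → q (uniq P h (flip P Cu))) (absent ue t)) (off (agree s) p q)
      ...   | inj₂ (inj₂ refl) = trans (swap-fix (absent yc t) (λ h → q (uniq P h (flip P Cy)))) (off (agree s) p q)
      sub : ∀ {x} → swap c e S C v x ≢ D v x → C v x ≢ D v x
      sub {x} h eq with x Fin.≟ u | x Fin.≟ y
      ... | yes refl | _ = u-moves eq
      ... | no _ | yes refl = y-moves eq
      ... | no p | no q = h (trans (swap-fix (λ r → p (uniq P r Cu)) (λ r → q (uniq P r Cy))) eq)

    moved-edge : ∀ {C D t} → Situation C D → C v t ≢ D v t → A v t ≡ true
    moved-edge {C} {D} {t} s neq with C v t in Ct | D v t in Dt
    ... | just _  | _       = adj (colC s) Ct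
    ... | nothing | just _  = adj (colD s) Dt
    ... | nothing | nothing = contradiction refl neq

    Links : Colouring n → Colouring n → ℕ → Set
    Links C D m = ∀ t {e} → C v t ≢ D v t → D v t ≡ just e → Star (Bicoloured C m e) t v

    links : ∀ {C D m} → Situation C D → m < k → Misses C v m → Misses D v m → k ⊢ C ≈ D ⊎ Links C D m
    links {C} {D} {m} s m<k Cm Dm = collect at
      where
      at : ∀ t → k ⊢ C ≈ D ⊎ (∀ {e} → C v t ≢ D v t → D v t ≡ just e → Star (Bicoloured C m e) t v)
      at t with D v t in Dt
      ... | nothing = inj₂ (λ _ ())
      ... | just e with C v t ≟ᴹ just e
      ...   | yes eq = inj₂ (λ neq _ → contradiction eq neq)
      ...   | no neq with relink s m<k Cm Dm (λ eq → neq (trans eq Dt)) Dt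
      ...     | inj₁ done = inj₁ done
      ...     | inj₂ link = inj₂ (λ { _ refl → link })

    -- A neighbour `w` of `u` whose edge to `v` changes would form a triangle with `u` and `v`. The
    -- chains supplied by `Links` then contain a detour around one of its edges: around `wv` or `uv`
    -- if `uw` has colour `m`, and around `uw` or `uv` otherwise.
    moved-apart : ∀ {C D m u y z c e} → Situation C D → Misses C v m → Links C D m → c ≢ e → y ≢ z →
                  C v u ≡ just c → D v u ≡ just e → C v y ≡ just e → D v z ≡ just c →
                  ∀ {w} → A u w ≡ true → w ≢ v → C v w ≡ D v w
    moved-apart {C} {D} {m} {u} {y} {z} {c} {e} s Cm link c≢e y≢z Cu Du Cy Dz {w} uw w≢v with C v w ≟ᴹ D v w
    ... | yes eq = eq
    ... | no neq = ⊥-elim (clash-at (colour P uw))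
      where
      P : IsColouring A k C
      P = colC s
      u-moves : C v u ≢ D v u
      u-moves eq = c≢e (Maybeₚ.just-injective (trans (sym Cu) (trans eq Du)))
      v≢u : v ≢ u
      v≢u = edge-≢ irr P Cu
      Avu : A v u ≡ true
      Avu = adj P Cu
      Avw : A v w ≡ true
      Avw = moved-edge s neq
      f : ℕ
      f = proj₁ (colour (colD s) Avw)
      Dw : D v w ≡ just f
      Dw = proj₂ (colour (colD s) Avw)
      Asym : ∀ {x t} → A x t ≡ true → A t x ≡ true
      Asym a = adj P (flip P (proj₂ (colour P a)))
      adj-bi : ∀ {x t g} → Bicoloured C m g x t → A x t ≡ true
      adj-bi = [ adj P , adj P ]′
      ue : Misses C u e
      ue = target-missing s u-moves Du
      detour : ∀ {a b x g} → ¬ Bicoloured C m g a b → Star (Avoiding (Bicoloured C m g) x) a b → Star (Detour A a b x) a b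
      detour ¬ab = Star.map λ { (r , p , q) → (adj-bi r , p , q) , (λ { (refl , refl) → ¬ab r })
                                                              , (λ { (refl , refl) → ¬ab (flip-bi P r) }) }
      around : ∀ {a} → C u w ≡ just a → a ≢ m → ¬ Star (Avoiding (Bicoloured C m e) v) u w
      around ua a≢m st = no-detour uw (Asym Avw) (Asym Avu)
        (detour [ (λ h → a≢m (Maybeₚ.just-injective (trans (sym ua) h))) , absent ue w ]′ st)
      clash-at : ∃[ a ] C u w ≡ just a → ⊥
      clash-at (a , ua) with a ℕ.≟ m | w Fin.≟ y
      ... | yes refl | no w≢y = no-detour (Asym Avw) Avu (Asym uw) (detour
              [ (λ h → absent Cm w (flip P h)) , (λ h → w≢y (uniq P (flip P h) Cy)) ]′
              (leave-root (λ { (inj₁ h) → uniq P h ua ; (inj₂ h) → contradiction h (absent ue _) }) v≢u (link u u-moves Du)))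
      ... | yes refl | yes refl = no-detour (Asym Avu) Avw uw (detour
              [ (λ h → absent Cm u (flip P h))
              , (λ h → y≢z (uniq (colD s) (trans Dw (trans (sym h) (flip P Cu))) Dz)) ]′
              (leave-root (λ { (inj₁ h) → uniq P h (flip P ua) ; (inj₂ h) → contradiction h (absent (target-missing s neq Dw) _) })
                (≢-sym w≢v) (link w neq Dw)))
      -- The chain enters `v` through `y`. If the part from `u` to `y` meets `w`, it is a detour for
      -- `uw` that avoids `v`; if not, prolonged by `yv` it is a detour for `uv` that avoids `w`.
      ... | no a≢m | w≟y = via w≟y (star-flip (λ (r , p , q) → flip-bi P r , q , p) (leave-root
              (λ { (inj₁ h) → contradiction h (absent Cm _) ; (inj₂ h) → uniq P h Cy })
              (≢-sym v≢u) (star-flip (flip-bi P) (link u u-moves Du))))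
        where
        y≢u : y ≢ u
        y≢u refl = c≢e (Maybeₚ.just-injective (trans (sym Cu) Cy))
        v≢y : v ≢ y
        v≢y = edge-≢ irr P Cy
        via : Dec (w ≡ y) → Star (Avoiding (Bicoloured C m e) v) u y → ⊥
        via (yes refl) st = around ua a≢m st
        via (no w≢y) st with meet w st
        ... | inj₂ st′ = around ua a≢m st′
        ... | inj₁ st′ = no-detour (Asym Avu) Avw uw
          (Star.map (λ { ((r , p , q) , p′ , q′) → (adj-bi r , p′ , q′) , (λ { (_ , refl) → q refl }) , (λ { (refl , _) → p refl }) }) st′
           ◅◅ (((adj P (flip P Cy) , ≢-sym w≢y , ≢-sym w≢v)
               , (λ (y≡u , _) → y≢u y≡u) , (λ (y≡v , _) → v≢y (sym y≡v))) ◅ ε))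

    star-step : ∀ {C D} → Situation C D → k ⊢ C ≈ D
    star-step {C} {D} s with Finₚ.any? (λ t → ¬? (C v t ≟ᴹ D v t))
    ... | no none = pointwise same
      where
      at-v : ∀ x → C v x ≡ D v x
      at-v x with C v x ≟ᴹ D v x
      ... | yes eq = eq
      ... | no neq = contradiction (x , neq) none
      same : C ≐ D
      same x t with x Fin.≟ v | t Fin.≟ v
      ... | yes refl | _ = at-v t
      ... | no _ | yes refl = trans (symm (colC s) x v) (trans (at-v x) (symm (colD s) v x))
      ... | no p | no q = off (agree s) p q
    ... | yes (u , u-moves) with onto s | onto (flip-situation s)
    ...   | inj₁ done | _ = done
    ...   | inj₂ _ | inj₁ done = symᴷ done
    ...   | inj₂ f | inj₂ g = main (room (colC s) v)
      where
      P : IsColouring A k C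
      P = colC s
      edge-vu : A v u ≡ true
      edge-vu = moved-edge s u-moves
      c e : ℕ
      c = proj₁ (colour P edge-vu)
      e = proj₁ (colour (colD s) edge-vu)
      Cu : C v u ≡ just c
      Cu = proj₂ (colour P edge-vu)
      Du : D v u ≡ just e
      Du = proj₂ (colour (colD s) edge-vu)
      c≢e : c ≢ e
      c≢e eq = u-moves (trans Cu (trans (cong just eq) (sym Du)))
      y z : Fin n
      y = proj₁ (f u u-moves Du)
      z = proj₁ (g u (≢-sym u-moves) Cu)
      Cy : C v y ≡ just e
      Cy = proj₂ (f u u-moves Du)
      Dz : D v z ≡ just c
      Dz = proj₂ (g u (≢-sym u-moves) Cu)
      unseen : ∀ {m} → Misses C v m → Misses D v m
      unseen {m} Cm = missing absent-D
        where
        absent-D : ∀ x → D v x ≢ just m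
        absent-D x h with C v x ≟ᴹ D v x
        ... | yes eq = absent Cm x (trans eq h)
        ... | no neq = absent Cm _ (proj₂ (f x neq h))
      main : ∃[ m ] m < k × Misses C v m → k ⊢ C ≈ D
      main (m , m<k , Cm) with links s m<k Cm (unseen Cm) | y Fin.≟ z
      ... | inj₁ done | _ = done
      ... | inj₂ _ | yes y≡z = two-cycle s c≢e Cu Du Cy (trans (cong (D v) y≡z) Dz)
      ... | inj₂ ls | no y≢z = Core.solve c≢e (record
        { situation = s ; m<k = m<k ; missC = Cm ; missD = unseen Cm ; Cu = Cu ; Du = Du ; Cy = Cy ; Dz = Dz
        ; apart = moved-apart s Cm ls c≢e y≢z Cu Du Cy Dz })

  star-lemma-≤ : ∀ p {C D} → IsColouring A k C → IsColouring A k D → AgreeOff C D → count (diff C D) ≤ p → k ⊢ C ≈ D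
  star-lemma-≤ p P Q ag le = Descent.star-step (smaller p) (record { colC = P ; colD = Q ; agree = ag ; size = le })
    where
    smaller : ∀ p {C D} → IsColouring A k C → IsColouring A k D → AgreeOff C D → count (diff C D) < p → k ⊢ C ≈ D
    smaller (suc p) P Q ag (s≤s le) = star-lemma-≤ p P Q ag le

  star-lemma : ∀ {C D} → IsColouring A k C → IsColouring A k D → AgreeOff C D → k ⊢ C ≈ D
  star-lemma P Q ag = star-lemma-≤ _ P Q ag ℕₚ.≤-refl

-- Freeing a vertex from a colour and bringing an edge into a class

module _ {n : ℕ} {A : Fin n → Fin n → Bool} {k : ℕ} (irr : ∀ x → A x x ≡ false)
         (room : Roomy A k) (no-detour : NoDetour A) where

  -- At most one edge enters the colour class s, and it is an edge at a.
  record Freed (C : Colouring n) (v a : Fin n) (s : ℕ) : Set where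
    field
      result : Colouring n
      equiv  : k ⊢ C ≈ result
      freed  : Misses result v s
      kept   : ∀ {x y} → C x y ≡ just s → x ≢ v → y ≢ v → result x y ≡ just s
      free   : ∀ {x} → A x a ≡ false → Misses C x s → Misses result x s

  open Freed

  freed-after-swap : ∀ {C v a s c d S} → c < k → d < k → Closed C c d S → s ≢ c → s ≢ d →
                     Freed (swap c d S C) v a s → Freed C v a s
  freed-after-swap c<k d<k cl s≢c s≢d F = record
    { result = result F ; equiv = transᴷ (kempe _ _ _ c<k d<k cl) (equiv F) ; freed = freed F
    ; kept = λ e → kept F (swap-keep s≢c s≢d e) ; free = λ xa h → free F xa (misses-keep s≢c s≢d h) }

  module _ {C : Colouring n} {v a : Fin n} {s : ℕ} (P : IsColouring A k C) (va : C v a ≡ just s) where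

    private
      av : C a v ≡ just s
      av = flip P va

      v≢a : v ≢ a
      v≢a = edge-≢ irr P va

      s<k : s < k
      s<k = bounded P va

      off-a : ∀ {x y} → C x y ≡ just s → x ≢ v → y ≢ v → x ≢ a × y ≢ a
      off-a e x≢v y≢v = (λ { refl → y≢v (uniq P e av) }) , (λ { refl → x≢v (uniq P (flip P e) av) })

    -- The fan begins at `v`, the only neighbour of `a` along `s`. Turning it removes `s` from `a`,
    -- and `v` had no other edge of this colour.
    shift-walk : ∀ {ok w b} → Walk C a ok s w → Misses C w b → Misses C a b → b < k → Freed C v a s
    shift-walk {ok} {w} {b} p wb ab b<k with walk-fan p
    ... | ps , fan , vs = record
      { result = C₁ ; equiv = proj₁ turned ; freed = missing freed₁
      ; kept = λ e x≢v y≢v → trans (restar-off (proj₁ (off-a e x≢v y≢v)) (proj₂ (off-a e x≢v y≢v))) e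
      ; free = λ {x} _ h → missing (free₁ x h) }
      where
      g : Fin n → Maybe ℕ
      g = override (C a) ((w , b) ∷ ps)
      C₁ : Colouring n
      C₁ = restar C a g
      turned : k ⊢ C ≈ C₁ × (∀ x → g x ≢ just s)
      turned = turn irr (fan b) P (λ _ → refl) (wb ∷ All.map (λ h → proj₁ (proj₂ h)) vs) (absent ab) b<k
      freed₁ : ∀ x → C₁ v x ≢ just s
      freed₁ x e with x Fin.≟ a
      ... | yes refl = proj₂ turned v (trans (sym (restar-at′ v)) e)
      ... | no x≢a = x≢a (uniq P (trans (sym (restar-off v≢a x≢a)) e) va)
      free₁ : ∀ x → Misses C x s → ∀ y → C₁ x y ≢ just s
      free₁ x h y e with x Fin.≟ a | y Fin.≟ a
      ... | yes refl | _ = proj₂ turned y (trans (sym (restar-at y)) e)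
      ... | no _ | yes refl = proj₂ turned x (trans (sym (restar-at′ x)) e)
      ... | no p | no q = absent h y (trans (sym (restar-off p q)) e)

    -- With the spare colour k a closed fan can be rotated by Kempe changes, which shows that the result is a
    -- colouring; by the star lemma it is also reached without the spare colour.
    rotate : ∀ {w} → Walk C a (_≢ s) s w → Misses C w s → Freed C v a s
    rotate {w} p ws = [ (λ { refl → contradiction va (absent ws a) }) , turned ]′ (tail p)
      where
      C⁺ : Colouring n
      C⁺ = recolour C a v k
      fresh : ∀ {x y} → C x y ≢ just k
      fresh e = ℕₚ.<-irrefl refl (bounded P e)
      P′ : IsColouring A (suc k) C
      P′ = record { proper = proper P ; support = support P ; bounded = λ e → ℕₚ.m<n⇒m<1+n (bounded P e) }
      P⁺ : IsColouring A (suc k) C⁺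
      P⁺ = ≈-colouring (recolour-≈ irr P′ av (missing (λ _ → fresh)) (missing (λ _ → fresh)) (ℕₚ.n<1+n k)) P′
      C⁺-old : ∀ {x y e} → e ≢ k → C⁺ x y ≡ just e → C x y ≡ just e
      C⁺-old {x} {y} e≢k q with x Fin.≟ a | y Fin.≟ a
      C⁺-old {x} {y} e≢k q | yes refl | _ with y Fin.≟ v
      ... | yes refl = contradiction (Maybeₚ.just-injective (trans (sym q) (recolour-here v k))) e≢k
      ... | no y≢v = trans (sym (recolour-at y≢v)) q
      C⁺-old {x} {y} e≢k q | no _ | yes refl with x Fin.≟ v
      ... | yes refl = contradiction (Maybeₚ.just-injective (trans (sym q) (recolour-here′ v k))) e≢k
      ... | no x≢v = flip P (trans (sym (recolour-at x≢v)) (flip P⁺ q))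
      C⁺-old e≢k q | no x≢a | no y≢a = trans (sym (recolour-off x≢a y≢a)) q
      misses⁺ : ∀ {x e} → e ≢ k → Misses C x e → Misses C⁺ x e
      misses⁺ e≢k h = missing (λ y q → absent h y (C⁺-old e≢k q))
      -- What is left of the walk without its first vertex `v`. It starts with a colour `b` that `v`
      -- misses; after the rotation `av` receives `b` in place of the spare colour.
      Tail : Fin n → Set
      Tail w = ∃[ b ] b < k × b ≢ s × Misses C v b × Walk C⁺ a (_< k) b w
      tail : ∀ {w} → Walk C a (_≢ s) s w → w ≡ v ⊎ Tail w
      tail (begin e) = inj₁ (uniq P e av)
      tail (next {w = x} {w′} {b} q m b≢s e) = inj₂ (go (tail q))
        where
        b<k : b < k
        b<k = bounded P e
        e⁺ : C⁺ a w′ ≡ just b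
        e⁺ = trans (recolour-at (λ { refl → b≢s (Maybeₚ.just-injective (trans (sym e) av)) })) e
        go : x ≡ v ⊎ Tail x → Tail w′
        go (inj₁ refl) = b , b<k , b≢s , m , begin e⁺
        go (inj₂ (b₀ , b₀<k , b₀≢s , vb₀ , q⁺)) = b₀ , b₀<k , b₀≢s , vb₀ , next q⁺ (misses⁺ (ℕₚ.<⇒≢ b<k) m) b<k e⁺
      turned : Tail w → Freed C v a s
      turned (b , b<k , b≢s , vb , q) with walk-fan q
      ... | ps , fan , vs = record
        { result = D ; equiv = StarLemma.star-lemma irr room no-detour a P PD (StarLemma.agreeing (λ x≢a y≢a → sym (D-off x≢a y≢a)))
        ; freed = missing freed₁
        ; kept = λ e x≢v y≢v → trans (D-off (proj₁ (off-a e x≢v y≢v)) (proj₂ (off-a e x≢v y≢v))) e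
        ; free = λ {x} xa h → missing (free₁ x xa h) }
        where
        qs : List (Fin n × ℕ)
        qs = (w , s) ∷ ps
        g : Fin n → Maybe ℕ
        g = override (C⁺ a) qs
        E D : Colouring n
        E = restar C⁺ a g
        D = recolour E a v b
        s≢k : s ≢ k
        s≢k = ℕₚ.<⇒≢ s<k
        not-v : ∀ {x} → Walk C⁺ a (_< k) b x → x ≢ v
        not-v r refl with walk-colour r
        ... | e , h , inj₁ refl = ℕₚ.<⇒≢ b<k (Maybeₚ.just-injective (trans (sym h) (recolour-here v k)))
        ... | e , h , inj₂ e<k = ℕₚ.<⇒≢ e<k (Maybeₚ.just-injective (trans (sym h) (recolour-here v k)))
        v∉ : ∀ {rs} → All (λ r → proj₁ r ≢ v) rs → v ∉ map proj₁ rs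
        v∉ (h ∷ _) (here refl) = h refl
        v∉ (_ ∷ hs) (there i)  = v∉ hs i
        g-v : g v ≡ just k
        g-v = trans (override-∉ {ps = qs} (v∉ {qs} (not-v q ∷ All.map (not-v ∘ proj₁) vs))) (recolour-here v k)
        g-< : ∀ {rs x e} → All (λ r → proj₂ r < k) rs → x ≢ v → override (C⁺ a) rs x ≡ just e → e < k
        g-< {[]} [] x≢v h = bounded P (trans (sym (recolour-at x≢v)) h)
        g-< {(w′ , e′) ∷ rs} {x} (l ∷ ls) x≢v h with x Fin.≟ w′
        g-< (l ∷ ls) x≢v refl | yes refl = l
        ... | no _ = g-< ls x≢v h
        turned⁺ : suc k ⊢ C⁺ ≈ E × (∀ x → g x ≢ just b)
        turned⁺ = turn irr (fan s) P⁺ (λ _ → refl) (misses⁺ s≢k ws ∷ All.map (λ h → proj₁ (proj₂ h)) vs)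
          (λ x h → s≢k (Maybeₚ.just-injective (trans (sym h) (subst (λ y → C⁺ a y ≡ just k) (uniq P av (C⁺-old s≢k h)) (recolour-here v k)))))
          (ℕₚ.m<n⇒m<1+n s<k)
        PE : IsColouring A (suc k) E
        PE = ≈-colouring (proj₁ turned⁺) P⁺
        E-v : ∀ x → E v x ≢ just b
        E-v x h with x Fin.≟ a
        ... | yes refl = ℕₚ.<⇒≢ b<k (Maybeₚ.just-injective (trans (sym h) (trans (restar-at′ v) g-v)))
        ... | no x≢a = absent vb x (trans (sym (recolour-off v≢a x≢a)) (trans (sym (restar-off v≢a x≢a)) h))
        PD⁺ : IsColouring A (suc k) D
        PD⁺ = ≈-colouring (recolour-≈ irr PE (trans (restar-at v) g-v)
          (missing (λ x h → proj₂ turned⁺ x (trans (sym (restar-at x)) h))) (missing E-v) (ℕₚ.m<n⇒m<1+n b<k)) PE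
        D-off : ∀ {x y} → x ≢ a → y ≢ a → D x y ≡ C x y
        D-off p q = trans (recolour-off p q) (trans (restar-off p q) (recolour-off p q))
        row-< : ∀ {y e} → D a y ≡ just e → e < k
        row-< {y} h with y Fin.≟ v
        ... | yes refl = subst (_< k) (Maybeₚ.just-injective (trans (sym (recolour-here v b)) h)) b<k
        ... | no y≢v = g-< (s<k ∷ All.map (λ r → proj₂ (proj₂ r)) vs) y≢v (trans (sym (trans (recolour-at y≢v) (restar-at y))) h)
        D-< : ∀ {x y e} → D x y ≡ just e → e < k
        D-< {x} {y} h with x Fin.≟ a | y Fin.≟ a
        ... | yes refl | _ = row-< h
        ... | no _ | yes refl = row-< (flip PD⁺ h)
        ... | no p | no q = bounded P (trans (sym (D-off p q)) h)
        PD : IsColouring A k D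
        PD = record { proper = proper PD⁺ ; support = support PD⁺ ; bounded = D-< }
        freed₁ : ∀ x → D v x ≢ just s
        freed₁ x h with x Fin.≟ a
        ... | yes refl = b≢s (Maybeₚ.just-injective (trans (sym (recolour-here′ v b)) h))
        ... | no x≢a = x≢a (uniq P (trans (sym (D-off v≢a x≢a)) h) va)
        free₁ : ∀ x → A x a ≡ false → Misses C x s → ∀ y → D x y ≢ just s
        free₁ x xa h y e with x Fin.≟ a | y Fin.≟ a
        ... | yes refl | _ = absent h v av
        ... | no _ | yes refl = true≢false (trans (sym (adj PD e)) xa)
        ... | no p | no q = absent h y (trans (sym (D-off p q)) e)

  module _ {C : Colouring n} {v a : Fin n} {s : ℕ} (P : IsColouring A k C) (va : C v a ≡ just s) where

    private
      av : C a v ≡ just s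
      av = flip P va

    -- As `a` misses `μ`, it is an end of its (x, μ)-chain, which contains at most one of `p` and
    -- `q`. Swapping outside this chain leaves the edges at `a` alone and makes the vertex off the
    -- chain miss `μ`, as `a` does. If `p` is on the chain it still misses `x`, so the two walks
    -- join and lead to `q`.
    unfork : ∀ {p q x} → p ≢ q → x ≢ s → Walk C a (Inner₃ s s x) s p → Misses C p x →
             Walk C a (Inner₃ s s x) x q → Misses C q x → Freed C v a s
    unfork {p} {q} {x} p≢q x≢s sp px xq qx with room P a
    ... | μ , μ<k , aμ = choose (Component.mem L p) refl
      where
      μ≢s : μ ≢ s
      μ≢s refl = absent aμ v av
      L : Component {R = Bicoloured C x μ} a
      L = chain C x μ a
      S : VSet n
      S = ∁ (Component.mem L)
      cl : Closed C x μ S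
      cl = ∁-closed (chain-closed (proper P) L)
      C′ : Colouring n
      C′ = swap x μ S C
      P′ : IsColouring A k C′
      P′ = swap-colouring (bounded P (proj₂ (walk-source xq))) μ<k cl P
      a∉ : S a ≡ false
      a∉ = ∁-false (Component.root L)
      stay : ∀ {y c} → C a y ≡ just c → C′ a y ≡ just c
      stay h = trans (swap-out _ a∉) h
      keep : ∀ {w w′ b} → Inner₃ s s x b → Misses C w b → C a w′ ≡ just b → Misses C′ w b × b ≢ s × C′ a w′ ≡ just b
      keep ((b≢s , _) , b≢x) h e = misses-keep b≢x (λ { refl → absent aμ _ e }) h , b≢s , stay e
      sp′ : Walk C′ a (_≢ s) s p
      sp′ = walk-map stay keep sp
      aμ′ : Misses C′ a μ
      aμ′ = misses-out a∉ aμ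
      crossed : ∀ {w} → Component.mem L w ≡ false → Misses C w x → Misses C′ w μ
      crossed w∉ h = misses-in (∁-true w∉) (subst (Misses C _) (sym (exchange-r x μ)) h)
      vertex : ∀ {ok t w} → Walk C a ok t w → w ≢ a
      vertex r = ≢-sym (edge-≢ irr P (proj₁ (proj₂ (walk-colour r))))
      back : Freed C′ v a s → Freed C v a s
      back = freed-after-swap (bounded P (proj₂ (walk-source xq))) μ<k cl (≢-sym x≢s) (≢-sym μ≢s)
      va′ : C′ v a ≡ just s
      va′ = flip P′ (stay av)
      choose : ∀ b → Component.mem L p ≡ b → Freed C v a s
      choose false p∉ = back (shift-walk P′ va′ sp′ (crossed p∉ px) aμ′ μ<k)
      choose true p∈ = back (shift-walk P′ va′ (walk-join sp′ (misses-out (∁-false p∈) px) x≢s (walk-map stay keep xq))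
                               (crossed q∉ qx) aμ′ μ<k)
        where
        q∉ : Component.mem L q ≡ false
        q∉ = Boolₚ.¬-not (λ q∈ → three-ends (proper P) (inj₂ aμ) (inj₁ px) (inj₁ qx) (vertex sp) (vertex xq) p≢q
                                   (Component.reached L p∈) (Component.reached L q∈))

    -- With `c` equal to `s`, the outcomes `blocked` and `loop` coincide: both are closed fans.
    make-free : Freed C v a s
    make-free with explore (proper P) (room P) a s s av
    ... | escape p wb b<k ab           = shift-walk P va p wb ab b<k
    ... | blocked p ws                 = rotate P va (walk-weaken proj₁ p) ws
    ... | loop p ws                    = rotate P va (walk-weaken proj₁ p) ws
    ... | fork p≢q x≢s _ sp px xq qx   = unfork p≢q x≢s sp px xq qx

  Kept : Colouring n → Colouring n → ℕ → Fin n → Fin n → Set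
  Kept C C′ s u v = ∀ {x y} → C x y ≡ just s → x ≢ u → y ≢ u → x ≢ v → y ≢ v → C′ x y ≡ just s

  Improved : Colouring n → ℕ → Fin n → Fin n → Set
  Improved C s u v = ∃[ C′ ] k ⊢ C ≈ C′ × C′ u v ≡ just s × Kept C C′ s u v

  improve-free : ∀ {C s u v} → IsColouring A k C → s < k → A u v ≡ true → Misses C u s → Misses C v s → Improved C s u v
  improve-free {C} {s} {u} {v} P s<k uv us vs = recolour C u v s , recolour-≈ irr P (proj₂ (colour P uv)) us vs s<k ,
    recolour-here v s , λ e x≢u y≢u _ _ → trans (recolour-off x≢u y≢u) e

  improve-after : ∀ {C C₁ s u v} → k ⊢ C ≈ C₁ → Kept C C₁ s u v → Improved C₁ s u v → Improved C s u v
  improve-after p keep (C₂ , q , uv , keep₂) =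
    C₂ , transᴷ p q , uv , λ e x≢u y≢u x≢v y≢v → keep₂ (keep e x≢u y≢u x≢v y≢v) x≢u y≢u x≢v y≢v

  -- Let v miss x and a miss μ.  If the (μ , x)-chain of v avoids a, swapping it frees v; otherwise NoDetour
  -- forces uv to have colour μ and ua colour x, and then the edges uv and va form a (μ , s)-chain.
  improve-triangle : ∀ {C s u v a} → IsColouring A k C → Misses C u s → C v a ≡ just s →
                     A u v ≡ true → A u a ≡ true → Improved C s u v
  improve-triangle {C} {s} {u} {v} {a} P us va uv ua with room P v | room P a
  ... | x , x<k , vx | μ , μ<k , aμ = by-x (sees? C a x)
    where
    s<k : s < k
    s<k = bounded P va
    x≢s : x ≢ s
    x≢s refl = absent vx a va
    μ≢s : μ ≢ s
    μ≢s refl = absent aμ v (flip P va)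
    v≢a : v ≢ a
    v≢a = edge-≢ irr P va
    Asym : ∀ {x t} → A x t ≡ true → A t x ≡ true
    Asym e = adj P (flip P (proj₂ (colour P e)))
    u≢a : u ≢ a
    u≢a refl = true≢false (trans (sym ua) (irr u))
    u≢v : u ≢ v
    u≢v refl = true≢false (trans (sym uv) (irr u))
    Ava : A v a ≡ true
    Ava = adj P va
    recoloured : ∀ {C₁ b} → IsColouring A k C₁ → Misses C₁ u s → C₁ v a ≡ just s → Misses C₁ v b → Misses C₁ a b →
                 b < k → b ≢ s → Improved C₁ s u v
    recoloured {C₁} {b} P₁ us₁ va₁ vb ab b<k b≢s =
      improve-after C₁≈C₂ (λ e _ _ x≢v y≢v → trans (recolour-off x≢v y≢v) e)
        (improve-free (≈-colouring C₁≈C₂ P₁) s<k uv (missing us₂) (missing vs₂))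
      where
      C₂ : Colouring n
      C₂ = recolour C₁ v a b
      C₁≈C₂ : k ⊢ C₁ ≈ C₂
      C₁≈C₂ = recolour-≈ irr P₁ va₁ vb ab b<k
      us₂ : ∀ y → C₂ u y ≢ just s
      us₂ y e = absent us₁ y (trans (sym (recolour-off₂ y u≢v u≢a)) e)
      vs₂ : ∀ y → C₂ v y ≢ just s
      vs₂ y e with y Fin.≟ a
      ... | yes refl = b≢s (Maybeₚ.just-injective (trans (sym (recolour-here a b)) e))
      ... | no y≢a = y≢a (uniq P₁ (trans (sym (recolour-at y≢a)) e) va₁)
    L : Component {R = Bicoloured C μ x} v
    L = chain C μ x v
    by-x : (∃[ y ] C a y ≡ just x) ⊎ Misses C a x → Improved C s u v
    by-x (inj₂ ax) = recoloured P us va vx ax x<k x≢s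
    by-x (inj₁ (y , ay)) = by-chain (Component.mem L a) refl
      where
      trapped : Component.mem L a ≡ true → C v u ≡ just μ × C a u ≡ just x
      trapped a∈ = proj₁ found , proj₂ found
        where
        st : Star (Bicoloured C μ x) v a
        st = Component.reached L a∈
        adj-bi : ∀ {b c} → Bicoloured C μ x b c → A b c ≡ true
        adj-bi = [ adj P , adj P ]′
        detour : ∀ {b c d} → ¬ Bicoloured C μ x b c → Star (Avoiding (Bicoloured C μ x) d) b c → Star (Detour A b c d) b c
        detour ¬bc = Star.map λ { (r , p , q) → (adj-bi r , p , q) , (λ { (refl , refl) → ¬bc r })
                                                                , (λ { (refl , refl) → ¬bc (flip-bi P r) }) }
        ¬va : ¬ Bicoloured C μ x v a
        ¬va = [ (λ h → μ≢s (Maybeₚ.just-injective (trans (sym h) va))) , (λ h → x≢s (Maybeₚ.just-injective (trans (sym h) va))) ]′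
        to-y : Star (Avoiding (Bicoloured C μ x) a) v y
        to-y = star-flip (λ (r , p , q) → flip-bi P r , q , p)
          (leave-root (λ { (inj₁ h) → contradiction h (absent aμ _) ; (inj₂ h) → uniq P h ay }) v≢a (star-flip (flip-bi P) st))
        vu-μ : Star (Avoiding (Bicoloured C μ x) a) v u → C v u ≡ just μ
        vu-μ st′ with C v u ≟ᴹ just μ
        ... | yes h = h
        ... | no ¬h = ⊥-elim (no-detour (Asym uv) ua Ava (detour [ ¬h , absent vx u ]′ st′))
        found : C v u ≡ just μ × C a u ≡ just x
        -- The chain from `v` enters `a` through `y`. If `y` is not `u`, there are two cases: a
        -- chain avoiding `u` is a detour for `va`; a chain through `u` must begin with `vu`, and
        -- its remainder is a detour for `ua` that avoids `v`.
        found with y Fin.≟ u | meet u to-y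
        ... | yes refl | _ = vu-μ to-y , ay
        ... | no y≢u | inj₁ st′ = ⊥-elim (no-detour Ava (Asym ua) (Asym uv) (detour ¬va
          (Star.map (λ { ((r , _ , _) , p , q) → r , p , q }) st′ ◅◅ ((flip-bi P (inj₂ ay) , y≢u , ≢-sym u≢a) ◅ ε))))
        ... | no y≢u | inj₂ st′ = ⊥-elim (no-detour ua (Asym Ava) uv (detour
          [ (λ h → absent aμ u (flip P h)) , (λ h → y≢u (uniq P ay (flip P h))) ]′
          (leave-root (λ { (inj₁ h) → uniq P h (vu-μ st′) ; (inj₂ h) → contradiction h (absent vx _) }) (≢-sym v≢a) st)))
      by-chain : ∀ b → Component.mem L a ≡ b → Improved C s u v
      by-chain false a∉ = improve-after (kempe μ x (Component.mem L) μ<k x<k cl) (λ e _ _ _ _ → swap-keep (≢-sym μ≢s) (≢-sym x≢s) e)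
        (recoloured (swap-colouring μ<k x<k cl P) (misses-keep (≢-sym μ≢s) (≢-sym x≢s) us) (swap-keep (≢-sym μ≢s) (≢-sym x≢s) va)
          (misses-in (Component.root L) (subst (Misses C v) (sym (exchange-l μ x)) vx)) (misses-out a∉ aμ) μ<k μ≢s)
        where
        cl : Closed C μ x (Component.mem L)
        cl = chain-closed (proper P) L
      by-chain true a∈ = swap μ s S C , kempe μ s S μ<k s<k cl ,
        trans (swap-in-just u∈ (flip P vu)) (cong just (exchange-l μ s)) , kept₂
        where
        vu : C v u ≡ just μ
        vu = proj₁ (trapped a∈)
        S : VSet n
        S = insert v (insert u (insert a (λ _ → false)))
        v∈ : S v ≡ true
        v∈ = insert-here v (insert u (insert a (λ _ → false)))
        u∈ : S u ≡ true
        u∈ = insert-⊆ (insert-here u (insert a (λ _ → false)))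
        a∈S : S a ≡ true
        a∈S = insert-⊆ (insert-⊆ (insert-here a (λ _ → false)))
        out : ∀ {x t} → S x ≡ true → Bicoloured C μ s x t → S t ≡ true
        out x∈ b with triple-inv x∈ | b
        ... | inj₁ refl | inj₁ h = subst (λ t → S t ≡ true) (uniq P vu h) u∈
        ... | inj₁ refl | inj₂ h = subst (λ t → S t ≡ true) (uniq P va h) a∈S
        ... | inj₂ (inj₁ refl) | inj₁ h = subst (λ t → S t ≡ true) (uniq P (flip P vu) h) v∈
        ... | inj₂ (inj₁ refl) | inj₂ h = contradiction h (absent us _)
        ... | inj₂ (inj₂ refl) | inj₁ h = contradiction h (absent aμ _)
        ... | inj₂ (inj₂ refl) | inj₂ h = subst (λ t → S t ≡ true) (uniq P (flip P va) h) v∈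
        cl : Closed C μ s S
        cl = symm-closed (flip-bi P) out
        kept₂ : Kept C (swap μ s S C) s u v
        kept₂ {x} {y} e x≢u y≢u x≢v y≢v with S x in x∈
        ... | false = trans (swap-out y x∈) e
        ... | true with triple-inv x∈
        ...   | inj₁ h = contradiction h x≢v
        ...   | inj₂ (inj₁ h) = contradiction h x≢u
        ...   | inj₂ (inj₂ refl) = contradiction (uniq P e (flip P va)) y≢v

  -- Freeing `u` at a pivot `b` can bring `s` back to a neighbour of `b`. If `v` is one, then u, v,
  -- b is a triangle, and `improve-triangle` is applied with the roles of `u` and `v` exchanged.
  improve : ∀ {C s u v} → IsColouring A k C → s < k → A u v ≡ true → C u v ≢ just s → Improved C s u v
  improve {C} {s} {u} {v} P s<k uv uv≢s = first (sees? C v s)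
    where
    swap-ends : ∀ {C} → IsColouring A k C → Improved C s v u → Improved C s u v
    swap-ends P (C₂ , q , vu , keep) = C₂ , q , flip (≈-colouring q P) vu , λ e x≢u y≢u x≢v y≢v → keep e x≢v y≢v x≢u y≢u
    second : ∀ {C} → IsColouring A k C → Misses C v s → Improved C s u v
    second {C} P vs with sees? C u s
    ... | inj₂ us = improve-free P s<k uv us vs
    ... | inj₁ (b , ub) with A v b in vb
    ...   | true = swap-ends P (improve-triangle P vs ub (adj P (flip P (proj₂ (colour P uv)))) vb)
    ...   | false with make-free P ub
    ...     | F = improve-after (equiv F) (λ e x≢u y≢u _ _ → kept F e x≢u y≢u)
                    (improve-free (≈-colouring (equiv F) P) s<k uv (freed F) (free F vb vs))
    first : (∃[ a ] C v a ≡ just s) ⊎ Misses C v s → Improved C s u v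
    first (inj₂ vs) = second P vs
    first (inj₁ (a , va)) with make-free P va
    ... | F = improve-after (equiv F) (λ e _ _ x≢v y≢v → kept F e x≢v y≢v) (second (≈-colouring (equiv F) P) (freed F))

-- If `x` saw all k+1 colours, it would have k+1 edges, two of which would share one of the k
-- colours of `γ`.
roomy : ∀ {n} {A : Fin n → Fin n → Bool} {k γ} → IsColouring A k γ → Roomy A (suc k)
roomy {n} {A} {k} {γ} Q {C} P x with Finₚ.any? (λ (i : Fin (suc k)) → ¬? (Finₚ.any? (λ y → C x y ≟ᴹ just (toℕ i))))
... | yes (i , h) = toℕ i , Finₚ.toℕ<n i , missing (λ y e → h (y , e))
... | no none = contradiction (Finₚ.toℕ-injective (Maybeₚ.just-injective
      (trans (sym (proj₂ (seen i))) (trans (cong (C x) same-vertex) (proj₂ (seen j)))))) (λ i≡j → Finₚ.<⇒≢ i<j i≡j)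
  where
  seen : ∀ i → ∃[ y ] C x y ≡ just (toℕ i)
  seen i with Finₚ.any? (λ y → C x y ≟ᴹ just (toℕ i))
  ... | yes s = s
  ... | no ¬s = contradiction (i , ¬s) none
  γ-colour : ∀ i → ∃[ c ] γ x (proj₁ (seen i)) ≡ just c
  γ-colour i = colour Q (adj P (proj₂ (seen i)))
  f : Fin (suc k) → Fin k
  f i = fromℕ< (bounded Q (proj₂ (γ-colour i)))
  hole : ∃[ i ] ∃[ j ] i Fin.< j × f i ≡ f j
  hole = Finₚ.pigeonhole ℕₚ.≤-refl f
  i j : Fin (suc k)
  i = proj₁ hole
  j = proj₁ (proj₂ hole)
  i<j : i Fin.< j
  i<j = proj₁ (proj₂ (proj₂ hole))
  same-colour : proj₁ (γ-colour i) ≡ proj₁ (γ-colour j)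
  same-colour = Finₚ.fromℕ<-injective _ _ _ _ (proj₂ (proj₂ (proj₂ hole)))
  same-vertex : proj₁ (seen i) ≡ proj₁ (seen j)
  same-vertex = uniq Q (proj₂ (γ-colour i)) (trans (proj₂ (γ-colour j)) (cong just (sym same-colour)))

-- Covering a colour class, and induction on the number of colours

module _ {n : ℕ} where

  Covers : Colouring n → Colouring n → ℕ → ℕ → Set
  Covers C γ j s = ∀ {x y} → γ x y ≡ just j → C x y ≡ just s

  module _ {A : Fin n → Fin n → Bool} {k : ℕ} (irr : ∀ x → A x x ≡ false)
           (no-detour : NoDetour A) {γ : Colouring n} (Q : IsColouring A k γ) (j s : ℕ) (s<1+k : s < suc k) where

    Bad : Colouring n → Fin n → Set
    Bad C x = ∃[ y ] γ x y ≡ just j × C x y ≢ just s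

    bad? : ∀ C x → Dec (Bad C x)
    bad? C x = Finₚ.any? (λ y → (γ x y ≟ᴹ just j) ×-dec ¬? (C x y ≟ᴹ just s))

    opaque

      bad : Colouring n → VSet n
      bad C x = holds (bad? C x)

      bad-true : ∀ {C x} → Bad C x → bad C x ≡ true
      bad-true {C} {x} = holds-true (bad? C x)

      bad-inv : ∀ {C x} → bad C x ≡ true → Bad C x
      bad-inv {C} {x} = holds-inv (bad? C x)

    cover-≤ : ∀ p {C} → IsColouring A (suc k) C → count (bad C) < p → ∃[ C′ ] suc k ⊢ C ≈ C′ × Covers C′ γ j s
    cover-≤ (suc p) {C} P (s≤s le) with Finₚ.any? (bad? C)
    ... | no none = C , reflᴷ , covered
      where
      covered : Covers C γ j s
      covered {x} {y} e with C x y ≟ᴹ just s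
      ... | yes h = h
      ... | no ¬h = contradiction (x , y , e , ¬h) none
    ... | yes (u , v , uv , uv≢s) with improve irr (roomy Q) no-detour P s<1+k (adj Q uv) uv≢s
    ...   | C₁ , p₁ , uv-s , keep = C₂ , transᴷ p₁ (proj₁ (proj₂ rec)) , proj₂ (proj₂ rec)
      where
      P₁ : IsColouring A (suc k) C₁
      P₁ = ≈-colouring p₁ P
      -- The class `j` of `γ` is a matching that contains `uv`. An edge of this class touching `u`
      -- or `v` is therefore `uv` itself, which does not have colour `s` in `C`.
      good-stays : ∀ {x y} → γ x y ≡ just j → C x y ≡ just s → C₁ x y ≡ just s
      good-stays {x} {y} e h = keep h
        (λ { refl → uv≢s (trans (cong (C x) (uniq Q uv e)) h) })
        (λ { refl → uv≢s (trans (cong (C y) (uniq Q uv (flip Q e))) (flip P h)) })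
        (λ { refl → uv≢s (flip P (trans (cong (C x) (uniq Q (flip Q uv) e)) h)) })
        (λ { refl → uv≢s (flip P (trans (cong (C y) (uniq Q (flip Q uv) (flip Q e))) (flip P h))) })
      sub : ∀ x → bad C₁ x ≡ true → bad C x ≡ true
      sub x b with bad-inv b
      ... | y , e , ¬h = bad-true (y , e , λ h → ¬h (good-stays e h))
      u-good : bad C₁ u ≡ false
      u-good = Boolₚ.¬-not (λ b → good (bad-inv b))
        where
        good : ¬ Bad C₁ u
        good (y , e , ¬h) = ¬h (trans (cong (C₁ u) (uniq Q e uv)) uv-s)
      rec : ∃[ C′ ] suc k ⊢ C₁ ≈ C′ × Covers C′ γ j s
      rec = cover-≤ p P₁ (ℕₚ.<-≤-trans (count-strict sub u u-good (bad-true (v , uv , uv≢s))) le)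
      C₂ : Colouring n
      C₂ = proj₁ rec

    cover : ∀ {C} → IsColouring A (suc k) C → ∃[ C′ ] suc k ⊢ C ≈ C′ × Covers C′ γ j s
    cover P = cover-≤ _ P (ℕₚ.n<1+n _)

  -- Removing and restoring a colour class

  opaque

    paint : (Fin n → Fin n → Bool) → Maybe ℕ → Colouring n → Colouring n
    paint N a C x y = if N x y then a else C x y

    paint-on : ∀ {N a C x y} → N x y ≡ true → paint N a C x y ≡ a
    paint-on h rewrite h = refl

    paint-off : ∀ {N a C x y} → N x y ≡ false → paint N a C x y ≡ C x y
    paint-off h rewrite h = refl

    paint-cong : ∀ {N M a C D x y z t} → N x y ≡ M z t → C x y ≡ D z t → paint N a C x y ≡ paint M a D z t
    paint-cong {N} {M} {x = x} {y} {z} {t} h e rewrite h with M z t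
    ... | true  = refl
    ... | false = e

  -- Moves below `s` never involve a painted edge, so closed sets remain closed and every move
  -- lifts.
  paint-≈ : ∀ {N s C D} → s ⊢ C ≈ D → suc s ⊢ paint N (just s) C ≈ paint N (just s) D
  paint-≈ {N} {s} {C} {D} (pointwise e) = pointwise same
    where
    same : paint N (just s) C ≐ paint N (just s) D
    same x y = paint-cong {N = N} refl (e x y)
  paint-≈ {N} {s} (transᴷ p q) = transᴷ (paint-≈ p) (paint-≈ q)
  paint-≈ {N} {s} (kempe {C} c d S c<s d<s cl) =
    transᴷ (kempe c d S (ℕₚ.m<n⇒m<1+n c<s) (ℕₚ.m<n⇒m<1+n d<s) (closed (λ b → same-side cl (old b)))) (pointwise same)
    where
    old : ∀ {x y} → Bicoloured (paint N (just s) C) c d x y → Bicoloured C c d x y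
    old {x} {y} b with N x y in h
    ... | false = Sum.map (trans (sym (paint-off h))) (trans (sym (paint-off h))) b
    ... | true  = ⊥-elim ([ (λ e → ℕₚ.<⇒≢ c<s (Maybeₚ.just-injective (trans (sym e) (paint-on h))))
                          , (λ e → ℕₚ.<⇒≢ d<s (Maybeₚ.just-injective (trans (sym e) (paint-on h)))) ]′ b)
    same : swap c d S (paint N (just s) C) ≐ paint N (just s) (swap c d S C)
    same x y with N x y in h
    ... | true  = trans (swap-keep (≢-sym (ℕₚ.<⇒≢ c<s)) (≢-sym (ℕₚ.<⇒≢ d<s)) (paint-on h)) (sym (paint-on h))
    ... | false = trans (swap-agree refl (paint-off h)) (sym (paint-off h))

  -- The edges of the class k of C receive colour k in γ, one colour of γ after another.
  module _ {A : Fin n → Fin n → Bool} {k : ℕ} {γ C : Colouring n} (Q : IsColouring A k γ) (P : IsColouring A (suc k) C) where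

    class : Fin n → Fin n → Bool
    class x y = holds (C x y ≟ᴹ just k)

    class-true : ∀ {x y} → C x y ≡ just k → class x y ≡ true
    class-true {x} {y} = holds-true (C x y ≟ᴹ just k)

    class-inv : ∀ {x y} → class x y ≡ true → C x y ≡ just k
    class-inv {x} {y} = holds-inv (C x y ≟ᴹ just k)

    class-symm : ∀ x y → class x y ≡ class y x
    class-symm x y = cong (λ a → holds (a ≟ᴹ just k)) (symm P x y)

    private
      below : ℕ → Maybe ℕ → Bool
      below c nothing  = false
      below c (just a) = holds (a ℕ.<? c)

      below-just : ∀ {a c} → a < c → below c (just a) ≡ true
      below-just {a} {c} = holds-true (a ℕ.<? c)

      below-inv : ∀ {c} m → below c m ≡ true → ∃[ a ] m ≡ just a × a < c
      below-inv {c} (just a) e = a , refl , holds-inv (a ℕ.<? c) e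

      stage : ℕ → Fin n → Fin n → Bool
      stage c x y = class x y ∧ below c (γ x y)

      ∧-true : ∀ {a b} → a ≡ true → b ≡ true → a ∧ b ≡ true
      ∧-true refl refl = refl

      stage-on : ∀ {c a x y} → C x y ≡ just k → γ x y ≡ just a → a < c → stage c x y ≡ true
      stage-on xy e a<c = ∧-true (class-true xy) (trans (cong (below _) e) (below-just a<c))

      stage-inv : ∀ {c x y} → stage c x y ≡ true → C x y ≡ just k × ∃[ a ] γ x y ≡ just a × a < c
      stage-inv {c} {x} {y} e with class x y in h
      ... | true = class-inv h , below-inv (γ x y) e

      staged : ℕ → Colouring n
      staged c = paint (stage c) (just k) γ

      S : ℕ → VSet n
      S c x = holds (Finₚ.any? (λ y → (C x y ≟ᴹ just k) ×-dec (γ x y ≟ᴹ just c)))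

      S-on : ∀ {c x y} → C x y ≡ just k → γ x y ≡ just c → S c x ≡ true
      S-on {c} {x} {y} p q = holds-true (Finₚ.any? (λ y → (C x y ≟ᴹ just k) ×-dec (γ x y ≟ᴹ just c))) (y , p , q)

      S-inv : ∀ {c x} → S c x ≡ true → ∃[ y ] C x y ≡ just k × γ x y ≡ just c
      S-inv {c} {x} = holds-inv (Finₚ.any? (λ y → (C x y ≟ᴹ just k) ×-dec (γ x y ≟ᴹ just c)))

      staged-symm : ∀ c x y → staged c x y ≡ staged c y x
      staged-symm c x y = paint-cong {N = stage c} (cong₂ (λ b m → b ∧ below c m) (class-symm x y) (symm Q x y)) (symm Q x y)

      γ≢k : ∀ {x y} → γ x y ≢ just k
      γ≢k e = ℕₚ.<-irrefl refl (bounded Q e)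

      not-later : ∀ {c x y} → S c x ≡ true → stage c x y ≡ true → ⊥
      not-later h st with S-inv h | stage-inv st
      ... | y′ , xy′ , e′ | xy , a , e , a<c with uniq P xy xy′
      ...   | refl = ℕₚ.<-irrefl (Maybeₚ.just-injective (trans (sym e) e′)) a<c

      -- Each edge of the class with `γ`-colour `c` is a chain by itself: the class is a matching,
      -- so no painted edge of colour `k` meets it.
      S-closed : ∀ c → Closed (staged c) c k (S c)
      S-closed c = symm-closed (Sum.map (trans (staged-symm c _ _)) (trans (staged-symm c _ _))) out
        where
        out : ∀ {x y} → S c x ≡ true → Bicoloured (staged c) c k x y → S c y ≡ true
        out {x} {y} h b with stage c x y in st
        ... | true = ⊥-elim (not-later h st)
        ... | false with b
        ...   | inj₂ e = contradiction (trans (sym (paint-off st)) e) γ≢k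
        ...   | inj₁ e with S-inv h
        ...     | y′ , xy′ , e′ with uniq Q (trans (sym (paint-off st)) e) e′
        ...       | refl = S-on (flip P xy′) (flip Q e′)

      advance : ∀ c → c < k → suc k ⊢ staged c ≈ staged (suc c)
      advance c c<k = transᴷ (kempe c k (S c) (ℕₚ.m<n⇒m<1+n c<k) (ℕₚ.n<1+n k) (S-closed c)) (pointwise same)
        where
        same : ∀ x y → swap c k (S c) (staged c) x y ≡ staged (suc c) x y
        same x y with stage c x y in st | stage (suc c) x y in st′
        ... | true | true = trans (swap-out y (Boolₚ.¬-not (λ h → not-later h st))) (trans (paint-on st) (sym (paint-on st′)))
        ... | true | false = let (xy , a , e , a<c) = stage-inv st in
          contradiction (trans (sym (stage-on xy e (ℕₚ.m<n⇒m<1+n a<c))) st′) true≢false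
        ... | false | true = let (xy , a , e , a≤c) = stage-inv st′ ; a≡c = at xy e a≤c in
          trans (swap-in-just (S-on xy (trans e (cong just a≡c))) (trans (paint-off st) (trans e (cong just a≡c))))
                (trans (cong just (exchange-l c k)) (sym (paint-on st′)))
          where
          at : ∀ {a} → C x y ≡ just k → γ x y ≡ just a → a < suc c → a ≡ c
          at {a} xy e (s≤s a≤c) with a ℕ.≟ c
          ... | yes a≡c = a≡c
          ... | no a≢c = contradiction (trans (sym (stage-on xy e (ℕₚ.≤∧≢⇒< a≤c a≢c))) st) true≢false
        ... | false | false with γ x y ≟ᴹ just c
        ...   | no γ≢c = trans (swap-fix (γ≢c ∘ trans (sym (paint-off st))) (γ≢k ∘ trans (sym (paint-off st)))) (trans (paint-off st) (sym (paint-off st′)))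
        ...   | yes e = trans (swap-out y (Boolₚ.¬-not absurd)) (trans (paint-off st) (sym (paint-off st′)))
          where
          absurd : S c x ≢ true
          absurd h with S-inv h
          ... | y′ , xy′ , e′ with uniq Q e e′
          ...   | refl = true≢false (trans (sym (stage-on xy′ e (ℕₚ.n<1+n c))) st′)

      climb : ∀ c → c ≤ k → suc k ⊢ staged 0 ≈ staged c
      climb zero    _   = reflᴷ
      climb (suc c) c<k = transᴷ (climb c (ℕₚ.<⇒≤ c<k)) (advance c c<k)

    paint-class : suc k ⊢ γ ≈ paint class (just k) γ
    paint-class = transᴷ (pointwise first) (transᴷ (climb k ℕₚ.≤-refl) (pointwise last))
      where
      first : ∀ x y → γ x y ≡ staged 0 x y
      first x y = sym (paint-off {N = stage 0} (Boolₚ.¬-not (λ h → case proj₂ (stage-inv h) of λ { (_ , _ , ()) })))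
      last : ∀ x y → staged k x y ≡ paint class (just k) γ x y
      last x y = go (class x y) refl (stage k x y) refl
        where
        go : ∀ b → class x y ≡ b → ∀ b′ → stage k x y ≡ b′ → staged k x y ≡ paint class (just k) γ x y
        go true  h true  st = trans (paint-on st) (sym (paint-on h))
        go false h false st = trans (paint-off st) (sym (paint-off h))
        go false h true  st = contradiction (trans (sym (class-true (proj₁ (stage-inv st)))) h) true≢false
        go true  h false st = contradiction (trans (sym (stage-on (class-inv h) (proj₂ γxy) (bounded Q (proj₂ γxy)))) st) true≢false
          where
          γxy : ∃[ a ] γ x y ≡ just a
          γxy = colour Q (adj P (class-inv h))

  paint-nothing : ∀ {N C x y c} → paint N nothing C x y ≡ just c → N x y ≡ false × C x y ≡ just c
  paint-nothing {N} {C} {x} {y} e with N x y in h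
  ... | true  = case trans (sym (paint-on h)) e of λ ()
  ... | false = refl , trans (sym (paint-off h)) e

  without : (Fin n → Fin n → Bool) → (Fin n → Fin n → Bool) → Fin n → Fin n → Bool
  without A N x y = A x y ∧ not (N x y)

  without-⊆ : ∀ A N {x y} → without A N x y ≡ true → A x y ≡ true
  without-⊆ A N {x} {y} e with A x y
  ... | true = refl

  without-irr : ∀ {A N} → (∀ x → A x x ≡ false) → ∀ x → without A N x x ≡ false
  without-irr irr x rewrite irr x = refl

  without-no-detour : ∀ A N → NoDetour A → NoDetour (without A N)
  without-no-detour A N nd xy yz xz st = nd (sub xy) (sub yz) (sub xz)
    (Star.map (λ ((a , p , q) , r , s) → (sub a , p , q) , r , s) st)
    where
    sub : ∀ {x y} → without A N x y ≡ true → A x y ≡ true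
    sub = without-⊆ A N

  erase-colouring : ∀ {A N k l C} → (∀ x y → N x y ≡ N y x) → IsColouring A k C →
                    (∀ {x y c} → N x y ≡ false → C x y ≡ just c → c < l) →
                    IsColouring (without A N) l (paint N nothing C)
  erase-colouring {A} {N} {C = C} N-symm P bound = record
    { proper = record
      { symm = λ x y → paint-cong {N = N} (N-symm x y) (symm P x y)
      ; uniq = λ p q → uniq P (proj₂ (paint-nothing p)) (proj₂ (paint-nothing q)) }
    ; support = supp
    ; bounded = λ e → let (h , e′) = paint-nothing e in bound h e′ }
    where
    supp : ∀ x y → is-just (paint N nothing C x y) ≡ without A N x y
    supp x y with N x y in h
    ... | true  = trans (cong is-just (paint-on h)) (sym (Boolₚ.∧-zeroʳ (A x y)))
    ... | false = trans (cong is-just (paint-off h)) (trans (support P x y) (sym (Boolₚ.∧-identityʳ (A x y))))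

  all-equivalent : ∀ k {A : Fin n → Fin n → Bool} → (∀ x → A x x ≡ false) → NoDetour A → ∀ {γ C : Colouring n} →
                   IsColouring A k γ → IsColouring A (suc k) C → suc k ⊢ C ≈ γ
  all-equivalent zero {A} irr nd {γ} {C} Q P = pointwise empty
    where
    empty : C ≐ γ
    empty x y with C x y in e | γ x y in f
    ... | _       | just _  = contradiction (bounded Q f) λ ()
    ... | nothing | nothing = refl
    ... | just _  | nothing = case trans (sym f) (proj₂ (colour Q (adj P e))) of λ ()
  all-equivalent (suc j) {A} irr nd {γ} {C} Q P with cover irr nd Q j (suc j) (ℕₚ.n<1+n (suc j)) P
  ... | C′ , C≈C′ , covers = transᴷ C≈C′ (transᴷ (pointwise repaint) (transᴷ (paint-≈ rec)
                               (transᴷ (pointwise repaint-γ) (symᴷ (paint-class Q P′)))))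
    where
    P′ : IsColouring A (suc (suc j)) C′
    P′ = ≈-colouring C≈C′ P
    N : Fin n → Fin n → Bool
    N = class Q P′
    -- Both palettes shrink by one: `covers` puts the class `j` of `γ` inside `N`, and `N` is the
    -- whole class `suc j` of `C′`.
    rec : suc j ⊢ paint N nothing C′ ≈ paint N nothing γ
    rec = all-equivalent j {without A N} (without-irr {A} {N} irr) (without-no-detour A N nd)
      (erase-colouring (class-symm Q P′) Q (λ h e → ℕₚ.≤∧≢⇒< (ℕₚ.≤-pred (bounded Q e))
        (λ { refl → true≢false (trans (sym (class-true Q P′ (covers e))) h) })))
      (erase-colouring (class-symm Q P′) P′ (λ h e → ℕₚ.≤∧≢⇒< (ℕₚ.≤-pred (bounded P′ e))
        (λ { refl → true≢false (trans (sym (class-true Q P′ e)) h) })))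
    repaint : C′ ≐ paint N (just (suc j)) (paint N nothing C′)
    repaint x y with N x y in h
    ... | true  = trans (class-inv Q P′ h) (sym (paint-on h))
    ... | false = sym (trans (paint-off h) (paint-off h))
    repaint-γ : paint N (just (suc j)) (paint N nothing γ) ≐ paint N (just (suc j)) γ
    repaint-γ x y with N x y in h
    ... | true  = trans (paint-on h) (sym (paint-on h))
    ... | false = trans (paint-off h) (trans (paint-off h) (sym (paint-off h)))

-- From colourings back to graphs and edge maps

T⇒true : ∀ {b} → T b → b ≡ true
T⇒true {true} _ = refl

true⇒T : ∀ {b} → b ≡ true → T b
true⇒T refl = tt

T-unique : ∀ {b} (p q : T b) → p ≡ q
T-unique {true} _ _ = refl

module _ {n : ℕ} (G : Graph n) where
  open Graph G renaming (adj to A; sym to A-symm)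

  -- Simple routes and chords

  data Route (R : Rel (Fin n) 0ℓ) : Fin n → Fin n → List (Fin n) → Set where
    stop : ∀ {y} → Route R y y (y ∷ [])
    hop  : ∀ {x w y ws} → R x w → x ∉ ws → Route R w y ws → Route R x y (x ∷ ws)

  module _ {R : Rel (Fin n) 0ℓ} where

    route-suffix : ∀ {a x y ws} → a ∈ ws → Route R x y ws → ∃[ us ] Route R a y us
    route-suffix (here refl) r@(stop)     = _ , r
    route-suffix (here refl) r@(hop _ _ _) = _ , r
    route-suffix (there i)   (hop _ _ r)  = route-suffix i r

    route : ∀ {x y} → Star R x y → ∃[ ws ] Route R x y ws
    route ε = _ , stop
    route {x} (r ◅ rs) with route rs
    ... | ws , p with DecMembership._∈?_ Fin._≟_ x ws
    ...   | yes x∈ = route-suffix x∈ p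
    ...   | no x∉  = _ , hop r x∉ p

    route-first : ∀ {x y ws} → Route R x y ws → (i : Fin (length ws)) → toℕ i ≡ 0 → lookup ws i ≡ x
    route-first stop zero _ = refl
    route-first (hop _ _ _) zero _ = refl

    route-last : ∀ {x y ws} → Route R x y ws → (i : Fin (length ws)) → suc (toℕ i) ≡ length ws → lookup ws i ≡ y
    route-last stop zero _ = refl
    route-last (hop _ _ stop) (suc zero) _ = refl
    route-last (hop _ _ p@(hop _ _ _)) (suc i) e = route-last p i (ℕₚ.suc-injective e)
    route-last (hop _ _ (hop _ _ stop)) zero ()
    route-last (hop _ _ (hop _ _ (hop _ _ _))) zero ()

    route-next : ∀ {x y ws} → Route R x y ws → (i j : Fin (length ws)) → toℕ j ≡ suc (toℕ i) →
                 R (lookup ws i) (lookup ws j)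
    route-next (hop r _ p) zero (suc j) e = subst (R _) (sym (route-first p j (ℕₚ.suc-injective e))) r
    route-next (hop _ _ p) (suc i) (suc j) e = route-next p i j (ℕₚ.suc-injective e)
    route-next stop zero zero ()

    route-injective : ∀ {x y ws} → Route R x y ws → (i j : Fin (length ws)) → lookup ws i ≡ lookup ws j → i ≡ j
    route-injective stop zero zero _ = refl
    route-injective (hop _ _ _) zero zero _ = refl
    route-injective (hop {ws = ws} _ x∉ _) zero (suc j) e = contradiction (subst (_∈ ws) (sym e) (∈-lookup j)) x∉
    route-injective (hop {ws = ws} _ x∉ _) (suc i) zero e = contradiction (subst (_∈ ws) e (∈-lookup i)) x∉
    route-injective (hop _ _ p) (suc i) (suc j) e = cong suc (route-injective p i j e)

  triangle-free⇒no-detour : TriangleFree G → NoDetour A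
  triangle-free⇒no-detour tf xy yz xz _ = tf _ _ _ (true⇒T xy) (true⇒T yz) (true⇒T xz)

  -- A detour from `x` to `y`, shortened to a simple route, closes up through `z` to a cycle in
  -- which `xy` is a chord.
  chordless⇒no-detour : Chordless G → NoDetour A
  chordless⇒no-detour ch {x} {y} {z} xy yz xz st = shape (proj₂ (route st))
    where
    x≢y : x ≢ y
    x≢y refl = true≢false (trans (sym xy) (irrefl x))
    zx : A z x ≡ true
    zx = trans (A-symm z x) xz
    zy : A z y ≡ true
    zy = trans (A-symm z y) yz
    long : ∀ {ws} → 3 ≤ length ws → Route (Detour A x y z) x y ws → ⊥
    long {ws} 3≤ p = ch (suc (length ws)) C (suc first) (suc last) distinct-ends not-consecutive
                        (true⇒T (subst₂ (λ a b → A a b ≡ true) (sym (route-first p first first-0)) (sym (route-last p last last-ℓ)) xy))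
      where
      z∉ : ∀ {a ws} → a ≢ z → Route (Detour A x y z) a y ws → z ∉ ws
      z∉ a≢z stop (here refl) = a≢z refl
      z∉ a≢z (hop _ _ _) (here refl) = a≢z refl
      z∉ a≢z (hop ((_ , _ , w≢z) , _) _ q) (there i) = z∉ w≢z q i
      z∉ws : z ∉ ws
      z∉ws = z∉ (λ { refl → true≢false (trans (sym xz) (irrefl z)) }) p
      0<ℓ : 0 < length ws
      0<ℓ = ℕₚ.≤-trans (s≤s z≤n) 3≤
      1+pred : suc (length ws ∸ 1) ≡ length ws
      1+pred = ℕₚ.m+[n∸m]≡n 0<ℓ
      first last : Fin (length ws)
      first = fromℕ< 0<ℓ
      last = fromℕ< {length ws ∸ 1} (ℕₚ.≤-reflexive 1+pred)
      first-0 : toℕ first ≡ 0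
      first-0 = Finₚ.toℕ-fromℕ< 0<ℓ
      last-ℓ : suc (toℕ last) ≡ length ws
      last-ℓ = trans (cong suc (Finₚ.toℕ-fromℕ< (ℕₚ.≤-reflexive 1+pred))) 1+pred
      distinct-ends : suc first ≢ suc last
      distinct-ends e = ℕₚ.<⇒≢ (ℕₚ.≤-trans (s≤s (s≤s z≤n)) 3≤)
        (trans (cong suc (trans (sym first-0) (cong toℕ (Finₚ.suc-injective e)))) last-ℓ)
      not-consecutive : ¬ Consecutive G (suc first) (suc last)
      not-consecutive (inj₁ (inj₁ e)) = ℕₚ.<⇒≢ 3≤ (sym (trans (sym last-ℓ) (trans e (cong (λ m → ℕ.suc (ℕ.suc m)) first-0))))
      not-consecutive (inj₁ (inj₂ e)) = case trans (sym first-0) (ℕₚ.suc-injective e) of λ ()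
      not-consecutive (inj₂ (inj₁ (() , _)))
      not-consecutive (inj₂ (inj₂ (() , _)))
      vs : List (Fin n)
      vs = z ∷ ws
      injective : ∀ {i j : Fin (length vs)} → lookup vs i ≡ lookup vs j → i ≡ j
      injective {zero} {zero} e = refl
      injective {zero} {suc j} e = contradiction (subst (_∈ ws) (sym e) (∈-lookup j)) z∉ws
      injective {suc i} {zero} e = contradiction (subst (_∈ ws) e (∈-lookup i)) z∉ws
      injective {suc i} {suc j} e = cong suc (route-injective p i j e)
      forward : ∀ i j → toℕ j ≡ suc (toℕ i) → A (lookup vs i) (lookup vs j) ≡ true
      forward zero (suc j) e = subst (λ a → A z a ≡ true) (sym (route-first p j (ℕₚ.suc-injective e))) zx
      forward (suc i) (suc j) e = proj₁ (proj₁ (route-next p i j (ℕₚ.suc-injective e)))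
      around : ∀ i j → toℕ i ≡ 0 → toℕ j ≡ length vs ∸ 1 → A (lookup vs i) (lookup vs j) ≡ true
      around zero zero _ e = contradiction e (ℕₚ.<⇒≢ 0<ℓ)
      around zero (suc j) _ e = subst (λ a → A z a ≡ true) (sym (route-last p j e)) zy
      C : Cycle G (length vs)
      C = record { len≥3 = ℕₚ.m≤n⇒m≤1+n 3≤ ; vtx = lookup vs ; distinct = injective ; closed = adjacent }
        where
        adjacent : ∀ i j → Consecutive G i j → Adj G (lookup vs i) (lookup vs j)
        adjacent i j (inj₁ (inj₁ e)) = true⇒T (forward i j e)
        adjacent i j (inj₁ (inj₂ e)) = true⇒T (trans (A-symm _ _) (forward j i e))
        adjacent i j (inj₂ (inj₁ (e , f))) = true⇒T (around i j e f)
        adjacent i j (inj₂ (inj₂ (e , f))) = true⇒T (trans (A-symm _ _) (around j i e f))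
    -- Routes with fewer than three vertices are impossible, as `x` differs from `y` and the edge
    -- `xy` is barred; so the ends are not consecutive on the cycle.
    shape : ∀ {ws} → Route (Detour A x y z) x y ws → ⊥
    shape stop = x≢y refl
    shape (hop (_ , ¬xy , _) _ stop) = ¬xy (refl , refl)
    shape p@(hop _ _ (hop _ _ stop)) = long (s≤s (s≤s (s≤s z≤n))) p
    shape p@(hop _ _ (hop _ _ (hop _ _ _))) = long (s≤s (s≤s (s≤s z≤n))) p

  -- Edge maps as colourings

  data Joins (e : Edge G) (x y : Fin n) : Set where
    along   : Edge.lo e ≡ x → Edge.hi e ≡ y → Joins e x y
    against : Edge.lo e ≡ y → Edge.hi e ≡ x → Joins e x y

  edge-≡ : ∀ {e f : Edge G} → Edge.lo e ≡ Edge.lo f → Edge.hi e ≡ Edge.hi f → e ≡ f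
  edge-≡ {edge lo hi p a} {edge _ _ q b} refl refl with ℕₚ.<-irrelevant p q | T-unique a b
  ... | refl | refl = refl

  joins-unique : ∀ {e f x y} → Joins e x y → Joins f x y → e ≡ f
  joins-unique {e} {f} (along refl refl) (along p q) = edge-≡ (sym p) (sym q)
  joins-unique {e} {f} (against refl refl) (against p q) = edge-≡ (sym p) (sym q)
  joins-unique {e} {f} (along refl refl) (against p q) =
    contradiction (Edge.lo<hi e) (ℕₚ.<-asym (subst₂ (λ a b → toℕ a < toℕ b) p q (Edge.lo<hi f)))
  joins-unique {e} {f} (against refl refl) (along p q) =
    contradiction (Edge.lo<hi e) (ℕₚ.<-asym (subst₂ (λ a b → toℕ a < toℕ b) p q (Edge.lo<hi f)))

  joins-flip : ∀ {e x y} → Joins e x y → Joins e y x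
  joins-flip (along p q)   = against p q
  joins-flip (against p q) = along p q

  edge-between : ∀ {x y} → A x y ≡ true → ∃[ e ] Joins e x y
  edge-between {x} {y} a with Finₚ.<-cmp x y
  ... | tri< x<y _ _ = edge x y x<y (true⇒T a) , along refl refl
  ... | tri≈ _ refl _ = contradiction (trans (sym a) (irrefl x)) true≢false
  ... | tri> _ _ y<x = edge y x y<x (true⇒T (trans (A-symm y x) a)) , against refl refl

  joins-adj : ∀ {e x y} → Joins e x y → A x y ≡ true
  joins-adj {e} (along refl refl) = T⇒true (Edge.isEdge e)
  joins-adj {e} (against refl refl) = trans (A-symm _ _) (T⇒true (Edge.isEdge e))

  joins-share : ∀ {e f x y z} → Joins e x y → Joins f x z → ShareEnd G e f
  joins-share (along refl _) (along refl _) = inj₁ (inj₁ refl)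
  joins-share (along refl _) (against _ refl) = inj₁ (inj₂ refl)
  joins-share (against _ refl) (along refl _) = inj₂ (inj₁ refl)
  joins-share (against _ refl) (against _ refl) = inj₂ (inj₂ refl)

  Represents : ∀ {t} → EdgeMap G t → Colouring n → Set
  Represents α C = ∀ e → C (Edge.lo e) (Edge.hi e) ≡ just (toℕ (α e))

  module _ {t : ℕ} (α : EdgeMap G t) where

    private
      -- The Boolean is an argument of its own so that the lemmas below can match on it together
      -- with its equation.
      entry : ∀ x y b → A x y ≡ b → Maybe ℕ
      entry x y true  a = just (toℕ (α (proj₁ (edge-between a))))
      entry x y false _ = nothing

      entry-on : ∀ {e x y} → Joins e x y → ∀ b (a : A x y ≡ b) → entry x y b a ≡ just (toℕ (α e))
      entry-on j true  a = cong (just ∘ toℕ ∘ α) (joins-unique (proj₂ (edge-between a)) j)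
      entry-on j false a = contradiction (trans (sym (joins-adj j)) a) true≢false

      entry-inv : ∀ {x y c} b (a : A x y ≡ b) → entry x y b a ≡ just c → ∃[ e ] Joins e x y × toℕ (α e) ≡ c
      entry-inv true a refl = _ , proj₂ (edge-between a) , refl

      entry-support : ∀ {x y} b (a : A x y ≡ b) → is-just (entry x y b a) ≡ b
      entry-support true  a = refl
      entry-support false a = refl

    opaque

      colouring : Colouring n
      colouring x y = entry x y (A x y) refl

      colouring-on : ∀ {e x y} → Joins e x y → colouring x y ≡ just (toℕ (α e))
      colouring-on j = entry-on j _ refl

      colouring-inv : ∀ {x y c} → colouring x y ≡ just c → ∃[ e ] Joins e x y × toℕ (α e) ≡ c
      colouring-inv = entry-inv _ refl

      colouring-support : ∀ x y → is-just (colouring x y) ≡ A x y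
      colouring-support x y = entry-support _ refl

    colouring-represents : Represents α colouring
    colouring-represents e = colouring-on (along refl refl)

    colouring-symm : ∀ x y → colouring x y ≡ colouring y x
    colouring-symm x y with colouring x y in p | colouring y x in q
    ... | nothing | nothing = refl
    ... | just c | m = let (e , j , h) = colouring-inv p in
      trans (cong just (sym h)) (trans (sym (colouring-on (joins-flip j))) q)
    ... | nothing | just c = let (e , j , h) = colouring-inv q in
      trans (sym p) (trans (colouring-on (joins-flip j)) (cong just h))

    is-colouring : Proper G α → IsColouring A t colouring
    is-colouring prop = record
      { proper = record { symm = colouring-symm ; uniq = unique }
      ; support = colouring-support
      ; bounded = λ h → let (e , _ , c) = colouring-inv h in subst (_< t) c (Finₚ.toℕ<n (α e)) }
      where
      joins-end : ∀ {e x y z} → Joins e x y → Joins e x z → y ≡ z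
      joins-end (along refl refl) (along _ q) = q
      joins-end (against refl refl) (against q _) = q
      joins-end (along refl refl) (against p q) = trans q p
      joins-end (against refl refl) (along p q) = trans p q
      unique : ∀ {x y z c} → colouring x y ≡ just c → colouring x z ≡ just c → y ≡ z
      unique {x} {y} {z} p q with colouring-inv p | colouring-inv q
      ... | e , j , h | f , j′ , h′ with y Fin.≟ z
      ...   | yes y≡z = y≡z
      ...   | no y≢z = contradiction (Finₚ.toℕ-injective (trans h (sym h′))) (prop e f (different , joins-share j j′))
        where
        different : ¬ SameEdge G e f
        different (lo≡ , hi≡) with edge-≡ {e} {f} lo≡ hi≡
        ... | refl = y≢z (joins-end j j′)

  -- Kempe moves on closed sets as sequences of Kempe changes

  module _ {t : ℕ} where

    private
      fin : ∀ {c} → c < t → Fin t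
      fin p = fromℕ< p

      toℕ-fin : ∀ {c} (p : c < t) → toℕ (fin p) ≡ c
      toℕ-fin p = Finₚ.toℕ-fromℕ< p

    edge-map : ∀ {C} → IsColouring A t C → EdgeMap G t
    edge-map P e = fin (bounded P (proj₂ (colour P (T⇒true (Edge.isEdge e)))))

    edge-map-represents : ∀ {C} (P : IsColouring A t C) → Represents (edge-map P) C
    edge-map-represents P e = trans (proj₂ (colour P (T⇒true (Edge.isEdge e))))
                                    (cong just (sym (toℕ-fin (bounded P (proj₂ (colour P (T⇒true (Edge.isEdge e))))))))

    represents-joins : ∀ {α : EdgeMap G t} {C e x y} → IsColouring A t C → Represents α C → Joins e x y → C x y ≡ just (toℕ (α e))
    represents-joins P rep (along refl refl) = rep _
    represents-joins P rep (against refl refl) = trans (symm P _ _) (rep _)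

    module _ {α : EdgeMap G t} {C : Colouring n} (P : IsColouring A t C) (rep : Represents α C)
             {c d : ℕ} (c<t : c < t) (d<t : d < t) (c≢d : c ≢ d) (x y : Fin n) (xy : Bicoloured C c d x y) where

      private
        K : Component {R = Bicoloured C c d} x
        K = chain C c d x
        M : VSet n
        M = Component.mem K
        K-closed : Closed C c d M
        K-closed = chain-closed (proper P) K
        P₁ : IsColouring A t (swap c d M C)
        P₁ = swap-colouring c<t d<t K-closed P
        β : EdgeMap G t
        β = edge-map P₁
        adj-bi : ∀ {a b} → Bicoloured C c d a b → A a b ≡ true
        adj-bi = [ adj P , adj P ]′
        e₀ : Edge G
        e₀ = proj₁ (edge-between (adj-bi xy))
        e₀-joins : Joins e₀ x y
        e₀-joins = proj₂ (edge-between (adj-bi xy))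
        InK : Edge G → Set
        InK f = InPair G (fin c<t) (fin d<t) (α f)
        coloured : ∀ {f a b} → Joins f a b → Bicoloured C c d a b → InK f
        coloured {f} j = Sum.map (same c<t) (same d<t)
          where
          same : ∀ {e} (e<t : e < t) → C _ _ ≡ just e → α f ≡ fin e<t
          same e<t h = Finₚ.toℕ-injective (trans (Maybeₚ.just-injective (trans (sym (represents-joins P rep j)) h)) (sym (toℕ-fin e<t)))
        bicoloured : ∀ {f} → InK f → Bicoloured C c d (Edge.lo f) (Edge.hi f)
        bicoloured {f} = Sum.map (λ h → trans (rep f) (cong just (trans (cong toℕ h) (toℕ-fin c<t))))
                                 (λ h → trans (rep f) (cong just (trans (cong toℕ h) (toℕ-fin d<t))))
        ends : ∀ {f} → InK f → M (Edge.lo f) ≡ M (Edge.hi f)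
        ends h = same-side K-closed (bicoloured h)
        Chain : Edge G → Set
        Chain = KChain G α (fin c<t) (fin d<t) e₀
        chain-inside : ∀ {f} → Chain f → InK f × M (Edge.lo f) ≡ true
        chain-inside (here h) = h , root e₀-joins
          where
          root : Joins e₀ x y → M (Edge.lo e₀) ≡ true
          root (along p _) = subst (λ z → M z ≡ true) (sym p) (Component.root K)
          root (against _ p) = trans (ends h) (subst (λ z → M z ≡ true) (sym p) (Component.root K))
        chain-inside (step {f} {g} k share h) with chain-inside k
        ... | hf , lo∈ = h , touch share
          where
          touch : ShareEnd G f g → M (Edge.lo g) ≡ true
          touch (inj₁ (inj₁ p)) = subst (λ z → M z ≡ true) p lo∈
          touch (inj₁ (inj₂ p)) = trans (ends h) (subst (λ z → M z ≡ true) p lo∈)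
          touch (inj₂ (inj₁ p)) = subst (λ z → M z ≡ true) p (trans (sym (ends hf)) lo∈)
          touch (inj₂ (inj₂ p)) = trans (ends h) (subst (λ z → M z ≡ true) p (trans (sym (ends hf)) lo∈))
        -- A property of all edges at a vertex, so that it can be carried along a walk of vertices
        -- whose next edge is arbitrary.
        Touching : Fin n → Set
        Touching z = ∀ {g w} → Joins g z w → InK g → Chain g
        spreading : ∀ {a z} → Touching a → Star (Bicoloured C c d) a z → Touching z
        spreading h ε = h
        spreading h (r ◅ rs) with edge-between (adj-bi r)
        ... | e , j = spreading (λ j′ → step (h j (coloured j r)) (joins-share (joins-flip j) j′)) rs
        at-root : Touching x
        at-root j = step (here (coloured e₀-joins xy)) (joins-share e₀-joins j)
        inside-chain : ∀ {f} → InK f → M (Edge.lo f) ≡ true → Chain f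
        inside-chain {f} h lo∈ = spreading at-root (Component.reached K lo∈) (along refl refl) h
        value : ∀ f {e} → swap c d M C (Edge.lo f) (Edge.hi f) ≡ just e → toℕ (β f) ≡ e
        value f h = Maybeₚ.just-injective (trans (sym (edge-map-represents P₁ f)) h)

      -- The chain of edges through `e₀` consists of the edges of the two colours inside the vertex
      -- component `M`: a step between edges stays in `M`, and walks in `M` can be followed edge by
      -- edge.
      kempe-change : KChange G α β
      kempe-change = fin c<t , fin d<t , (λ h → c≢d (trans (sym (toℕ-fin c<t)) (trans (cong toℕ h) (toℕ-fin d<t)))) , e₀ ,
        λ f → (λ k → exchanged f c<t d<t (proj₂ (chain-inside k)) (exchange-l c d)
                   , exchanged f d<t c<t (proj₂ (chain-inside k)) (exchange-r c d))
            , unchanged f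
        where
        exchanged : ∀ f {a b} (a<t : a < t) (b<t : b < t) → M (Edge.lo f) ≡ true → exchange c d a ≡ b →
                    α f ≡ fin a<t → β f ≡ fin b<t
        exchanged f a<t b<t lo∈ ab h = Finₚ.toℕ-injective (trans (value f (trans (swap-in-just lo∈
          (trans (rep f) (cong just (trans (cong toℕ h) (toℕ-fin a<t))))) (cong just ab))) (sym (toℕ-fin b<t)))
        unchanged : ∀ f → ¬ Chain f → β f ≡ α f
        unchanged f ¬k = by-side (M (Edge.lo f)) refl (bicoloured? C c d (Edge.lo f) (Edge.hi f))
          where
          by-side : ∀ b → M (Edge.lo f) ≡ b → Dec (Bicoloured C c d (Edge.lo f) (Edge.hi f)) → β f ≡ α f
          by-side false lo∉ _       = Finₚ.toℕ-injective (value f (trans (swap-out _ lo∉) (rep f)))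
          by-side true lo∈ (yes h)  = contradiction (inside-chain (coloured (along refl refl) h) lo∈) ¬k
          by-side true _   (no ¬h)  = Finₚ.toℕ-injective (value f (trans (swap-fix (¬h ∘ inj₁) (¬h ∘ inj₂)) (rep f)))

    Realised : EdgeMap G t → Colouring n → Set
    Realised α D = ∃[ γ ] Star (KChange G) α γ × Represents γ D

    realised-≐ : ∀ {α : EdgeMap G t} {C D} → C ≐ D → Realised α C → Realised α D
    realised-≐ e (γ , st , rep) = γ , st , λ f → trans (sym (e _ _)) (rep f)

    swap-same : ∀ {c S} {C : Colouring n} → C ≐ swap c c S C
    swap-same {c} {S} {C} x y with S x in h | C x y in e
    ... | false | _ = sym (trans (swap-out y h) e)
    ... | true | nothing = sym (trans (swap-in y h) (cong (Maybe.map _) e))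
    ... | true | just f = sym (trans (swap-in-just h e) (cong just (exchange-same c f)))

    -- The components of `S` are swapped one at a time. A vertex without edges of either colour
    -- yields no Kempe change, as there is no edge to name the chain, but it still leaves `S`, and
    -- the count drops.
    realise-swap : ∀ p {α : EdgeMap G t} {C c d S} → IsColouring A t C → Represents α C → c < t → d < t → c ≢ d → Closed C c d S →
                   count S < p → Realised α (swap c d S C)
    realise-swap (suc p) {α} {C} {c} {d} {S} P rep c<t d<t c≢d cl (s≤s le) with Finₚ.any? (λ x → S x Boolₚ.≟ true)
    ... | no none = α , ε , λ f → trans (swap-out _ (Boolₚ.¬-not (λ h → none (_ , h)))) (rep f)
    ... | yes (x , x∈) with first-swap
      where
      M : VSet n
      M = Component.mem (chain C c d x)
      first-swap : Realised α (swap c d M C)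
      first-swap with Finₚ.any? (bicoloured? C c d x)
      ... | yes (y , xy) = _ , kempe-change P rep c<t d<t c≢d x y xy ◅ ε
                             , edge-map-represents (swap-colouring c<t d<t (chain-closed (proper P) (chain C c d x)) P)
      ... | no none = α , ε , λ f → trans (still _ _) (rep f)
        where
        only : ∀ {z} → Star (Bicoloured C c d) x z → z ≡ x
        only ε       = refl
        only (r ◅ _) = contradiction (_ , r) none
        still : ∀ a b → swap c d M C a b ≡ C a b
        still a b with M a in h
        ... | false = swap-out b h
        ... | true with only (Component.reached (chain C c d x) h)
        ...   | refl = swap-fix (λ e → none (b , inj₁ e)) (λ e → none (b , inj₂ e))
    ... | γ , st , rep₁ = second-swap (realise-swap p P₁ rep₁ c<t d<t c≢d cl₁ (ℕₚ.<-≤-trans (count-strict sub x x∉ x∈) le))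
      where
      M : VSet n
      M = Component.mem (chain C c d x)
      M-closed : Closed C c d M
      M-closed = chain-closed (proper P) (chain C c d x)
      P₁ : IsColouring A t (swap c d M C)
      P₁ = swap-colouring c<t d<t M-closed P
      M⊆S : ∀ {z} → M z ≡ true → S z ≡ true
      M⊆S h = stay-in x∈ (Component.reached (chain C c d x) h)
        where
        stay-in : ∀ {a z} → S a ≡ true → Star (Bicoloured C c d) a z → S z ≡ true
        stay-in a∈ ε = a∈
        stay-in a∈ (r ◅ rs) = stay-in (trans (sym (same-side cl r)) a∈) rs
      cl₁ : Closed (swap c d M C) c d (S ∖ M)
      cl₁ = swap-closed (∖-closed cl M-closed)
      sub : ∀ z → (S ∖ M) z ≡ true → S z ≡ true
      sub z = ∖-⊆
      x∉ : (S ∖ M) x ≡ false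
      x∉ = ∖-∉ (Component.root (chain C c d x))
      combined : swap c d (S ∖ M) (swap c d M C) ≐ swap c d S C
      combined a b with M a in h
      ... | true  = trans (swap-out b (∖-∉ h)) (swap-agree (trans h (sym (M⊆S h))) refl)
      ... | false = swap-agree (∖-off h) (swap-out b h)
      second-swap : Realised γ (swap c d (S ∖ M) (swap c d M C)) → Realised α (swap c d S C)
      second-swap (γ′ , st′ , rep′) = realised-≐ combined (γ′ , st ◅◅ st′ , rep′)

    realise : ∀ {α : EdgeMap G t} {C D} → t ⊢ C ≈ D → IsColouring A t C → Represents α C → Realised α D
    realise (pointwise e) P rep = realised-≐ e (_ , ε , rep)
    -- `kempe` permits equal colours whereas `KChange` does not; in that case the swap is the
    -- identity.
    realise (kempe c d S c<t d<t cl) P rep with c ℕ.≟ d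
    ... | yes refl = realised-≐ swap-same (_ , ε , rep)
    ... | no c≢d   = realise-swap _ P rep c<t d<t c≢d cl (ℕₚ.n<1+n _)
    realise (transᴷ p q) P rep with realise p P rep
    ... | γ , st , rep₁ with realise q (≈-colouring p P) rep₁
    ...   | δ , st′ , rep₂ = δ , st ◅◅ st′ , rep₂

theorem1p2 : (n : ℕ) (G : Graph n) →
    IsChromaticIndex G (maxDegree G) →
    TriangleFree G ⊎ Chordless G →
    (α β : EdgeMap G (suc (maxDegree G))) →
    Proper G α → Proper G β →
    KEquivalent G α β
theorem1p2 n G ((γ , γ-proper) , _) tf-or-ch α β α-proper β-proper
  with realise G (transᴷ (to-γ α-proper) (symᴷ (to-γ β-proper))) (is-colouring G α α-proper) (colouring-represents G α)
  where
  no-detour : NoDetour (Graph.adj G)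
  no-detour = [ triangle-free⇒no-detour G , chordless⇒no-detour G ]′ tf-or-ch
  to-γ : ∀ {α : EdgeMap G (suc (maxDegree G))} → Proper G α → suc (maxDegree G) ⊢ colouring G α ≈ colouring G γ
  to-γ {α} p = all-equivalent (maxDegree G) (Graph.irrefl G) no-detour (is-colouring G γ γ-proper) (is-colouring G α p)
... | δ , st , rep = δ , st , λ f → Finₚ.toℕ-injective
      (Maybeₚ.just-injective (trans (sym (rep f)) (colouring-represents G β f)))
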